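{- For all natural numbers $n$ and $d$, there is a one-to-one correspondence between rooted planar maps with $n$ edges and outer face degree $d$, and normal planar lambda terms with one free variable whose $R$-coloring has size $n+1$ (i.e. $n+1$ uses of the rule $s$) and which have exactly $d+1$ outer neutral handles.
   Context: Lambda skeletons: graded sets $\Lambda(i)$, $i\in\mathbb{N}$, least such that $\_\in\Lambda(1)$; if $p\in\Lambda(j)$, $q\in\Lambda(k)$ then $p(q)\in\Lambda(j+k)$; if $p\in\Lambda(i+1)$ then $\lambda\_.p\in\Lambda(i)$. A planar lambda term $[\Gamma]t$ decorating $p$ (with $\Gamma$ a list of variables) is defined by: $[x]x$ decorates $\_$; if $[\Gamma]t$ decorates $p$ and $[\Delta]u$ decorates $q$ then $[\Gamma,\Delta]t(u)$ decorates $p(q)$; if $[x,\Gamma]t$ decorates $p$ then $[\Gamma]\lambda x.t$ decorates $\lambda\_.p$. Terms are taken modulo renaming of variables ($\alpha$-equivalence). Colorings: two graded sets $\Lambda_B(i)$ (neutral, "blue") and $\Lambda_R(i)$ (normal, "red") of skeletons defined by rules $v$: $\_\in\Lambda_B(1)$; $a$: if $p\in\Lambda_B(j)$, $q\in\Lambda_R(k)$ then $p(q)\in\Lambda_B(j+k)$; $s$: if $p\in\Lambda_B(i)$ then $p\in\Lambda_R(i)$; $\ell$: if $p\in\Lambda_R(i+1)$ then $\lambda\_.p\in\Lambda_R(i)$. A $c$-coloring ($c\in\{B,R\}$) of a term is a derivation of its skeleton in $\Lambda_c(i)$; it is unique when it exists. A term is normal if it has an $R$-coloring and neutral if it has a $B$-coloring;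 the size $|\pi|$ of a coloring $\pi$ is the number of uses of rule $s$. Outer neutral handles: for a neutral or normal planar term $[\Gamma]t$ with coloring $\pi$, a neutral handle is an occurrence of a neutral subterm (the subterm of a $B$-colored subderivation); the ordered list $\mathrm{ONH}(\pi)$ is defined inductively: if $\pi$ is rule $v$ for $[x]x$, $\mathrm{ONH}(\pi)=(x)$; if $\pi$ is rule $a$ from $\pi_1$ for $[\Gamma]t$ and $\pi_2$ for $[\Delta]u$, $\mathrm{ONH}(\pi)$ is the whole $t(u)$, followed by the handles of $\pi_2$ (inside $u$), followed, only when $\Delta$ is empty, by the handles of $\pi_1$ (inside $t$); if $\pi$ ends in $s$ or $\ell$ with premise $\pi_1$, $\mathrm{ONH}(\pi)$ consists of the handles of $\pi_1$. Rooted planar maps: a planar map is a connected graph (loops and multiple edges allowed) embedded in the sphere, partitioning it into vertices, edges and faces homeomorphic to open disks; a rooting is a choice of an oriented edge (dart), except for the vertex map (one vertex, no edges) which is rooted by default; rooted maps are taken up to root-preserving homeomorphism. The outer face is the face to the left of the root dart, and its degree counts the darts incident to it (an isthmus counting twice); the vertex map has outer face degree $0$. -}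

module Defs where

open import Data.Nat using (ℕ; zero; suc; _+_; _*_; _≤ᵇ_)
open import Data.Bool using (Bool; true; false; if_then_else_; _∧_; _∨_)
open import Data.Fin using (Fin; toℕ; _≟_)
open import Data.Fin.Permutation using (Permutation′; _⟨$⟩ʳ_)
open import Data.List using (List; []; _∷_; _++_; length)
open import Data.Product using (Σ; _×_; _,_; proj₁)
open import Data.Unit using (⊤)
open import Relation.Binary.PropositionalEquality using (_≡_; _≢_)
open import Relation.Nullary.Decidable using (⌊_⌋)

-- Planar lambda terms.
-- A planar term [Γ]t decorating a skeleton p ∈ Λ(i) is unique up to
-- α-equivalence (variables are bound/used exactly once, in order), so
-- planar terms with i free variables modulo α are represented by their
-- skeletons Λ(i).

data Sk : ℕ → Set where
  var : Sk 1
  app : ∀ {j k} → Sk j → Sk k → Sk (j + k)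
  lam : ∀ {i} → Sk (suc i) → Sk i

mutual
  data Neu : ∀ {i} → Sk i → Set where
    v : Neu var
    a : ∀ {j k} {p : Sk j} {q : Sk k} → Neu p → Nor q → Neu (app p q)

  data Nor : ∀ {i} → Sk i → Set where
    s : ∀ {i} {p : Sk i} → Neu p → Nor p
    ℓ : ∀ {i} {p : Sk (suc i)} → Nor p → Nor (lam p)

mutual
  sizeB : ∀ {i} {p : Sk i} → Neu p → ℕ
  sizeB v = 0
  sizeB (a π₁ π₂) = sizeB π₁ + sizeR π₂

  sizeR : ∀ {i} {p : Sk i} → Nor p → ℕ
  sizeR (s π) = suc (sizeB π)
  sizeR (ℓ π) = sizeR π

-- A handle occurrence, recorded as the (neutral) subterm it designates.
Handle : Set
Handle = Σ ℕ Sk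

mutual
  onhB : ∀ {i} {p : Sk i} → Neu p → List Handle
  onhB v = (1 , var) ∷ []
  onhB (a {j} {zero}  {p} {q} π₁ π₂) = (j + zero , app p q) ∷ (onhR π₂ ++ onhB π₁)
  onhB (a {j} {suc k} {p} {q} π₁ π₂) = (j + suc k , app p q) ∷ onhR π₂

  onhR : ∀ {i} {p : Sk i} → Nor p → List Handle
  onhR (s π) = onhB π
  onhR (ℓ π) = onhR π

NormalTerm : ℕ → ℕ → Set
NormalTerm n d = Σ (Sk 1) λ t → Σ (Nor t) λ π →
                   (sizeR π ≡ suc n) × (length (onhR π) ≡ suc d)

-- Rooted planar maps, combinatorially: darts Fin (2e); σ gives the
-- clockwise rotation of darts around each vertex, α the fixed-point-free
-- involution pairing the two darts of each edge; faces are the cycles of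
-- φ = σ ∘ α (face to the left of a dart).

iter : ∀ {m} → (Fin m → Fin m) → ℕ → Fin m → Fin m
iter f zero i = i
iter f (suc k) i = f (iter f k i)

anyBelow : ℕ → (ℕ → Bool) → Bool
anyBelow zero P = false
anyBelow (suc b) P = P b ∨ anyBelow b P

allBelow : ℕ → (ℕ → Bool) → Bool
allBelow zero P = true
allBelow (suc b) P = P b ∧ allBelow b P

countFin : ∀ m → (Fin m → Bool) → ℕ
countFin zero P = 0
countFin (suc m) P = (if P Fin.zero then 1 else 0) + countFin m (λ i → P (Fin.suc i))

-- number of cycles of a permutation f of Fin m: count the darts that are
-- the least element (w.r.t. toℕ) of their orbit {f^k i | k < m}
cycles : ∀ {m} → (Fin m → Fin m) → ℕ
cycles {m} f = countFin m λ i → allBelow m λ k → toℕ i ≤ᵇ toℕ (iter f k i)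

orbitSize : ∀ {m} → (Fin m → Fin m) → Fin m → ℕ
orbitSize {m} f r = countFin m λ j → anyBelow m λ k → ⌊ iter f k r ≟ j ⌋

-- reachability in the monoid generated by σ and α (= group, finite case)
data Reach {m} (σ α : Fin m → Fin m) : Fin m → Fin m → Set where
  here  : ∀ {i} → Reach σ α i i
  stepσ : ∀ {i j} → Reach σ α (σ i) j → Reach σ α i j
  stepα : ∀ {i j} → Reach σ α (α i) j → Reach σ α i j

record PlanarMap (e : ℕ) : Set where
  field
    σ α       : Permutation′ (2 * e)
    α-invol   : ∀ i → α ⟨$⟩ʳ (α ⟨$⟩ʳ i) ≡ i
    α-fpf     : ∀ i → α ⟨$⟩ʳ i ≢ i
    connected : ∀ i j → Reach (σ ⟨$⟩ʳ_) (α ⟨$⟩ʳ_) i j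
    -- Euler's formula V − E + F = 2 (genus 0)
    planar    : cycles (σ ⟨$⟩ʳ_) + cycles (λ i → σ ⟨$⟩ʳ (α ⟨$⟩ʳ i)) ≡ e + 2

  φ : Fin (2 * e) → Fin (2 * e)
  φ i = σ ⟨$⟩ʳ (α ⟨$⟩ʳ i)

-- rooted planar maps with e edges; e = 0: only the vertex map
RootedPlanarMap : ℕ → Set
RootedPlanarMap zero = ⊤
RootedPlanarMap (suc e) = PlanarMap (suc e) × Fin (2 * suc e)

outerDegree : ∀ e → RootedPlanarMap e → ℕ
outerDegree zero _ = 0
outerDegree (suc e) (M , r) = orbitSize (PlanarMap.φ M) r

RootedIso : ∀ e → RootedPlanarMap e → RootedPlanarMap e → Set
RootedIso zero _ _ = ⊤
RootedIso (suc e) (M , r) (M' , r') =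
  Σ (Permutation′ (2 * suc e)) λ τ →
    (∀ i → τ ⟨$⟩ʳ (PlanarMap.σ M ⟨$⟩ʳ i) ≡ PlanarMap.σ M' ⟨$⟩ʳ (τ ⟨$⟩ʳ i)) ×
    (∀ i → τ ⟨$⟩ʳ (PlanarMap.α M ⟨$⟩ʳ i) ≡ PlanarMap.α M' ⟨$⟩ʳ (τ ⟨$⟩ʳ i)) ×
    (τ ⟨$⟩ʳ r ≡ r')

RootedMap : ℕ → ℕ → Set
RootedMap n d = Σ (RootedPlanarMap n) λ M → outerDegree n M ≡ d

{-# OPTIONS --safe #-}
-- Rooted planar maps and normal planar terms with one free variable obey the same recursion, due to Tutte
-- for maps. If the root edge of a map is an isthmus, removing it leaves two maps, of outer degrees d₁ and d₂
-- with d = d₁ + d₂ + 2; if not, removing it leaves one map, of outer degree d′, and d − 1 ∈ {0, …, d′} tells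
-- where to put it back. In a term, look at the maximal application y(u₁)...(uₖ) headed by the free variable
-- y. If k > 0, then uₖ = λx.u, and removing uₖ leaves two terms with one free variable. If k = 0 and the term
-- is not just y, it is some λx.t in which y occurs as h(y); replacing h(y) by h turns t into a term with free
-- variable x and a distinguished outer neutral handle h.
--
-- On the map side, edges are deleted by multiplying φ and α by a transposition, which keeps the dart set.
-- Each deletion changes V, E, F and the number C of components in such a way that V − E + F ≤ 2C follows
-- by induction, and that the equality case, planarity, is inherited; in particular, deleting an edge of a
-- planar map disconnects it exactly when both sides of the edge lie on the same face.

module Submission where

open import Data.Nat using (ℕ; zero; suc; _+_; _*_; _∸_; _≤_; _<_; z≤n; s≤s)
import Data.Nat as ℕ
open import Data.Product using (Σ; ∃; _×_; _,_; proj₁; proj₂)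
open import Relation.Binary.PropositionalEquality using (_≡_; _≢_; refl; sym; trans; cong; cong₂; subst; subst₂; module ≡-Reasoning)
import Data.Nat.Properties as ℕₚ
open import Data.Empty using (⊥; ⊥-elim)
open import Data.Unit using (⊤; tt)
open import Data.Sum using (_⊎_; inj₁; inj₂; [_,_]′)
import Data.Sum as Sum
open import Data.Sum.Properties using (inj₁-injective; inj₂-injective)
open import Algebra.Properties.CommutativeSemigroup ℕₚ.+-commutativeSemigroup using (interchange)
open import Data.Sum.Function.Propositional using (_⊎-↔_)
open import Data.Fin using (Fin; toℕ; punchIn; punchOut)
import Data.Fin as Fin
import Data.Fin.Properties as Finₚ
open import Data.List using (List; []; _∷_; length)
import Data.List as List
open import Data.List.Properties using (length-++)
open import Data.List.Membership.Propositional using (_∈_)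
open import Data.List.Membership.Propositional.Properties using (∈-filter⁺; ∈-filter⁻; ∈-cartesianProduct⁺; ∈-map⁺; ∈-allFin)
open import Data.List.Relation.Unary.Any as Any using ()
open import Function using (_∘_; id; _↔_; Inverse; mk↔ₛ′)
open import Function.Construct.Composition using (_↔-∘_)
open import Function.Construct.Symmetry using (↔-sym)
open import Function.Definitions using (Injective)
open import Relation.Binary using (IsEquivalence; DecidableEquality; tri<; tri≈; tri>)
open import Relation.Binary.Construct.Closure.Equivalence as EqC using (EqClosure)
open import Relation.Binary.Construct.Closure.ReflexiveTransitive using (ε; _◅_)
open import Relation.Binary.Construct.Closure.Symmetric using (fwd; bwd)
open import Relation.Nullary using (¬_; Dec; yes; no)
open import Relation.Nullary.Decidable using (map′; _⊎-dec_; _×-dec_; ⌊_⌋; toWitness)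
open import Data.Fin.Permutation using (Permutation′; _⟨$⟩ʳ_)
open import Data.Nat.Solver using (module +-*-Solver)
open import Data.Bool using (Bool; true; false; if_then_else_)
import Data.Bool as Bool

-- Both sides are compared with `Tree`, whose constructors are the three cases of the recursion and
-- whose `edges` and `deg` carry the two parameters. The parameters match because inserting a new
-- last variable at the handle of index `i` leaves exactly `i + 2` outer handles: a map of outer
-- degree `d′` has `d′ + 1` places for a chord, and the corresponding term has `d′ + 1` handles. The
-- price of a fixed dart set is that the maps met in the induction are disconnected and contain
-- darts left over from earlier deletions. Isomorphism is therefore replaced by embedding: each tree
-- has a standard map with a marked dart, uniqueness says that two trees embedded in one map at the
-- same dart are equal, and existence asks only for a root that is the sole dead dart of its
-- component. Euler's inequality is proved for all these maps because it excludes that an edge with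
-- one face on both sides lies on a circuit, which is the combinatorial form of the Jordan curve
-- theorem.

record Finite (D : Set) : Set where
  field
    size : ℕ
    enum : D ↔ Fin size

  open Inverse enum public using (to; from) renaming (strictlyInverseʳ to from-to; strictlyInverseˡ to to-from)

  to-injective : Injective _≡_ _≡_ to
  to-injective {x} {y} eq = trans (sym (from-to x)) (trans (cong from eq) (from-to y))

  _≟_ : DecidableEquality D
  x ≟ y = map′ to-injective (cong to) (to x Fin.≟ to y)

  elements : List D
  elements = List.map from (List.allFin size)

  ∈-elements : ∀ x → x ∈ elements
  ∈-elements x = subst (_∈ elements) (from-to x) (∈-map⁺ from (∈-allFin (to x)))

⊥-finite : Finite ⊥
⊥-finite = record { size = 0 ; enum = ↔-sym Finₚ.0↔⊥ }

⊤-finite : Finite ⊤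
⊤-finite = record { size = 1 ; enum = ↔-sym Finₚ.1↔⊤ }

⊎-finite : ∀ {A B} → Finite A → Finite B → Finite (A ⊎ B)
⊎-finite F G = record
  { size = Finite.size F + Finite.size G
  ; enum = ↔-sym Finₚ.+↔⊎ ↔-∘ (Finite.enum F ⊎-↔ Finite.enum G) }

Fin-finite : ∀ m → Finite (Fin m)
Fin-finite m = record { size = m ; enum = mk↔ₛ′ id id (λ _ → refl) (λ _ → refl) }

-- Iterates of injections on finite sets

iterate : ∀ {D : Set} → (D → D) → ℕ → D → D
iterate f zero x = x
iterate f (suc n) x = f (iterate f n x)

iterate-comm : ∀ {D : Set} (f : D → D) n x → iterate f n (f x) ≡ f (iterate f n x)
iterate-comm f zero x = refl
iterate-comm f (suc n) x = cong f (iterate-comm f n x)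

iterate-+ : ∀ {D : Set} (f : D → D) m n x → iterate f (m + n) x ≡ iterate f m (iterate f n x)
iterate-+ f zero n x = refl
iterate-+ f (suc m) n x = cong f (iterate-+ f m n x)

iterate-hom : ∀ {D E : Set} {f : D → D} {g : E → E} (h : D → E) → (∀ x → h (f x) ≡ g (h x)) →
              ∀ n x → h (iterate f n x) ≡ iterate g n (h x)
iterate-hom h comm zero x = refl
iterate-hom {g = g} h comm (suc n) x = trans (comm _) (cong g (iterate-hom h comm n x))

iterate-injective : ∀ {D : Set} {f : D → D} → Injective _≡_ _≡_ f → ∀ n → Injective _≡_ _≡_ (iterate f n)
iterate-injective inj zero eq = eq
iterate-injective inj (suc n) eq = iterate-injective inj n (inj eq)

iterate-cancel : ∀ {D : Set} {f : D → D} → Injective _≡_ _≡_ f → ∀ {i j} x → i < j →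
                 iterate f i x ≡ iterate f j x → ∃ λ n → (suc n + i ≡ j) × iterate f (suc n) x ≡ x
iterate-cancel {f = f} inj {i} {j} x i<j eq = n , n+i≡j ,
  iterate-injective inj i (begin
    iterate f i (iterate f (suc n) x) ≡⟨ sym (iterate-+ f i (suc n) x) ⟩
    iterate f (i + suc n) x           ≡⟨ cong (λ k → iterate f k x) (trans (ℕₚ.+-comm i (suc n)) n+i≡j) ⟩
    iterate f j x                     ≡⟨ sym eq ⟩
    iterate f i x                     ∎)
  where
  open ≡-Reasoning
  n : ℕ
  n = j ∸ suc i
  n+i≡j : suc n + i ≡ j
  n+i≡j = trans (sym (ℕₚ.+-suc n i)) (ℕₚ.m∸n+n≡m i<j)

module _ {D : Set} (F : Finite D) where
  open Finite F

  abstract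
    finite-order : ∀ {f : D → D} → Injective _≡_ _≡_ f → ∀ x → ∃ λ n → iterate f (suc n) x ≡ x
    finite-order {f} inj x
      with i , j , i<j , eq ← Finₚ.pigeonhole (ℕₚ.n<1+n size) (λ k → to (iterate f (toℕ k) x))
      with n , _ , eq′ ← iterate-cancel inj x i<j (to-injective eq) = n , eq′

    injective⇒surjective : ∀ {f : D → D} → Injective _≡_ _≡_ f → ∀ y → ∃ λ x → f x ≡ y
    injective⇒surjective {f} inj y with n , eq ← finite-order inj y = iterate f n y , eq

-- Transpositions

data SwapCase {D : Set} (a b : D) : D → D → Set where
  left  : SwapCase a b a b
  right : SwapCase a b b a
  other : ∀ {x} → x ≢ a → x ≢ b → SwapCase a b x x

module Swap {D : Set} (_≟_ : DecidableEquality D) where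

  abstract
    swap : D → D → D → D
    swap a b x with x ≟ a
    ... | yes _ = b
    ... | no _ with x ≟ b
    ... | yes _ = a
    ... | no _ = x

    swap-case : ∀ a b x → SwapCase a b x (swap a b x)
    swap-case a b x with x ≟ a
    ... | yes refl = left
    ... | no x≢a with x ≟ b
    ... | yes refl = right
    ... | no x≢b = other x≢a x≢b

  swap-left : ∀ a b → swap a b a ≡ b
  swap-left a b with swap a b a | swap-case a b a
  ... | _ | left = refl
  ... | _ | right = refl
  ... | _ | other a≢a _ = ⊥-elim (a≢a refl)

  swap-right : ∀ a b → swap a b b ≡ a
  swap-right a b with swap a b b | swap-case a b b
  ... | _ | left = refl
  ... | _ | right = refl
  ... | _ | other _ b≢b = ⊥-elim (b≢b refl)

  swap-other : ∀ {a b x} → x ≢ a → x ≢ b → swap a b x ≡ x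
  swap-other {a} {b} {x} x≢a x≢b with swap a b x | swap-case a b x
  ... | _ | left = ⊥-elim (x≢a refl)
  ... | _ | right = ⊥-elim (x≢b refl)
  ... | _ | other _ _ = refl

  swap-invol : ∀ a b x → swap a b (swap a b x) ≡ x
  swap-invol a b x with swap a b x | swap-case a b x
  ... | _ | left = swap-right a b
  ... | _ | right = swap-left a b
  ... | _ | other x≢a x≢b = swap-other x≢a x≢b

  swap-injective : ∀ a b → Injective _≡_ _≡_ (swap a b)
  swap-injective a b {x} {y} eq =
    trans (sym (swap-invol a b x)) (trans (cong (swap a b) eq) (swap-invol a b y))

  swap-same : ∀ a x → swap a a x ≡ x
  swap-same a x with swap a a x | swap-case a a x
  ... | _ | left = refl
  ... | _ | right = refl
  ... | _ | other _ _ = refl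

  swap-flip : ∀ a b x → swap a b x ≡ swap b a x
  swap-flip a b x with swap a b x | swap-case a b x
  ... | _ | left = sym (swap-right b a)
  ... | _ | right = sym (swap-left b a)
  ... | _ | other x≢a x≢b = sym (swap-other x≢b x≢a)

swap-natural : ∀ {D E : Set} (_≟₁_ : DecidableEquality D) (_≟₂_ : DecidableEquality E) (h : D → E) →
               Injective _≡_ _≡_ h → ∀ a b x →
               h (Swap.swap _≟₁_ a b x) ≡ Swap.swap _≟₂_ (h a) (h b) (h x)
swap-natural _≟₁_ _≟₂_ h inj a b x with Swap.swap _≟₁_ a b x | Swap.swap-case _≟₁_ a b x
... | _ | left = sym (Swap.swap-left _≟₂_ _ _)
... | _ | right = sym (Swap.swap-right _≟₂_ _ _)
... | _ | other x≢a x≢b = sym (Swap.swap-other _≟₂_ (x≢a ∘ inj) (x≢b ∘ inj))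

-- Counting the classes of an equivalence relation

record Classes {D : Set} (R : D → D → Set) (k : ℕ) : Set where
  field
    class     : D → Fin k
    rep       : Fin k → D
    class-rep : ∀ l → class (rep l) ≡ l
    sound     : ∀ {x y} → class x ≡ class y → R x y
    complete  : ∀ {x y} → R x y → class x ≡ class y

-- Restricted to representatives, a map that reflects the relation is injective on classes. Two such
-- bounds, one in each direction, later replace the construction of a bijection between quotients.
classes-≤ : ∀ {D E : Set} {R : D → D → Set} {S : E → E → Set} {k l} → Classes R k → Classes S l →
            (h : D → E) → (∀ {x y} → S (h x) (h y) → R x y) → k ≤ l
classes-≤ {k = k} {l} P Q h reflects = Finₚ.injective⇒≤ {f = Q.class ∘ h ∘ P.rep} λ {i} {j} eq →
  trans (sym (P.class-rep i)) (trans (P.complete (reflects (Q.sound eq))) (P.class-rep j))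
  where
  module P = Classes P
  module Q = Classes Q

classes-unique : ∀ {D E : Set} {R : D → D → Set} {S : E → E → Set} {k l} → Classes R k → Classes S l →
                 (g : D → E) → (∀ {x y} → S (g x) (g y) → R x y) →
                 (h : E → D) → (∀ {x y} → R (h x) (h y) → S x y) → k ≡ l
classes-unique P Q g g-reflects h h-reflects =
  ℕₚ.≤-antisym (classes-≤ P Q g g-reflects) (classes-≤ Q P h h-reflects)

classes-resp : ∀ {D : Set} {R S : D → D → Set} {k} →
               (∀ {x y} → R x y → S x y) → (∀ {x y} → S x y → R x y) → Classes R k → Classes S k
classes-resp R⇒S S⇒R P = record
  { class = class ; rep = rep ; class-rep = class-rep ; sound = R⇒S ∘ sound ; complete = complete ∘ S⇒R }
  where open Classes P

module _ {k} {i j : Fin (suc k)} (i≢j : i ≢ j) where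

  -- The quotient that identifies `i` with `j`: the index `i` is removed and goes where `j` goes.
  collapse : Fin (suc k) → Fin k
  collapse x with i Fin.≟ x
  ... | yes _ = punchOut i≢j
  ... | no i≢x = punchOut i≢x

  collapse-i≡j : collapse i ≡ collapse j
  collapse-i≡j with i Fin.≟ i | i Fin.≟ j
  ... | yes _ | yes i≡j = ⊥-elim (i≢j i≡j)
  ... | yes _ | no _ = Finₚ.punchOut-cong i refl
  ... | no i≢i | _ = ⊥-elim (i≢i refl)

  collapse-punchIn : ∀ l → collapse (punchIn i l) ≡ l
  collapse-punchIn l with i Fin.≟ punchIn i l
  ... | yes eq = ⊥-elim (Finₚ.punchInᵢ≢i i l (sym eq))
  ... | no i≢ = trans (Finₚ.punchOut-cong i refl) (Finₚ.punchOut-punchIn i)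

  collapse-cases : ∀ {x y} → collapse x ≡ collapse y → x ≡ y ⊎ (x ≡ j × i ≡ y) ⊎ (x ≡ i × j ≡ y)
  collapse-cases {x} {y} eq with i Fin.≟ x | i Fin.≟ y
  ... | yes i≡x | yes i≡y = inj₁ (trans (sym i≡x) i≡y)
  ... | yes i≡x | no i≢y = inj₂ (inj₂ (sym i≡x , Finₚ.punchOut-injective i≢j i≢y eq))
  ... | no i≢x | yes i≡y = inj₂ (inj₁ (Finₚ.punchOut-injective i≢x i≢j eq , i≡y))
  ... | no i≢x | no i≢y = inj₁ (Finₚ.punchOut-injective i≢x i≢y eq)

-- If `R` is an equivalence relation, this is already the one generated by `R` and the pair
-- `(a , b)`: a chain that uses the pair several times can be shortened to one that uses it at most
-- once.
Join : ∀ {D : Set} → (D → D → Set) → D → D → (D → D → Set)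
Join R a b x y = R x y ⊎ (R x a × R b y) ⊎ (R x b × R a y)

join-isEquivalence : ∀ {D : Set} {R : D → D → Set} {a b} → IsEquivalence R → IsEquivalence (Join R a b)
join-isEquivalence {D} {R} {a} {b} E = record { refl = inj₁ E.refl ; sym = join-sym ; trans = join-trans }
  where
  module E = IsEquivalence E
  join-sym : ∀ {x y} → Join R a b x y → Join R a b y x
  join-sym (inj₁ r) = inj₁ (E.sym r)
  join-sym (inj₂ (inj₁ (r , s))) = inj₂ (inj₂ (E.sym s , E.sym r))
  join-sym (inj₂ (inj₂ (r , s))) = inj₂ (inj₁ (E.sym s , E.sym r))
  join-trans : ∀ {x y z} → Join R a b x y → Join R a b y z → Join R a b x z
  join-trans (inj₁ r) (inj₁ s) = inj₁ (E.trans r s)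
  join-trans (inj₁ r) (inj₂ (inj₁ (s , t))) = inj₂ (inj₁ (E.trans r s , t))
  join-trans (inj₁ r) (inj₂ (inj₂ (s , t))) = inj₂ (inj₂ (E.trans r s , t))
  join-trans (inj₂ (inj₁ (r , s))) (inj₁ t) = inj₂ (inj₁ (r , E.trans s t))
  join-trans (inj₂ (inj₂ (r , s))) (inj₁ t) = inj₂ (inj₂ (r , E.trans s t))
  join-trans (inj₂ (inj₁ (r , s))) (inj₂ (inj₁ (t , u))) = inj₂ (inj₁ (r , u))
  join-trans (inj₂ (inj₁ (r , s))) (inj₂ (inj₂ (t , u))) = inj₁ (E.trans r u)
  join-trans (inj₂ (inj₂ (r , s))) (inj₂ (inj₁ (t , u))) = inj₁ (E.trans r u)
  join-trans (inj₂ (inj₂ (r , s))) (inj₂ (inj₂ (t , u))) = inj₂ (inj₂ (r , u))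

join-classes : ∀ {D : Set} {R : D → D → Set} {a b k} →
               Classes R (suc k) → ¬ R a b → Classes (Join R a b) k
join-classes {R = R} {a} {b} P ¬ab = record
  { class = collapse b≢a ∘ class
  ; rep = rep ∘ punchIn (class b)
  ; class-rep = λ l → trans (cong (collapse b≢a) (class-rep _)) (collapse-punchIn b≢a l)
  ; sound = join-sound ∘ collapse-cases b≢a
  ; complete = join-complete }
  where
  open Classes P
  b≢a : class b ≢ class a
  b≢a eq = ¬ab (sound (sym eq))
  join-sound : ∀ {x y} → class x ≡ class y ⊎ (class x ≡ class a × class b ≡ class y) ⊎
                         (class x ≡ class b × class a ≡ class y) → Join R a b x y
  join-sound = Sum.map sound (Sum.map (λ (p , q) → sound p , sound q) (λ (p , q) → sound p , sound q))
  join-complete : ∀ {x y} → Join R a b x y → collapse b≢a (class x) ≡ collapse b≢a (class y)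
  join-complete (inj₁ r) = cong (collapse b≢a) (complete r)
  join-complete (inj₂ (inj₁ (r , s))) =
    trans (cong (collapse b≢a) (complete r)) (trans (sym (collapse-i≡j b≢a)) (cong (collapse b≢a) (complete s)))
  join-complete (inj₂ (inj₂ (r , s))) =
    trans (cong (collapse b≢a) (complete r)) (trans (collapse-i≡j b≢a) (cong (collapse b≢a) (complete s)))

module _ {D : Set} (F : Finite D) where
  open Finite F

  private
    Gen : List (D × D) → D → D → Set
    Gen ps = EqClosure (λ x y → (x , y) ∈ ps)

    gen-weaken : ∀ {p ps x y} → Gen ps x y → Gen (p ∷ ps) x y
    gen-weaken = EqC.map Any.there

    gen-join : ∀ {a b ps x y} → Join (Gen ps) a b x y → Gen ((a , b) ∷ ps) x y
    gen-join (inj₁ r) = gen-weaken r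
    gen-join (inj₂ (inj₁ (r , s))) =
      EqC.transitive _ (gen-weaken r) (fwd (Any.here refl) ◅ gen-weaken s)
    gen-join (inj₂ (inj₂ (r , s))) =
      EqC.transitive _ (gen-weaken r) (bwd (Any.here refl) ◅ gen-weaken s)

    gen-split : ∀ {a b ps x y} → Gen ((a , b) ∷ ps) x y → Join (Gen ps) a b x y
    gen-split = EqC.fold (join-isEquivalence (EqC.isEquivalence _)) λ where
      (Any.here refl) → inj₂ (inj₁ (ε , ε))
      (Any.there p) → inj₁ (EqC.return p)

    -- Union-find along the list: a pair inside one class changes nothing, any other pair merges two
    -- classes and lowers the count by one.
    gen-classes : ∀ ps → ∃ (Classes (Gen ps))
    gen-classes [] = size , record
      { class = to ; rep = from ; class-rep = to-from
      ; sound = λ eq → subst (Gen [] _) (to-injective eq) ε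
      ; complete = λ r → cong to (EqC.fold (record { refl = refl ; sym = sym ; trans = trans }) (λ ()) r) }
    gen-classes ((a , b) ∷ ps) with gen-classes ps
    ... | k , P with Classes.class P a Fin.≟ Classes.class P b
    ... | yes eq = k , classes-resp gen-weaken (absorb ∘ gen-split) P
      where
      ab : Gen ps a b
      ab = Classes.sound P eq
      absorb : ∀ {x y} → Join (Gen ps) a b x y → Gen ps x y
      absorb (inj₁ r) = r
      absorb (inj₂ (inj₁ (r , s))) = EqC.transitive _ r (EqC.transitive _ ab s)
      absorb (inj₂ (inj₂ (r , s))) = EqC.transitive _ r (EqC.transitive _ (EqC.symmetric _ ab) s)
    gen-classes ((a , b) ∷ ps) | zero , P | no _ with () ← Classes.class P a
    gen-classes ((a , b) ∷ ps) | suc k , P | no ≢ =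
      k , classes-resp gen-join gen-split (join-classes P (≢ ∘ Classes.complete P))

  abstract
    -- A decidable relation on a finite set is the finite list of its pairs, which reduces the claim
    -- to `gen-classes`.
    classes-exist : ∀ {S : D → D → Set} → (∀ x y → Dec (S x y)) → ∃ (Classes (EqClosure S))
    classes-exist {S} S? = proj₁ found , classes-resp
      (EqC.map λ p → proj₂ (∈-filter⁻ S?′ {xs = List.cartesianProduct elements elements} p))
      (EqC.map λ s → ∈-filter⁺ S?′ (∈-cartesianProduct⁺ (∈-elements _) (∈-elements _)) s) (proj₂ found)
      where
      S?′ : ∀ p → Dec (S (proj₁ p) (proj₂ p))
      S?′ (x , y) = S? x y
      found : ∃ (Classes (Gen (List.filter S?′ (List.cartesianProduct elements elements))))
      found = gen-classes _

-- Orbits under transpositions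

Orb : ∀ {D : Set} → (D → D) → D → D → Set
Orb f = EqClosure (λ x y → f x ≡ y)

module _ {D : Set} (f : D → D) where

  orb-iterate : ∀ n x → Orb f x (iterate f n x)
  orb-iterate zero x = ε
  orb-iterate (suc n) x = EqC.transitive _ (orb-iterate n x) (fwd refl ◅ ε)

  orb-invariant : ∀ (P : D → Set) → (∀ x → P x → P (f x)) → (∀ x → P (f x) → P x) →
                  ∀ {x y} → Orb f x y → P x → P y
  orb-invariant P forth back = proj₁ ∘ EqC.fold
    {S = λ x y → (P x → P y) × (P y → P x)}
    (record { refl = id , id ; sym = λ (p , q) → q , p ; trans = λ (p , q) (r , t) → r ∘ p , q ∘ t })
    (λ { {x} refl → forth x , back x })

least : ∀ {P : ℕ → Set} → (∀ n → Dec (P n)) → ∀ n → P n → ∃ λ m → P m × (∀ j → j < m → ¬ P j)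
least P? zero p = 0 , p , λ _ ()
least P? (suc n) p with P? 0
... | yes p₀ = 0 , p₀ , λ _ ()
... | no ¬p₀ with m , pₘ , below ← least (P? ∘ suc) n p = suc m , pₘ , λ where
  zero _ → ¬p₀
  (suc j) (s≤s j<m) → below j j<m

classes-dec : ∀ {D : Set} {R : D → D → Set} {k} → Classes R k → ∀ x y → Dec (R x y)
classes-dec P x y = map′ (Classes.sound P) (Classes.complete P) (Classes.class P x Fin.≟ Classes.class P y)

-- Serves orbits and components alike, both when an edge is added and when a dart is attached.
join-count : ∀ {D : Set} {R S : D → D → Set} {a b k l} → Classes R k → Classes S l → ¬ R a b →
             (∀ {x y} → S x y → Join R a b x y) → (∀ {x y} → Join R a b x y → S x y) → k ≡ suc l
join-count {a = a} {k = zero} P _ _ _ _ with () ← Classes.class P a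
join-count {k = suc k} P Q ¬ab S⇒J J⇒S = cong suc (classes-unique (join-classes P ¬ab) Q id S⇒J id J⇒S)

join⇒ : ∀ {D : Set} {R S : D → D → Set} {a b} → (∀ {x y} → R x y → EqClosure S x y) →
        EqClosure S a b → ∀ {x y} → Join R a b x y → EqClosure S x y
join⇒ R⇒S ab (inj₁ r) = R⇒S r
join⇒ R⇒S ab (inj₂ (inj₁ (r , q))) = EqC.transitive _ (R⇒S r) (EqC.transitive _ ab (R⇒S q))
join⇒ R⇒S ab (inj₂ (inj₂ (r , q))) =
  EqC.transitive _ (R⇒S r) (EqC.transitive _ (EqC.symmetric _ ab) (R⇒S q))

module Orbits {D : Set} (F : Finite D) where
  open Finite F public
  open Swap _≟_ public

  orb-classes : ∀ f → ∃ (Classes (Orb f))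
  orb-classes f = classes-exist F (λ x y → f x ≟ y)

  orbits : (D → D) → ℕ
  orbits f = proj₁ (orb-classes f)

  orb? : ∀ f x y → Dec (Orb f x y)
  orb? f = classes-dec (proj₂ (orb-classes f))

  orbits-cong : ∀ {f g} → (∀ x → f x ≡ g x) → orbits f ≡ orbits g
  orbits-cong {f} {g} f≗g = classes-unique (proj₂ (orb-classes f)) (proj₂ (orb-classes g))
    id (EqC.map (λ {x} eq → trans (f≗g x) eq)) id (EqC.map (λ {x} eq → trans (sym (f≗g x)) eq))

  -- A backward step is a repeated forward step, since every point returns to itself under `f`.
  orb⇒iterate : ∀ {f} → Injective _≡_ _≡_ f → ∀ {x y} → Orb f x y → ∃ λ n → iterate f n x ≡ y
  orb⇒iterate {f} inj = EqC.fold
    (record { refl = 0 , refl ; sym = λ { {x} {y} (n , eq) → reach-sym n x y eq }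
            ; trans = λ { {x} (m , refl) (n , refl) → n + m , iterate-+ f n m x } })
    (λ eq → 1 , eq)
    where
    back : ∀ y → ∃ λ n → iterate f n (f y) ≡ y
    back y with n , eq ← finite-order F inj y = n , trans (iterate-comm f n y) eq
    reach-sym : ∀ n x y → iterate f n x ≡ y → ∃ λ m → iterate f m y ≡ x
    reach-sym zero x y eq = 0 , sym eq
    reach-sym (suc n) x _ refl
      with l , eq ← back (iterate f n x)
      with m , eq′ ← reach-sym n x _ refl =
      m + l , trans (iterate-+ f m l _) (trans (cong (iterate f m) eq) eq′)

  module _ {f : D → D} (inj : Injective _≡_ _≡_ f) {a b : D} where

    private
      g : D → D
      g = f ∘ swap a b

    swap-orb⇒join : ∀ {x y} → Orb g x y → Join (Orb f) a b x y
    swap-orb⇒join = EqC.fold (join-isEquivalence (EqC.isEquivalence _)) step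
      where
      step : ∀ {x y} → g x ≡ y → Join (Orb f) a b x y
      step {x} refl with swap a b x | swap-case a b x
      ... | _ | left = inj₂ (inj₁ (ε , fwd refl ◅ ε))
      ... | _ | right = inj₂ (inj₂ (ε , fwd refl ◅ ε))
      ... | _ | other _ _ = inj₁ (fwd refl ◅ ε)

    -- Walking along g from a follows the f-orbit of b, as long as it avoids b itself.
    swap-connects : ¬ Orb f a b → Orb g a b
    swap-connects ¬ab with n , eq ← finite-order F inj b with walk n
      where
      walk : ∀ n → Orb g a (iterate f (suc n) b) ⊎ Orb g a b
      walk zero = inj₁ (fwd (cong f (swap-left a b)) ◅ ε)
      walk (suc n) with walk n
      ... | inj₂ ab = inj₂ ab
      ... | inj₁ ax with iterate f (suc n) b ≟ b
      ... | yes eq = inj₂ (subst (Orb g a) eq ax)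
      ... | no ≢b = inj₁ (EqC.transitive _ ax (fwd (cong f (swap-other ≢a ≢b)) ◅ ε))
        where
        ≢a : iterate f (suc n) b ≢ a
        ≢a eq = ¬ab (EqC.symmetric _ (subst (Orb f b) eq (orb-iterate f (suc n) b)))
    ... | inj₁ ax = subst (Orb g a) eq ax
    ... | inj₂ ab = ab

    join⇒swap-orb : ¬ Orb f a b → ∀ {x y} → Join (Orb f) a b x y → Orb g x y
    join⇒swap-orb ¬ab = join⇒ (EqC.fold (EqC.isEquivalence _) step) ab
      where
      ab : Orb g a b
      ab = swap-connects ¬ab
      step : ∀ {x y} → f x ≡ y → Orb g x y
      step {x} refl with x ≟ a | x ≟ b
      ... | yes refl | _ = EqC.transitive _ ab (fwd (cong f (swap-right a b)) ◅ ε)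
      ... | no _ | yes refl = EqC.transitive _ (EqC.symmetric _ ab) (fwd (cong f (swap-left a b)) ◅ ε)
      ... | no x≢a | no x≢b = fwd (cong f (swap-other x≢a x≢b)) ◅ ε

    -- Multiplying a permutation by a transposition joins two of its cycles or cuts one in two. This
    -- is the first alternative, `orbits-split` the second.
    orbits-merge : ¬ Orb f a b → orbits f ≡ suc (orbits g)
    orbits-merge ¬ab = join-count (proj₂ (orb-classes f)) (proj₂ (orb-classes g)) ¬ab
      swap-orb⇒join (join⇒swap-orb ¬ab)

    -- The segment from `f a` to the first occurrence of `b` is closed under `g` in both directions,
    -- because `g` sends `b` back to `f a`. It contains `b` but not `a`.
    swap-separates : a ≢ b → Orb f a b → ¬ Orb g a b
    swap-separates a≢b ab g-ab
      with n , eq ← orb⇒iterate inj ab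
      with least (λ m → iterate f m a ≟ b) n eq
    ... | zero , eq , _ = a≢b eq
    ... | suc m , eq , below = ¬P-a (orb-invariant g P forth back (EqC.symmetric _ g-ab) P-b)
      where
      P : D → Set
      P x = ∃ λ j → j ≤ m × iterate f (suc j) a ≡ x
      P-b : P b
      P-b = m , ℕₚ.≤-refl , eq
      ¬P-a : ¬ P a
      ¬P-a (j , j≤m , eq′) = below (m ∸ j) (s≤s (ℕₚ.m∸n≤m m j)) (begin
        iterate f (m ∸ j) a                     ≡⟨ cong (iterate f (m ∸ j)) (sym eq′) ⟩
        iterate f (m ∸ j) (iterate f (suc j) a) ≡⟨ sym (iterate-+ f (m ∸ j) (suc j) a) ⟩
        iterate f (m ∸ j + suc j) a             ≡⟨ cong (λ i → iterate f i a) (trans (ℕₚ.+-suc (m ∸ j) j) (cong suc (ℕₚ.m∸n+n≡m j≤m))) ⟩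
        iterate f (suc m) a                     ≡⟨ eq ⟩
        b                                       ∎)
        where open ≡-Reasoning
      forth : ∀ x → P x → P (g x)
      forth x p@(j , j≤m , eq′) with swap a b x | swap-case a b x
      ... | _ | left = ⊥-elim (¬P-a p)
      ... | _ | right = 0 , z≤n , refl
      ... | _ | other _ x≢b = suc j ,
        ℕₚ.≤∧≢⇒< j≤m (λ where refl → x≢b (trans (sym eq′) eq)) , cong f eq′
      back : ∀ x → P (g x) → P x
      back x (zero , _ , eq′) with swap a b x | swap-case a b x | inj eq′
      ... | _ | left | refl = ⊥-elim (a≢b refl)
      ... | _ | right | refl = P-b
      ... | _ | other x≢a _ | refl = ⊥-elim (x≢a refl)
      back x (suc j , j<m , eq′) with swap a b x | swap-case a b x | inj eq′
      ... | _ | left | eq″ = ⊥-elim (below (suc j) (s≤s j<m) eq″)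
      ... | _ | right | eq″ = ⊥-elim (¬P-a (j , ℕₚ.<⇒≤ j<m , eq″))
      ... | _ | other _ _ | eq″ = j , ℕₚ.<⇒≤ j<m , eq″

  -- A second swap restores `f`, so `f` arises from `f ∘ swap a b` by merging the two orbits that
  -- `swap-separates` provides.
  orbits-split : ∀ {f} → Injective _≡_ _≡_ f → ∀ {a b} → a ≢ b → Orb f a b →
                 orbits (f ∘ swap a b) ≡ suc (orbits f)
  orbits-split {f} inj {a} {b} a≢b ab = trans
    (orbits-merge (λ {x} {y} eq → swap-injective a b (inj {swap a b x} {swap a b y} eq)) (swap-separates inj a≢b ab))
    (cong suc (orbits-cong (λ x → cong f (swap-invol a b x))))

  isolated : ∀ {f : D → D} → Injective _≡_ _≡_ f → ∀ {x y : D} → f x ≡ x → Orb f x y → y ≡ x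
  isolated {f} inj {x} fx r = orb-invariant f (_≡ x) (λ { _ refl → fx })
    (λ z eq → inj (trans eq (sym fx))) r refl

-- Maps on a set of darts; a dart fixed by α is dead, the others are paired into edges

record Map (D : Set) : Set where
  field
    φ α          : D → D
    φ-injective  : Injective _≡_ _≡_ φ
    α-involutive : ∀ x → α (α x) ≡ x

  σ : D → D
  σ = φ ∘ α

  α-injective : Injective _≡_ _≡_ α
  α-injective {x} {y} eq = trans (sym (α-involutive x)) (trans (cong α eq) (α-involutive y))

  σ-injective : Injective _≡_ _≡_ σ
  σ-injective = α-injective ∘ φ-injective

  Step : D → D → Set
  Step x y = φ x ≡ y ⊎ α x ≡ y

  Comp : D → D → Set
  Comp = EqClosure Step

  orb⇒comp : ∀ {x y} → Orb φ x y → Comp x y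
  orb⇒comp = EqC.map inj₁

  comp-invariant : ∀ (P : D → Set) → (∀ x → P x → P (φ x)) → (∀ x → P (φ x) → P x) →
                   (∀ x → P x → P (α x)) → ∀ {x y} → Comp x y → P x → P y
  comp-invariant P forth back across = proj₁ ∘ EqC.fold
    {S = λ x y → (P x → P y) × (P y → P x)}
    (record { refl = id , id ; sym = λ (p , q) → q , p ; trans = λ (p , q) (r , t) → r ∘ p , q ∘ t })
    (λ
      { {x} (inj₁ refl) → forth x , back x
      ; {x} (inj₂ refl) → across x , λ p → subst P (α-involutive x) (across (α x) p) })

open Map

infix 4 _≋_

_≋_ : ∀ {D : Set} → Map D → Map D → Set
X ≋ Y = (∀ x → φ X x ≡ φ Y x) × (∀ x → α X x ≡ α Y x)

≋-sym : ∀ {D : Set} {X Y : Map D} → X ≋ Y → Y ≋ X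
≋-sym (p , q) = sym ∘ p , sym ∘ q

comp-resp : ∀ {D : Set} {X Y : Map D} → X ≋ Y → ∀ {x y} → Comp X x y → Comp Y x y
comp-resp (p , q) = EqC.map (Sum.map (λ {e → trans (sym (p _)) e}) (λ {e → trans (sym (q _)) e}))

module Surgery {D : Set} (F : Finite D) where
  open Orbits F public

  -- Dead darts `a` and `b` become the ends of an edge; if `α` already pairs them, the same formula
  -- deletes that edge. Both permutations receive the same factor, which commutes with `α`, so the
  -- vertex rotation `φ ∘ α` is unchanged.
  edge : ∀ X a b → (∀ x → swap a b (α X x) ≡ α X (swap a b x)) → Map D
  edge X a b comm = record
    { φ = φ X ∘ swap a b
    ; α = α X ∘ swap a b
    ; φ-injective = λ {x} {y} eq → swap-injective a b (φ-injective X {swap a b x} {swap a b y} eq)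
    ; α-involutive = λ x → trans (cong (α X) (comm (swap a b x)))
        (trans (α-involutive X _) (swap-invol a b x)) }

  -- If `φ` and `α` fix `x`, this inserts `x` immediately before `q`, in its face and in its vertex.
  -- If the dead dart `x` already precedes `q` in its face, it takes `x` out again.
  attach : Map D → D → D → Map D
  attach X x q = record
    { φ = swap x q ∘ φ X
    ; α = α X
    ; φ-injective = φ-injective X ∘ swap-injective x q
    ; α-involutive = α-involutive X }

  dead-comm : ∀ X {a b} → α X a ≡ a → α X b ≡ b → ∀ x → swap a b (α X x) ≡ α X (swap a b x)
  dead-comm X {a} {b} αa αb x =
    trans (cong₂ (λ c d → swap c d (α X x)) (sym αa) (sym αb))
          (sym (swap-natural _≟_ _≟_ (α X) (α-injective X) a b x))

  edge-comm : ∀ X a x → swap a (α X a) (α X x) ≡ α X (swap a (α X a) x)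
  edge-comm X a x = trans (swap-flip a (α X a) (α X x))
    (trans (cong (λ c → swap (α X a) c (α X x)) (sym (α-involutive X a)))
           (sym (swap-natural _≟_ _≟_ (α X) (α-injective X) a (α X a) x)))

  edge-edge : ∀ X a b comm comm′ → edge (edge X a b comm) a b comm′ ≋ X
  edge-edge X a b _ _ = (λ x → cong (φ X) (swap-invol a b x)) , (λ x → cong (α X) (swap-invol a b x))

  attach-attach : ∀ X x q → attach (attach X x q) x q ≋ X
  attach-attach X x q = (λ y → swap-invol x q (φ X y)) , (λ _ → refl)

  comp-classes : ∀ X → ∃ (Classes (Comp X))
  comp-classes X = classes-exist F (λ x y → (φ X x ≟ y) ⊎-dec (α X x ≟ y))

  #V #F #A #C : Map D → ℕ
  #V X = orbits (σ X)
  #F X = orbits (φ X)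
  #A X = orbits (α X)
  #C X = proj₁ (comp-classes X)

  comp? : ∀ X x y → Dec (Comp X x y)
  comp? X = classes-dec (proj₂ (comp-classes X))

  χ : Map D → ℕ
  χ X = #V X + #F X + #A X

  -- V − E + F = 2C, where #A = size − E since every dead dart is a cycle of α
  Planar : Map D → Set
  Planar X = χ X ≡ size + #C X + #C X

  #A≤size : ∀ X → #A X ≤ size
  #A≤size X = Finₚ.injective⇒≤ {f = to ∘ Classes.rep P} λ {i} {j} eq →
    trans (sym (Classes.class-rep P i)) (trans (cong (Classes.class P) (to-injective eq)) (Classes.class-rep P j))
    where
    P : Classes (Orb (α X)) (#A X)
    P = proj₂ (orb-classes (α X))

  module _ {X Y : Map D} (X≋Y : X ≋ Y) where

    #V-resp : #V X ≡ #V Y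
    #V-resp = orbits-cong λ x → trans (proj₁ X≋Y (α X x)) (cong (φ Y) (proj₂ X≋Y x))

    #F-resp : #F X ≡ #F Y
    #F-resp = orbits-cong (proj₁ X≋Y)

    #A-resp : #A X ≡ #A Y
    #A-resp = orbits-cong (proj₂ X≋Y)

    #C-resp : #C X ≡ #C Y
    #C-resp = classes-unique (proj₂ (comp-classes X)) (proj₂ (comp-classes Y))
      id (comp-resp {X = Y} {X} (≋-sym {X = X} {Y} X≋Y)) id (comp-resp {X = X} {Y} X≋Y)

  module Edge (X : Map D) {a b : D} (a≢b : a ≢ b) (αa : α X a ≡ a) (αb : α X b ≡ b) where

    X⁺ : Map D
    X⁺ = edge X a b (dead-comm X αa αb)

    a∼⁺b : Comp X⁺ a b
    a∼⁺b = fwd (inj₂ (trans (cong (α X) (swap-left a b)) αb)) ◅ ε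

    -- The `φ`-step that one end of the new edge has lost is now made by the other end, which is one
    -- `α`-step away.
    comp⇒comp⁺ : ∀ {x y} → Comp X x y → Comp X⁺ x y
    comp⇒comp⁺ = EqC.fold (EqC.isEquivalence _) step
      where
      step : ∀ {x y} → Step X x y → Comp X⁺ x y
      step {x} (inj₁ refl) with x ≟ a | x ≟ b
      ... | yes refl | _ = EqC.transitive _ a∼⁺b (fwd (inj₁ (cong (φ X) (swap-right a b))) ◅ ε)
      ... | no _ | yes refl = EqC.transitive _ (EqC.symmetric _ a∼⁺b) (fwd (inj₁ (cong (φ X) (swap-left a b))) ◅ ε)
      ... | no x≢a | no x≢b = fwd (inj₁ (cong (φ X) (swap-other x≢a x≢b))) ◅ ε
      step {x} (inj₂ refl) with x ≟ a | x ≟ b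
      ... | yes refl | _ = subst (Comp X⁺ a) (sym αa) ε
      ... | no _ | yes refl = subst (Comp X⁺ b) (sym αb) ε
      ... | no x≢a | no x≢b = fwd (inj₂ (cong (α X) (swap-other x≢a x≢b))) ◅ ε

    comp⁺⇒join : ∀ {x y} → Comp X⁺ x y → Join (Comp X) a b x y
    comp⁺⇒join = EqC.fold (join-isEquivalence (EqC.isEquivalence _)) step
      where
      step : ∀ {x y} → Step X⁺ x y → Join (Comp X) a b x y
      step {x} (inj₁ refl) with swap a b x | swap-case a b x
      ... | _ | left = inj₂ (inj₁ (ε , fwd (inj₁ refl) ◅ ε))
      ... | _ | right = inj₂ (inj₂ (ε , fwd (inj₁ refl) ◅ ε))
      ... | _ | other _ _ = inj₁ (fwd (inj₁ refl) ◅ ε)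
      step {x} (inj₂ refl) with swap a b x | swap-case a b x
      ... | _ | left = inj₂ (inj₁ (ε , fwd (inj₂ refl) ◅ ε))
      ... | _ | right = inj₂ (inj₂ (ε , fwd (inj₂ refl) ◅ ε))
      ... | _ | other _ _ = inj₁ (fwd (inj₂ refl) ◅ ε)

    #V-edge : #V X ≡ #V X⁺
    #V-edge = orbits-cong λ x → cong (φ X) (trans (cong (α X) (sym (swap-invol a b x)))
      (sym (dead-comm X αa αb (swap a b x))))

    #A-edge : #A X ≡ suc (#A X⁺)
    #A-edge = orbits-merge (α-injective X) (a≢b ∘ sym ∘ isolated (α-injective X) αa)

    #F-bridge : ¬ Orb (φ X) a b → #F X ≡ suc (#F X⁺)
    #F-bridge = orbits-merge (φ-injective X)

    #F-chord : Orb (φ X) a b → #F X⁺ ≡ suc (#F X)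
    #F-chord = orbits-split (φ-injective X) a≢b

    #C-bridge : ¬ Comp X a b → #C X ≡ suc (#C X⁺)
    #C-bridge ¬ab = join-count (proj₂ (comp-classes X)) (proj₂ (comp-classes X⁺)) ¬ab
      comp⁺⇒join (join⇒ comp⇒comp⁺ a∼⁺b)

    #C-chord : Comp X a b → #C X ≡ #C X⁺
    #C-chord ab = classes-unique (proj₂ (comp-classes X)) (proj₂ (comp-classes X⁺))
      id (join⇒ id ab ∘ comp⁺⇒join) id comp⇒comp⁺

  module Attach (X : Map D) {x q : D} (x≢q : x ≢ q) (φx : φ X x ≡ x) (αx : α X x ≡ x) where

    X⁺ : Map D
    X⁺ = attach X x q

    alone : ∀ {y} → Comp X x y → y ≡ x
    alone r = comp-invariant X (_≡ x) (λ { _ refl → φx })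
      (λ z eq → φ-injective X (trans eq (sym φx))) (λ { _ refl → αx }) r refl

    -- Treats orbits and components at once. Besides the steps of `f`, the relation may contain
    -- steps `T` that the attachment leaves alone: none for orbits, the graph of `α` for components.
    module _ {S : D → D → Set} (T : D → D → Set) (f : D → D) (fx : f x ≡ x) (f-injective : Injective _≡_ _≡_ f)
             (S⇒ : ∀ {y z} → S y z → f y ≡ z ⊎ T y z) (⇐S : ∀ {y z} → f y ≡ z ⊎ T y z → S y z)
             {S⁺ : D → D → Set}
             (S⁺⇒ : ∀ {y z} → S⁺ y z → swap x q (f y) ≡ z ⊎ T y z)
             (⇐S⁺ : ∀ {y z} → swap x q (f y) ≡ z ⊎ T y z → S⁺ y z) where

      attach⇒join : ∀ {y z} → EqClosure S⁺ y z → Join (EqClosure S) x q y z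
      attach⇒join = EqC.fold (join-isEquivalence (EqC.isEquivalence _)) (step ∘ S⁺⇒)
        where
        step : ∀ {y z} → swap x q (f y) ≡ z ⊎ T y z → Join (EqClosure S) x q y z
        step (inj₂ t) = inj₁ (EqC.return (⇐S (inj₂ t)))
        step {y} (inj₁ refl) with f y in eq | swap x q (f y) | swap-case x q (f y)
        ... | _ | _ | left = inj₂ (inj₁ (EqC.return (⇐S (inj₁ eq)) , ε))
        ... | _ | _ | right = inj₂ (inj₂ (EqC.return (⇐S (inj₁ eq)) , ε))
        ... | _ | _ | other _ _ = inj₁ (EqC.return (⇐S (inj₁ eq)))

      join⇒attach : ∀ {y z} → Join (EqClosure S) x q y z → EqClosure S⁺ y z
      join⇒attach = join⇒ (EqC.fold (EqC.isEquivalence _) (step ∘ S⇒)) xq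
        where
        xq : EqClosure S⁺ x q
        xq = EqC.return (⇐S⁺ (inj₁ (trans (cong (swap x q) fx) (swap-left x q))))
        step : ∀ {y z} → f y ≡ z ⊎ T y z → EqClosure S⁺ y z
        step (inj₂ t) = EqC.return (⇐S⁺ (inj₂ t))
        step {y} (inj₁ refl) with f y ≟ x | f y ≟ q
        ... | yes fy≡x | _ = subst (EqClosure S⁺ y) (trans (f-injective (trans fy≡x (sym fx))) (sym fy≡x)) ε
        ... | no _ | yes fy≡q = subst (EqClosure S⁺ y) (sym fy≡q) (EqC.transitive _
          (EqC.return (⇐S⁺ (inj₁ (trans (cong (swap x q) fy≡q) (swap-right x q))))) xq)
        ... | no ≢x | no ≢q = EqC.return (⇐S⁺ (inj₁ (swap-other ≢x ≢q)))

    private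
      ∅ : D → D → Set
      ∅ _ _ = ⊥

      un : ∀ {A : Set} → A ⊎ ⊥ → A
      un (inj₁ p) = p

    orbits-attach : ∀ f → f x ≡ x → Injective _≡_ _≡_ f → orbits f ≡ suc (orbits (swap x q ∘ f))
    orbits-attach f fx f-inj = join-count (proj₂ (orb-classes f)) (proj₂ (orb-classes (swap x q ∘ f)))
      (x≢q ∘ sym ∘ isolated f-inj fx) (attach⇒join ∅ f fx f-inj inj₁ un inj₁ un) (join⇒attach ∅ f fx f-inj inj₁ un inj₁ un)

    join⇒orb⁺ : ∀ {y z} → Join (Orb (φ X)) x q y z → Orb (φ X⁺) y z
    join⇒orb⁺ = join⇒attach ∅ (φ X) φx (φ-injective X) inj₁ un inj₁ un

    orb⁺⇒join : ∀ {y z} → Orb (φ X⁺) y z → Join (Orb (φ X)) x q y z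
    orb⁺⇒join = attach⇒join ∅ (φ X) φx (φ-injective X) inj₁ un inj₁ un

    #V-attach : #V X ≡ suc (#V X⁺)
    #V-attach = orbits-attach (σ X) (trans (cong (φ X) αx) φx) (σ-injective X)

    #F-attach : #F X ≡ suc (#F X⁺)
    #F-attach = orbits-attach (φ X) φx (φ-injective X)

    comp⁺⇒join : ∀ {y z} → Comp X⁺ y z → Join (Comp X) x q y z
    comp⁺⇒join = attach⇒join (λ y z → α X y ≡ z) (φ X) φx (φ-injective X) id id id id

    join⇒comp⁺ : ∀ {y z} → Join (Comp X) x q y z → Comp X⁺ y z
    join⇒comp⁺ = join⇒attach (λ y z → α X y ≡ z) (φ X) φx (φ-injective X) id id id id

    #C-attach : #C X ≡ suc (#C X⁺)
    #C-attach = join-count (proj₂ (comp-classes X)) (proj₂ (comp-classes X⁺))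
      (x≢q ∘ sym ∘ alone) comp⁺⇒join join⇒comp⁺

-- Euler's inequality

+-suc-suc : ∀ k m n → k + suc m + suc n ≡ suc (suc (k + m + n))
+-suc-suc k m n = trans (ℕₚ.+-suc (k + suc m) n) (cong (λ i → suc (i + n)) (ℕₚ.+-suc k m))

suc-+-suc : ∀ k m n → suc k + suc m + n ≡ suc (suc (k + m + n))
suc-+-suc k m n = cong (λ i → suc (i + n)) (ℕₚ.+-suc k m)

module Euler {D : Set} (F : Finite D) where
  open Surgery F public

  module EdgePlanarity (X : Map D) {a b : D} (a≢b : a ≢ b) (αa : α X a ≡ a) (αb : α X b ≡ b) where
    open Edge X a≢b αa αb public

    -- The new edge costs a cycle of `α` and, by merging two faces, a cycle of `φ`. In `χ-chord` the
    -- face is split instead, and the two changes cancel.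
    χ-bridge : ¬ Orb (φ X) a b → χ X ≡ suc (suc (χ X⁺))
    χ-bridge ¬ab = trans (cong₂ _+_ (cong₂ _+_ #V-edge (#F-bridge ¬ab)) #A-edge) (+-suc-suc (#V X⁺) (#F X⁺) (#A X⁺))

    χ-chord : Orb (φ X) a b → χ X ≡ χ X⁺
    χ-chord ab = trans (cong₂ _+_ (cong (_+ #F X) #V-edge) #A-edge)
      (trans (ℕₚ.+-suc _ _) (cong (_+ #A X⁺) (trans (sym (ℕₚ.+-suc (#V X⁺) (#F X))) (cong (#V X⁺ +_) (sym (#F-chord ab))))))

    #CC-bridge : ¬ Comp X a b → size + #C X + #C X ≡ suc (suc (size + #C X⁺ + #C X⁺))
    #CC-bridge ¬ab = trans (cong (λ c → size + c + c) (#C-bridge ¬ab)) (+-suc-suc size (#C X⁺) (#C X⁺))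

    #CC-chord : Comp X a b → size + #C X + #C X ≡ size + #C X⁺ + #C X⁺
    #CC-chord ab = cong (λ c → size + c + c) (#C-chord ab)

    planar-bridge : ¬ Comp X a b → Planar X → Planar X⁺
    planar-bridge ¬ab pl = ℕₚ.suc-injective (ℕₚ.suc-injective
      (trans (sym (χ-bridge (¬ab ∘ orb⇒comp X))) (trans pl (#CC-bridge ¬ab))))

    planar-chord : Orb (φ X) a b → Planar X → Planar X⁺
    planar-chord ab pl = trans (sym (χ-chord ab)) (trans pl (#CC-chord (orb⇒comp X ab)))

  module AttachPlanarity (X : Map D) {x q : D} (x≢q : x ≢ q) (φx : φ X x ≡ x) (αx : α X x ≡ x) where
    open Attach X x≢q φx αx public

    χ-attach : χ X ≡ suc (suc (χ X⁺))
    χ-attach = trans (cong (_+ #A X) (cong₂ _+_ #V-attach #F-attach)) (suc-+-suc (#V X⁺) (#F X⁺) (#A X))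

    #CC-attach : size + #C X + #C X ≡ suc (suc (size + #C X⁺ + #C X⁺))
    #CC-attach = trans (cong (λ c → size + c + c) #C-attach) (+-suc-suc size (#C X⁺) (#C X⁺))

    planar-attach : Planar X → Planar X⁺
    planar-attach pl = ℕₚ.suc-injective (ℕₚ.suc-injective (trans (sym χ-attach) (trans pl #CC-attach)))

    planar-detach : Planar X⁺ → Planar X
    planar-detach pl = trans χ-attach (trans (cong (suc ∘ suc) pl) (sym #CC-attach))

  module _ {X Y : Map D} (X≋Y : X ≋ Y) where

    χ-resp : χ X ≡ χ Y
    χ-resp = cong₂ _+_ (cong₂ _+_ (#V-resp {X} {Y} X≋Y) (#F-resp {X} {Y} X≋Y)) (#A-resp {X} {Y} X≋Y)

    #CC-resp : size + #C X + #C X ≡ size + #C Y + #C Y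
    #CC-resp = cong (λ c → size + c + c) (#C-resp {X} {Y} X≋Y)

    planar-resp : Planar X → Planar Y
    planar-resp pl = trans (sym χ-resp) (trans pl #CC-resp)

  -- Presents `X` as `Y` with an edge added, so that the counts for adding an edge also govern its
  -- deletion.
  module Delete (X : Map D) (a : D) (alive : α X a ≢ a) where

    b : D
    b = α X a

    Y : Map D
    Y = edge X a b (edge-comm X a)

    Y-a : α Y a ≡ a
    Y-a = trans (cong (α X) (swap-left a b)) (α-involutive X a)

    Y-b : α Y b ≡ b
    Y-b = cong (α X) (swap-right a b)

    open EdgePlanarity Y (alive ∘ sym) Y-a Y-b public

    X⁺≋X : X⁺ ≋ X
    X⁺≋X = edge-edge X a b (edge-comm X a) (dead-comm Y Y-a Y-b)

    #A-delete : #A Y ≡ suc (#A X)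
    #A-delete = trans #A-edge (cong suc (#A-resp {X⁺} {X} X⁺≋X))

  alive-dart? : ∀ X → (∀ x → α X x ≡ x) ⊎ ∃ λ x → α X x ≢ x
  alive-dart? X with Finₚ.all? (λ i → α X (from i) ≟ from i)
  ... | yes allDead = inj₁ λ x → subst (λ y → α X y ≡ y) (from-to x) (allDead (to x))
  ... | no someAlive with i , ai ← Finₚ.¬∀⟶∃¬ size _ (λ i → α X (from i) ≟ from i) someAlive = inj₂ (from i , ai)

  module _ (X : Map D) where

    -- Without edges, `σ` agrees with `φ` and every component is a single cycle of it.
    euler-dead : (∀ x → α X x ≡ x) → χ X ≤ size + #C X + #C X
    euler-dead dead = ℕₚ.≤-trans
      (ℕₚ.+-mono-≤ (ℕₚ.≤-reflexive (cong₂ _+_ V≡C F≡C)) (#A≤size X))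
      (ℕₚ.≤-reflexive (trans (ℕₚ.+-comm _ size) (sym (ℕₚ.+-assoc size (#C X) (#C X)))))
      where
      F≡C : #F X ≡ #C X
      F≡C = classes-unique (proj₂ (orb-classes (φ X))) (proj₂ (comp-classes X))
        id (EqC.fold (EqC.isEquivalence _) λ where
          (inj₁ eq) → fwd eq ◅ ε
          {x} (inj₂ refl) → subst (Orb (φ X) x) (sym (dead x)) ε)
        id (orb⇒comp X)
      V≡C : #V X ≡ #C X
      V≡C = trans (orbits-cong (λ x → cong (φ X) (dead x))) F≡C

    module _ (x : D) (alive : α X x ≢ x) where
      open Delete X x alive
      open ℕₚ.≤-Reasoning

      -- If the edge splits a face of `Y`, neither side changes. If it merges two faces, the left
      -- side drops by two and the right side by two or not at all, according to whether the edge
      -- also merges components.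
      euler-undelete : χ Y ≤ size + #C Y + #C Y → χ X ≤ size + #C X + #C X
      euler-undelete IH = go (orb? (φ Y) x b)
        where
        CC≤ : Dec (Comp Y x b) → size + #C Y + #C Y ≤ suc (suc (size + #C X⁺ + #C X⁺))
        CC≤ (yes xb) = ℕₚ.≤-trans (ℕₚ.≤-reflexive (#CC-chord xb)) (ℕₚ.≤-trans (ℕₚ.n≤1+n _) (ℕₚ.n≤1+n _))
        CC≤ (no ¬xb) = ℕₚ.≤-reflexive (#CC-bridge ¬xb)
        go : Dec (Orb (φ Y) x b) → χ X ≤ size + #C X + #C X
        go (yes xb) = begin
          χ X                    ≡⟨ sym (χ-resp {X⁺} {X} X⁺≋X) ⟩
          χ X⁺                   ≡⟨ sym (χ-chord xb) ⟩
          χ Y                    ≤⟨ IH ⟩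
          size + #C Y + #C Y     ≡⟨ #CC-chord (orb⇒comp Y xb) ⟩
          size + #C X⁺ + #C X⁺   ≡⟨ #CC-resp {X⁺} {X} X⁺≋X ⟩
          size + #C X + #C X     ∎
        go (no ¬xb) = ℕₚ.≤-pred (ℕₚ.≤-pred (begin
          suc (suc (χ X))                    ≡⟨ cong (suc ∘ suc) (sym (χ-resp {X⁺} {X} X⁺≋X)) ⟩
          suc (suc (χ X⁺))                   ≡⟨ sym (χ-bridge ¬xb) ⟩
          χ Y                                ≤⟨ IH ⟩
          size + #C Y + #C Y                 ≤⟨ CC≤ (comp? Y x b) ⟩
          suc (suc (size + #C X⁺ + #C X⁺))   ≡⟨ cong (suc ∘ suc) (#CC-resp {X⁺} {X} X⁺≋X) ⟩
          suc (suc (size + #C X + #C X))     ∎))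

  private
    -- As `#A` is `size` minus the number of edges, the bound says that at most `k` edges are left.
    -- Each deletion raises `#A` by one.
    euler-fuel : ∀ k X → size ≤ k + #A X → χ X ≤ size + #C X + #C X
    euler-step : ∀ k X x (alive : α X x ≢ x) → size ≤ k + #A X → χ X ≤ size + #C X + #C X

    euler-fuel k X bound = [ euler-dead X , (λ (x , alive) → euler-step k X x alive bound) ]′ (alive-dart? X)

    euler-step zero X x alive bound = ⊥-elim (ℕₚ.<-irrefl refl (ℕₚ.≤-trans
      (ℕₚ.≤-reflexive (sym #A-delete)) (ℕₚ.≤-trans (#A≤size Y) bound)))
      where open Delete X x alive
    euler-step (suc k) X x alive bound = euler-undelete X x alive
      (euler-fuel k Y (ℕₚ.≤-trans bound (ℕₚ.≤-reflexive
        (trans (sym (ℕₚ.+-suc k (#A X))) (cong (k +_) (sym #A-delete))))))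
      where open Delete X x alive

  euler : ∀ X → χ X ≤ size + #C X + #C X
  euler X = euler-fuel size X (ℕₚ.m≤m+n size _)

  module DeletePlanarity (X : Map D) (a : D) (alive : α X a ≢ a) (pl : Planar X) where
    open Delete X a alive public

    private
      pl⁺ : Planar X⁺
      pl⁺ = planar-resp {X} {X⁺} (≋-sym {X = X⁺} {X} X⁺≋X) pl

    planar-chord-delete : Orb (φ Y) a b → Planar Y
    planar-chord-delete ab = trans (χ-chord ab) (trans pl⁺ (sym (#CC-chord (orb⇒comp Y ab))))

    -- Otherwise `Y` would have as many components as `X` and a value of `χ` larger by two, against
    -- `euler`. This is what the inequality is proved for.
    bridge-disconnects : ¬ Orb (φ Y) a b → ¬ Comp Y a b
    bridge-disconnects ¬ab ab = ℕₚ.<-irrefl refl (begin-strict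
      size + #C Y + #C Y     ≡⟨ #CC-chord ab ⟩
      size + #C X⁺ + #C X⁺   ≡⟨ sym pl⁺ ⟩
      χ X⁺                   <⟨ ℕₚ.m<n+m (χ X⁺) (s≤s (z≤n {1})) ⟩
      suc (suc (χ X⁺))       ≡⟨ sym (χ-bridge ¬ab) ⟩
      χ Y                    ≤⟨ euler Y ⟩
      size + #C Y + #C Y     ∎)
      where open ℕₚ.≤-Reasoning

    planar-bridge-delete : ¬ Orb (φ Y) a b → Planar Y
    planar-bridge-delete ¬ab = trans (χ-bridge ¬ab)
      (trans (cong (suc ∘ suc) pl⁺) (sym (#CC-bridge (bridge-disconnects ¬ab))))

-- Direct sums

infixr 4 _⊕_

_⊕_ : ∀ {A B : Set} → Map A → Map B → Map (A ⊎ B)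
X ⊕ Y = record
  { φ = Sum.map (φ X) (φ Y)
  ; α = Sum.map (α X) (α Y)
  ; φ-injective = λ
      { {inj₁ x} {inj₁ y} eq → cong inj₁ (φ-injective X (inj₁-injective eq))
      ; {inj₂ x} {inj₂ y} eq → cong inj₂ (φ-injective Y (inj₂-injective eq)) }
  ; α-involutive = λ where
      (inj₁ x) → cong inj₁ (α-involutive X x)
      (inj₂ y) → cong inj₂ (α-involutive Y y) }

point : Map ⊤
point = record { φ = id ; α = id ; φ-injective = id ; α-involutive = λ _ → refl }

empty : Map ⊥
empty = record { φ = id ; α = id ; φ-injective = id ; α-involutive = λ _ → refl }

SumRel : ∀ {A B : Set} → (A → A → Set) → (B → B → Set) → A ⊎ B → A ⊎ B → Set
SumRel R S (inj₁ x) (inj₁ y) = R x y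
SumRel R S (inj₁ x) (inj₂ y) = ⊥
SumRel R S (inj₂ x) (inj₁ y) = ⊥
SumRel R S (inj₂ x) (inj₂ y) = S x y

module _ {A B : Set} {R : A → A → Set} {S : B → B → Set} where

  sumRel-isEquivalence : IsEquivalence R → IsEquivalence S → IsEquivalence (SumRel R S)
  sumRel-isEquivalence E E′ = record
    { refl = λ { {inj₁ x} → E.refl ; {inj₂ y} → E′.refl }
    ; sym = λ { {inj₁ x} {inj₁ y} → E.sym ; {inj₂ x} {inj₂ y} → E′.sym }
    ; trans = λ { {inj₁ x} {inj₁ y} {inj₁ z} → E.trans ; {inj₂ x} {inj₂ y} {inj₂ z} → E′.trans } }
    where
    module E = IsEquivalence E
    module E′ = IsEquivalence E′

  sum-classes : ∀ {k l} → Classes R k → Classes S l → Classes (SumRel R S) (k + l)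
  sum-classes {k} {l} P Q = record
    { class = class ; rep = rep ∘ Fin.splitAt k
    ; class-rep = λ i → trans (class-rep (Fin.splitAt k i)) (Finₚ.join-splitAt k l i)
    ; sound = λ {x} {y} → sound x y ∘ join-inj (label x) (label y)
    ; complete = λ {x} {y} → complete x y }
    where
    module P = Classes P
    module Q = Classes Q
    label : A ⊎ B → Fin k ⊎ Fin l
    label = Sum.map P.class Q.class
    class : A ⊎ B → Fin (k + l)
    class = Fin.join k l ∘ label
    rep : Fin k ⊎ Fin l → A ⊎ B
    rep = Sum.map P.rep Q.rep
    class-rep : ∀ i → class (rep i) ≡ Fin.join k l i
    class-rep (inj₁ i) = cong (Fin.join k l ∘ inj₁) (P.class-rep i)
    class-rep (inj₂ i) = cong (Fin.join k l ∘ inj₂) (Q.class-rep i)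
    join-inj : ∀ i j → Fin.join k l i ≡ Fin.join k l j → i ≡ j
    join-inj i j eq = trans (sym (Finₚ.splitAt-join k l i)) (trans (cong (Fin.splitAt k) eq) (Finₚ.splitAt-join k l j))
    sound : ∀ x y → label x ≡ label y → SumRel R S x y
    sound (inj₁ x) (inj₁ y) eq = P.sound (inj₁-injective eq)
    sound (inj₂ x) (inj₂ y) eq = Q.sound (inj₂-injective eq)
    complete : ∀ x y → SumRel R S x y → class x ≡ class y
    complete (inj₁ x) (inj₁ y) r = cong (Fin.join k l ∘ inj₁) (P.complete r)
    complete (inj₂ x) (inj₂ y) r = cong (Fin.join k l ∘ inj₂) (Q.complete r)

module _ {A B : Set} where

  orb-⊕⇒ : ∀ {f : A → A} {g : B → B} {x y} → Orb (Sum.map f g) x y → SumRel (Orb f) (Orb g) x y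
  orb-⊕⇒ = EqC.fold (sumRel-isEquivalence (EqC.isEquivalence _) (EqC.isEquivalence _)) λ
    { {inj₁ x} refl → fwd refl ◅ ε
    ; {inj₂ y} refl → fwd refl ◅ ε }

  ⇒orb-⊕ : ∀ {f : A → A} {g : B → B} {x y} → SumRel (Orb f) (Orb g) x y → Orb (Sum.map f g) x y
  ⇒orb-⊕ {x = inj₁ x} {inj₁ y} = EqC.gmap inj₁ (cong inj₁)
  ⇒orb-⊕ {x = inj₂ x} {inj₂ y} = EqC.gmap inj₂ (cong inj₂)

  comp-⊕⇒ : ∀ (X : Map A) (Y : Map B) {x y} → Comp (X ⊕ Y) x y → SumRel (Comp X) (Comp Y) x y
  comp-⊕⇒ X Y = EqC.fold (sumRel-isEquivalence (EqC.isEquivalence _) (EqC.isEquivalence _)) λ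
    { {inj₁ x} (inj₁ refl) → fwd (inj₁ refl) ◅ ε
    ; {inj₂ y} (inj₁ refl) → fwd (inj₁ refl) ◅ ε
    ; {inj₁ x} (inj₂ refl) → fwd (inj₂ refl) ◅ ε
    ; {inj₂ y} (inj₂ refl) → fwd (inj₂ refl) ◅ ε }

  ⇒comp-⊕ : ∀ (X : Map A) (Y : Map B) {x y} → SumRel (Comp X) (Comp Y) x y → Comp (X ⊕ Y) x y
  ⇒comp-⊕ X Y {inj₁ x} {inj₁ y} = EqC.gmap inj₁ (Sum.map (cong inj₁) (cong inj₁))
  ⇒comp-⊕ X Y {inj₂ x} {inj₂ y} = EqC.gmap inj₂ (Sum.map (cong inj₂) (cong inj₂))

module _ {A B : Set} (F : Finite A) (G : Finite B) where
  private
    module A = Euler F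
    module B = Euler G
    module AB = Euler (⊎-finite F G)

  orbits-⊕ : ∀ f g → AB.orbits (Sum.map f g) ≡ A.orbits f + B.orbits g
  orbits-⊕ f g = classes-unique (proj₂ (AB.orb-classes (Sum.map f g)))
    (sum-classes (proj₂ (A.orb-classes f)) (proj₂ (B.orb-classes g))) id ⇒orb-⊕ id orb-⊕⇒

  #C-⊕ : ∀ X Y → AB.#C (X ⊕ Y) ≡ A.#C X + B.#C Y
  #C-⊕ X Y = classes-unique (proj₂ (AB.comp-classes (X ⊕ Y)))
    (sum-classes (proj₂ (A.comp-classes X)) (proj₂ (B.comp-classes Y))) id (⇒comp-⊕ X Y) id (comp-⊕⇒ X Y)

  private
    rearrange : ∀ p p′ q q′ r r′ → (p + p′) + (q + q′) + (r + r′) ≡ (p + q + r) + (p′ + q′ + r′)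
    rearrange p p′ q q′ r r′ =
      trans (cong (_+ (r + r′)) (interchange p p′ q q′)) (interchange (p + q) (p′ + q′) r r′)

  planar-⊕ : ∀ X Y → A.Planar X → B.Planar Y → AB.Planar (X ⊕ Y)
  planar-⊕ X Y pl pl′ = begin
    AB.χ (X ⊕ Y)
      ≡⟨ cong₂ _+_ (cong₂ _+_ #V-⊕ (orbits-⊕ (φ X) (φ Y))) (orbits-⊕ (α X) (α Y)) ⟩
    (A.#V X + B.#V Y) + (A.#F X + B.#F Y) + (A.#A X + B.#A Y)
      ≡⟨ rearrange (A.#V X) (B.#V Y) (A.#F X) (B.#F Y) (A.#A X) (B.#A Y) ⟩
    A.χ X + B.χ Y
      ≡⟨ cong₂ _+_ pl pl′ ⟩
    (A.size + A.#C X + A.#C X) + (B.size + B.#C Y + B.#C Y)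
      ≡⟨ sym (rearrange A.size B.size (A.#C X) (B.#C Y) (A.#C X) (B.#C Y)) ⟩
    (A.size + B.size) + (A.#C X + B.#C Y) + (A.#C X + B.#C Y)
      ≡⟨ cong (λ c → AB.size + c + c) (sym (#C-⊕ X Y)) ⟩
    AB.size + AB.#C (X ⊕ Y) + AB.#C (X ⊕ Y) ∎
    where
    open ≡-Reasoning
    #V-⊕ : AB.#V (X ⊕ Y) ≡ A.#V X + B.#V Y
    #V-⊕ = trans (AB.orbits-cong λ { (inj₁ x) → refl ; (inj₂ y) → refl }) (orbits-⊕ (σ X) (σ Y))

point-planar : Euler.Planar ⊤-finite point
point-planar = trans (cong₂ _+_ (cong₂ _+_ orbits≡1 orbits≡1) orbits≡1) (cong (λ c → 1 + c + c) (sym comps≡1))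
  where
  one : ∀ {R : ⊤ → ⊤ → Set} → R tt tt → Classes R 1
  one r = record { class = λ _ → Fin.zero ; rep = λ _ → tt ; class-rep = λ { Fin.zero → refl }
                 ; sound = λ _ → r ; complete = λ _ → refl }
  orbits≡1 : Euler.orbits ⊤-finite id ≡ 1
  orbits≡1 = classes-unique (proj₂ (Euler.orb-classes ⊤-finite id)) (one {Orb id} ε) id id id id
  comps≡1 : Euler.#C ⊤-finite point ≡ 1
  comps≡1 = classes-unique (proj₂ (Euler.comp-classes ⊤-finite point)) (one {Comp point} ε) id id id id

empty-planar : Euler.Planar ⊥-finite empty
empty-planar = trans (cong₂ _+_ (cong₂ _+_ orbits≡0 orbits≡0) orbits≡0) (cong (λ c → c + c) (sym comps≡0))
  where
  none : ∀ {R : ⊥ → ⊥ → Set} → Classes R 0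
  none = record { class = λ () ; rep = λ () ; class-rep = λ () ; sound = λ { {()} } ; complete = λ { {()} } }
  orbits≡0 : Euler.orbits ⊥-finite id ≡ 0
  orbits≡0 = classes-unique (proj₂ (Euler.orb-classes ⊥-finite id)) (none {Orb id}) id id id id
  comps≡0 : Euler.#C ⊥-finite empty ≡ 0
  comps≡0 = classes-unique (proj₂ (Euler.comp-classes ⊥-finite empty)) (none {Comp empty}) id id id id

-- Tutte's decomposition of rooted maps

data Tree : Set
deg : Tree → ℕ

data Tree where
  vertex  : Tree
  isthmus : Tree → Tree → Tree
  -- The index is the number of darts of the outer face of `t` that stay outer; with the new root
  -- dart they make up the degree.
  chord   : (t : Tree) → Fin (suc (deg t)) → Tree

deg vertex = 0
deg (isthmus t u) = suc (deg t + suc (deg u))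
deg (chord t i) = suc (toℕ i)

edges : Tree → ℕ
edges vertex = 0
edges (isthmus t u) = suc (edges t + edges u)
edges (chord t i) = suc (edges t)

Core : Tree → Set

Dart : Tree → Set
Dart t = ⊤ ⊎ Core t

Core vertex = ⊥
Core (isthmus t u) = Dart t ⊎ Dart u
Core (chord t i) = ⊤ ⊎ Dart t

pattern ∗ = inj₁ tt

core-finite : ∀ t → Finite (Core t)

dart-finite : ∀ t → Finite (Dart t)
dart-finite t = ⊎-finite ⊤-finite (core-finite t)

core-finite vertex = ⊥-finite
core-finite (isthmus t u) = ⊎-finite (dart-finite t) (dart-finite u)
core-finite (chord t i) = ⊎-finite ⊤-finite (dart-finite t)

entry : ∀ t → Dart t
entry vertex = ∗
entry (isthmus t u) = inj₂ (inj₂ ∗)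
entry (chord t i) = inj₂ ∗

-- The core of a tree is a rooted map, with root dart entry t. The pointed map has in addition a dead
-- dart ∗ preceding the root in the outer face, so that the vertex map needs no special treatment.

core : ∀ t → Map (Core t)

pointed : ∀ t → Map (Dart t)
pointed t = Euler.attach (dart-finite t) (point ⊕ core t) ∗ (entry t)

precore : ∀ t → Map (Core t)
precore vertex = empty
precore (isthmus t u) = pointed t ⊕ pointed u
-- The exponent runs from `1` to `deg t + 1`. At the last value the new dart goes before the old `∗`
-- itself, and the edge becomes a loop that cuts off a face of degree one.
precore (chord t i) = Euler.attach (⊎-finite ⊤-finite (dart-finite t)) (point ⊕ pointed t) ∗
  (inj₂ (iterate (φ (pointed t)) (suc (toℕ i)) ∗))

core vertex = empty
core (isthmus t u) = Euler.Edge.X⁺ (core-finite (isthmus t u)) (precore (isthmus t u))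
  {inj₂ ∗} {inj₁ ∗} (λ ()) refl refl
core (chord t i) = Euler.Edge.X⁺ (core-finite (chord t i)) (precore (chord t i))
  {∗} {inj₂ ∗} (λ ()) refl refl

pointed-vertex : pointed vertex ≋ (point ⊕ empty)
pointed-vertex = Euler.swap-same (dart-finite vertex) ∗ ∘ φ (point ⊕ empty) , λ _ → refl

precore-planar : ∀ t → Euler.Planar (core-finite t) (precore t)
core-planar : ∀ t → Euler.Planar (core-finite t) (core t)
pointed-planar : ∀ t → Euler.Planar (dart-finite t) (pointed t)

point⊕core-planar : ∀ t → Euler.Planar (dart-finite t) (point ⊕ core t)
point⊕core-planar t = planar-⊕ ⊤-finite (core-finite t) point (core t) point-planar (core-planar t)

pointed-planar vertex = Euler.planar-resp (dart-finite vertex) {point ⊕ empty} {pointed vertex}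
  (≋-sym {X = pointed vertex} {point ⊕ empty} pointed-vertex) (point⊕core-planar vertex)
pointed-planar t@(isthmus _ _) = Euler.AttachPlanarity.planar-attach (dart-finite t) (point ⊕ core t)
  (λ ()) refl refl (point⊕core-planar t)
pointed-planar t@(chord _ _) = Euler.AttachPlanarity.planar-attach (dart-finite t) (point ⊕ core t)
  (λ ()) refl refl (point⊕core-planar t)

precore-planar vertex = empty-planar
precore-planar (isthmus t u) = planar-⊕ (dart-finite t) (dart-finite u) (pointed t) (pointed u)
  (pointed-planar t) (pointed-planar u)
precore-planar (chord t i) = Euler.AttachPlanarity.planar-attach (⊎-finite ⊤-finite (dart-finite t))
  (point ⊕ pointed t) (λ ()) refl refl
  (planar-⊕ ⊤-finite (dart-finite t) point (pointed t) point-planar (pointed-planar t))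

core-planar vertex = empty-planar
core-planar (isthmus t u) = Euler.EdgePlanarity.planar-bridge (core-finite (isthmus t u)) (pointed t ⊕ pointed u)
  {inj₂ ∗} {inj₁ ∗} (λ ()) refl refl (comp-⊕⇒ (pointed t) (pointed u)) (precore-planar (isthmus t u))
core-planar (chord t i) = Euler.EdgePlanarity.planar-chord (core-finite (chord t i)) (precore (chord t i))
  {∗} {inj₂ ∗} (λ ()) refl refl
  -- The new dart sits before an iterate of the old `∗` under `φ`, so both ends of the chord lie on
  -- one face.
  (join⇒orb⁺ (inj₂ (inj₁ (ε , EqC.symmetric _ (EqC.gmap inj₂ (cong inj₂) (orb-iterate (φ (pointed t)) (suc (toℕ i)) ∗))))))
  (precore-planar (chord t i))
  where
  open Euler.Attach (⊎-finite ⊤-finite (dart-finite t)) (point ⊕ pointed t)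
    {∗} {inj₂ (iterate (φ (pointed t)) (suc (toℕ i)) ∗)} (λ ()) refl refl

-- Stated in `point ⊕ core t` because that is where `entry t` lives: the core of `vertex` has no
-- dart.
core-connected : ∀ t x → Comp (point ⊕ core t) (entry t) (inj₂ x)
pointed-connected : ∀ t x → Comp (pointed t) ∗ x

core-connected (isthmus t u) = λ where
    (inj₁ x) → EqC.gmap inj₂ (Sum.map (cong inj₂) (cong inj₂)) (EqC.transitive _ a∼⁺b
      (comp⇒comp⁺ (⇒comp-⊕ (pointed t) (pointed u) {inj₁ ∗} {inj₁ x} (pointed-connected t x))))
    (inj₂ x) → EqC.gmap inj₂ (Sum.map (cong inj₂) (cong inj₂))
      (comp⇒comp⁺ (⇒comp-⊕ (pointed t) (pointed u) {inj₂ ∗} {inj₂ x} (pointed-connected u x)))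
  where
  open Euler.Edge (core-finite (isthmus t u)) (precore (isthmus t u)) {inj₂ ∗} {inj₁ ∗} (λ ()) refl refl
core-connected (chord t i) = λ where
    ∗ → ε
    (inj₂ x) → EqC.gmap inj₂ (Sum.map (cong inj₂) (cong inj₂)) (EqC.transitive _ a∼⁺b
      (comp⇒comp⁺ (At.join⇒comp⁺ (inj₁ (⇒comp-⊕ point (pointed t) {inj₂ ∗} {inj₂ x} (pointed-connected t x))))))
  where
  open Euler.Edge (core-finite (chord t i)) (precore (chord t i)) {∗} {inj₂ ∗} (λ ()) refl refl
  module At = Euler.Attach (⊎-finite ⊤-finite (dart-finite t)) (point ⊕ pointed t)
    {∗} {inj₂ (iterate (φ (pointed t)) (suc (toℕ i)) ∗)} (λ ()) refl refl

pointed-connected t ∗ = ε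
pointed-connected t@(isthmus _ _) (inj₂ x) = join⇒comp⁺ (inj₂ (inj₁ (ε , core-connected t x)))
  where open Euler.Attach (dart-finite t) (point ⊕ core t) {∗} {entry t} (λ ()) refl refl
pointed-connected t@(chord _ _) (inj₂ x) = join⇒comp⁺ (inj₂ (inj₁ (ε , core-connected t x)))
  where open Euler.Attach (dart-finite t) (point ⊕ core t) {∗} {entry t} (λ ()) refl refl

core-alive : ∀ t x → α (core t) x ≢ x
pointed-alive : ∀ t x → α (pointed t) (inj₂ x) ≢ inj₂ x
pointed-alive t x = core-alive t x ∘ inj₂-injective

core-alive (isthmus t u) x eq
  with Euler.swap (core-finite (isthmus t u)) (inj₂ ∗) (inj₁ ∗) x
     | Euler.swap-case (core-finite (isthmus t u)) (inj₂ ∗) (inj₁ ∗) x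
... | _ | left = case-⊥ eq
  where
  case-⊥ : inj₁ ∗ ≢ inj₂ ∗
  case-⊥ ()
... | _ | right = case-⊥ eq
  where
  case-⊥ : inj₂ ∗ ≢ inj₁ ∗
  case-⊥ ()
core-alive (isthmus t u) (inj₁ ∗) eq | _ | other _ ≢b = ≢b refl
core-alive (isthmus t u) (inj₂ ∗) eq | _ | other ≢a _ = ≢a refl
core-alive (isthmus t u) (inj₁ (inj₂ x)) eq | _ | other _ _ = pointed-alive t x (inj₁-injective eq)
core-alive (isthmus t u) (inj₂ (inj₂ x)) eq | _ | other _ _ = pointed-alive u x (inj₂-injective eq)
core-alive (chord t i) x eq
  with Euler.swap (core-finite (chord t i)) ∗ (inj₂ ∗) x
     | Euler.swap-case (core-finite (chord t i)) ∗ (inj₂ ∗) x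
core-alive (chord t i) _ () | _ | left
core-alive (chord t i) _ () | _ | right
core-alive (chord t i) ∗ eq | _ | other ≢a _ = ≢a refl
core-alive (chord t i) (inj₂ ∗) eq | _ | other _ ≢b = ≢b refl
core-alive (chord t i) (inj₂ (inj₂ x)) eq | _ | other _ _ = pointed-alive t x (inj₂-injective eq)

-- The outer face of a pointed map

-- `P` is demanded of every dart except the final one. With `P = _≢ y`, a walk to `y` thus ends at
-- its first visit there, which determines its length.
data Walk {D : Set} (f : D → D) (P : D → Set) : D → ℕ → D → Set where
  []  : ∀ {x} → Walk f P x 0 x
  _∷_ : ∀ {x n y} → P x → Walk f P (f x) n y → Walk f P x (suc n) y

module _ {D : Set} {f : D → D} where

  _++ʷ_ : ∀ {P x m y n z} → Walk f P x m y → Walk f P y n z → Walk f P x (m + n) z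
  [] ++ʷ w = w
  (p ∷ w′) ++ʷ w = p ∷ (w′ ++ʷ w)

  walk-end : ∀ {P x n y} → Walk f P x n y → iterate f n x ≡ y
  walk-end [] = refl
  walk-end {x = x} (_∷_ {n = n} p w) = trans (sym (iterate-comm f n x)) (walk-end w)

  walk-inner : ∀ {P x n y} → Walk f P x n y → ∀ j → j < n → P (iterate f j x)
  walk-inner (p ∷ w) zero _ = p
  walk-inner {P} {x} (p ∷ w) (suc j) (s≤s j<n) = subst P (iterate-comm f j x) (walk-inner w j j<n)

  walk-build : ∀ {P} n x → (∀ j → j < n → P (iterate f j x)) → Walk f P x n (iterate f n x)
  walk-build zero x inner = []
  walk-build {P} (suc n) x inner = inner 0 (s≤s z≤n) ∷
    subst (Walk f P (f x) n) (iterate-comm f n x)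
      (walk-build n (f x) λ j j<n → subst P (sym (iterate-comm f j x)) (inner (suc j) (s≤s j<n)))

  walk-unique : ∀ {x y m n} → Walk f (_≢ y) x m y → Walk f (_≢ y) x n y → m ≡ n
  walk-unique [] [] = refl
  walk-unique [] (p ∷ _) = ⊥-elim (p refl)
  walk-unique (p ∷ _) [] = ⊥-elim (p refl)
  walk-unique (_ ∷ w) (_ ∷ w′) = cong suc (walk-unique w w′)

walk-map : ∀ {D E : Set} {f : D → D} {g : E → E} {P Q} (h : D → E) → (∀ x → P x → h (f x) ≡ g (h x)) →
           (∀ x → P x → Q (h x)) → ∀ {x n y} → Walk f P x n y → Walk g Q (h x) n (h y)
walk-map h comm P⇒Q [] = []
walk-map {g = g} {Q = Q} h comm P⇒Q {x} (p ∷ w) =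
  P⇒Q x p ∷ subst (λ z → Walk g Q z _ _) (comm x p) (walk-map h comm P⇒Q w)

-- The f-orbit of x has exactly n + 1 elements.
Period : ∀ {D : Set} → (D → D) → D → ℕ → Set
Period f x n = Walk f (_≢ x) (f x) n x

module _ {D : Set} {f : D → D} (inj : Injective _≡_ _≡_ f) {x : D} {n : ℕ} (period : Period f x n) where

  period-end : iterate f (suc n) x ≡ x
  period-end = trans (sym (iterate-comm f n x)) (walk-end period)

  period-inner : ∀ {j} → j < n → iterate f (suc j) x ≢ x
  period-inner {j} j<n = subst (_≢ x) (iterate-comm f j x) (walk-inner period j j<n)

  period-distinct< : ∀ {i j} → i < j → j ≤ n → iterate f (suc i) x ≢ iterate f (suc j) x
  period-distinct< {i} {j} i<j j≤n eq
    with m , m+i≡j , eq′ ← iterate-cancel inj x (s≤s i<j) eq =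
    period-inner (ℕₚ.≤-trans (ℕₚ.≤-trans (s≤s (ℕₚ.m≤m+n m i))
      (ℕₚ.≤-reflexive (ℕₚ.suc-injective (trans (sym (ℕₚ.+-suc (suc m) i)) m+i≡j)))) j≤n) eq′

  period-distinct : ∀ {i j} → i ≤ n → j ≤ n → iterate f (suc i) x ≡ iterate f (suc j) x → i ≡ j
  period-distinct {i} {j} i≤n j≤n eq with ℕₚ.<-cmp i j
  ... | tri< i<j _ _ = ⊥-elim (period-distinct< i<j j≤n eq)
  ... | tri≈ _ i≡j _ = i≡j
  ... | tri> _ _ j<i = ⊥-elim (period-distinct< j<i i≤n (sym eq))

  -- The exponents are shifted by one, so that the last index stands for `x` itself, in agreement
  -- with the positions of a chord.
  period-covers : ∀ m → ∃ λ (i : Fin (suc n)) → iterate f (suc (toℕ i)) x ≡ iterate f m x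
  period-covers zero = Fin.fromℕ n , trans (cong (λ j → iterate f (suc j) x) (Finₚ.toℕ-fromℕ n)) period-end
  period-covers (suc m) with i , eq ← period-covers m with toℕ i ℕ.≟ n
  ... | yes i≡n = Fin.zero , cong f (trans (sym period-end)
    (trans (cong (λ j → iterate f (suc j) x) (sym i≡n)) eq))
  ... | no i≢n = Fin.fromℕ< {suc (toℕ i)} (s≤s i<n) ,
    trans (cong (λ j → iterate f (suc j) x) (Finₚ.toℕ-fromℕ< (s≤s i<n))) (cong f eq)
    where
    i<n : toℕ i < n
    i<n = ℕₚ.≤∧≢⇒< (Finₚ.toℕ≤pred[n] i) i≢n

pointed-root : ∀ t → φ (pointed t) ∗ ≡ entry t
pointed-root t = Euler.swap-left (dart-finite t) ∗ (entry t)

outer-period : ∀ t → Period (φ (pointed t)) ∗ (deg t)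
outer-period vertex = subst (λ x → Walk (φ (pointed vertex)) (_≢ ∗) x 0 ∗) (sym (pointed-root vertex)) []
-- The face runs from `∗` to the root dart `a`, along the outer face of `t` up to `b`, the other end
-- of the isthmus, and then along the outer face of `u`.
outer-period (isthmus t u) = at (pointed-root (isthmus t u)) ((λ ()) ∷
    at φ-a (walk-map h₁ φ-h₁ (λ _ _ ()) (outer-period t)
      ++ʷ ((λ ()) ∷ subst (Walk Φ (_≢ ∗) _ _) (D.swap-right ∗ (inj₂ a))
             (at φ-b (walk-map h₂ φ-h₂ h₂≢∗ (outer-period u))))))
  where
  module C = Euler (core-finite (isthmus t u))
  module D = Euler (dart-finite (isthmus t u))
  Φ : Dart (isthmus t u) → Dart (isthmus t u)
  Φ = φ (pointed (isthmus t u))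
  a b : Core (isthmus t u)
  a = inj₂ ∗
  b = inj₁ ∗
  at : ∀ {x y n z} → x ≡ y → Walk Φ (_≢ ∗) y n z → Walk Φ (_≢ ∗) x n z
  at refl w = w
  h₁ : Dart t → Dart (isthmus t u)
  h₁ x = inj₂ (inj₁ x)
  -- In `pointed u` the face closes at its own `∗`, which is `a` here. The new `∗` now precedes `a`
  -- and is met instead.
  h₂ : Dart u → Dart (isthmus t u)
  h₂ y = D.swap ∗ (inj₂ a) (inj₂ (inj₂ y))
  exit : Core (isthmus t u) → Dart (isthmus t u)
  exit y = D.swap ∗ (inj₂ a) (inj₂ (φ (precore (isthmus t u)) y))
  φ-a : Φ (inj₂ a) ≡ h₁ (φ (pointed t) ∗)
  φ-a = trans (cong exit (C.swap-left a b)) (D.swap-other (λ ()) (λ ()))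
  φ-b : Φ (inj₂ b) ≡ h₂ (φ (pointed u) ∗)
  φ-b = cong exit (C.swap-right a b)
  φ-h₁ : ∀ x → x ≢ ∗ → h₁ (φ (pointed t) x) ≡ Φ (h₁ x)
  φ-h₁ x x≢∗ = sym (trans (cong exit (C.swap-other (λ ()) (x≢∗ ∘ inj₁-injective))) (D.swap-other (λ ()) (λ ())))
  h₂-other : ∀ y → y ≢ ∗ → h₂ y ≡ inj₂ (inj₂ y)
  h₂-other y y≢∗ = D.swap-other (λ ()) (y≢∗ ∘ inj₂-injective ∘ inj₂-injective)
  φ-h₂ : ∀ y → y ≢ ∗ → h₂ (φ (pointed u) y) ≡ Φ (h₂ y)
  φ-h₂ y y≢∗ = sym (trans (cong Φ (h₂-other y y≢∗)) (cong exit (C.swap-other (y≢∗ ∘ inj₂-injective) (λ ()))))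
  h₂≢∗ : ∀ y → y ≢ ∗ → h₂ y ≢ ∗
  h₂≢∗ y y≢∗ eq with () ← trans (sym (h₂-other y y≢∗)) eq
outer-period (chord t i) = at (pointed-root (chord t i)) ((λ ()) ∷
    subst (Walk Φ (_≢ ∗) _ _) h-q (at φ-a (walk-map h φ-h h≢∗ prefix)))
  where
  module C = Euler (core-finite (chord t i))
  module D = Euler (dart-finite (chord t i))
  Φ : Dart (chord t i) → Dart (chord t i)
  Φ = φ (pointed (chord t i))
  a b : Core (chord t i)
  a = ∗
  b = inj₂ ∗
  q : Dart t
  q = iterate (φ (pointed t)) (suc (toℕ i)) ∗
  at : ∀ {x y n z} → x ≡ y → Walk Φ (_≢ ∗) y n z → Walk Φ (_≢ ∗) x n z
  at refl w = w
  exit : Core (chord t i) → Dart (chord t i)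
  exit y = D.swap ∗ (inj₂ a) (inj₂ (φ (precore (chord t i)) y))
  -- What leads to `q` in `pointed t` leads to `a` once `a` is inserted before `q`, and to `∗` once
  -- `∗` is inserted before `a`.
  h : Dart t → Dart (chord t i)
  h y = D.swap ∗ (inj₂ a) (inj₂ (C.swap a (inj₂ q) (inj₂ y)))
  h-q : h q ≡ ∗
  h-q = trans (cong (D.swap ∗ (inj₂ a) ∘ inj₂) (C.swap-right a (inj₂ q))) (D.swap-right ∗ (inj₂ a))
  h-other : ∀ y → y ≢ q → h y ≡ inj₂ (inj₂ y)
  h-other y y≢q = trans (cong (D.swap ∗ (inj₂ a) ∘ inj₂) (C.swap-other (λ ()) (y≢q ∘ inj₂-injective)))
    (D.swap-other (λ ()) (λ ()))
  φ-a : Φ (inj₂ a) ≡ h (φ (pointed t) ∗)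
  φ-a = cong exit (C.swap-left a b)
  φ-h : ∀ y → y ≢ q × y ≢ ∗ → h (φ (pointed t) y) ≡ Φ (h y)
  φ-h y (y≢q , y≢∗) = sym (trans (cong Φ (h-other y y≢q)) (cong exit (C.swap-other (λ ()) (y≢∗ ∘ inj₂-injective))))
  h≢∗ : ∀ y → y ≢ q × y ≢ ∗ → h y ≢ ∗
  h≢∗ y (y≢q , _) eq with () ← trans (sym (h-other y y≢q)) eq
  φt-injective : Injective _≡_ _≡_ (φ (pointed t))
  φt-injective = φ-injective (pointed t)
  i≤deg : toℕ i ≤ deg t
  i≤deg = Finₚ.toℕ≤pred[n] i
  -- The part of the outer face of `t` that stays outer. It has to avoid `q` and the old `∗` until
  -- its end, since `h` and `φ` deviate there.
  prefix : Walk (φ (pointed t)) (λ y → y ≢ q × y ≢ ∗) (φ (pointed t) ∗) (toℕ i) q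
  prefix = subst (Walk _ _ _ _) (iterate-comm (φ (pointed t)) (toℕ i) ∗)
    (walk-build (toℕ i) (φ (pointed t) ∗) λ j j<i →
      subst (λ y → y ≢ q × y ≢ ∗) (sym (iterate-comm (φ (pointed t)) j ∗))
        ( period-distinct< φt-injective (outer-period t) j<i i≤deg
        , period-inner φt-injective (outer-period t) (ℕₚ.≤-trans j<i i≤deg)))

-- Embeddings of maps

-- For finite `D` the image is a union of components of `Y`, and the rest of `Y` is left arbitrary.
record Hom {D E : Set} (X : Map D) (Y : Map E) : Set where
  field
    fun       : D → E
    injective : Injective _≡_ _≡_ fun
    φ-hom     : ∀ x → fun (φ X x) ≡ φ Y (fun x)
    α-hom     : ∀ x → fun (α X x) ≡ α Y (fun x)

open Hom

module _ {D E : Set} {X : Map D} {Y : Map E} (h : Hom X Y) where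

  hom-orb : ∀ {x y} → Orb (φ X) x y → Orb (φ Y) (fun h x) (fun h y)
  hom-orb = EqC.gmap (fun h) λ {x} eq → trans (sym (φ-hom h x)) (cong (fun h) eq)

  hom-comp : ∀ {x y} → Comp X x y → Comp Y (fun h x) (fun h y)
  hom-comp = EqC.gmap (fun h) λ {x} → Sum.map
    (λ eq → trans (sym (φ-hom h x)) (cong (fun h) eq))
    (λ eq → trans (sym (α-hom h x)) (cong (fun h) eq))

  hom-source : ∀ {X′} → X ≋ X′ → Hom X′ Y
  hom-source (p , q) = record
    { fun = fun h ; injective = injective h
    ; φ-hom = λ x → trans (cong (fun h) (sym (p x))) (φ-hom h x)
    ; α-hom = λ x → trans (cong (fun h) (sym (q x))) (α-hom h x) }

  hom-target : ∀ {Y′} → Y ≋ Y′ → Hom X Y′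
  hom-target (p , q) = record
    { fun = fun h ; injective = injective h
    ; φ-hom = λ x → trans (φ-hom h x) (p _)
    ; α-hom = λ x → trans (α-hom h x) (q _) }

  module _ (F : Finite D) (G : Finite E) where

    hom-attach : ∀ {x q x′ q′} → fun h x ≡ x′ → fun h q ≡ q′ →
                 Hom (Surgery.attach F X x q) (Surgery.attach G Y x′ q′)
    hom-attach hx hq = record
      { fun = fun h ; injective = injective h ; α-hom = α-hom h
      ; φ-hom = λ y → trans (swap-natural (Finite._≟_ F) (Finite._≟_ G) (fun h) (injective h) _ _ _)
          (trans (cong₂ (λ x q → Surgery.swap G x q _) hx hq) (cong (Surgery.swap G _ _) (φ-hom h y))) }

    hom-edge : ∀ {a b a′ b′} → fun h a ≡ a′ → fun h b ≡ b′ → ∀ comm comm′ →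
               Hom (Surgery.edge F X a b comm) (Surgery.edge G Y a′ b′ comm′)
    hom-edge {a} {b} {a′} {b′} ha hb _ _ = record
      { fun = fun h ; injective = injective h
      ; φ-hom = λ y → trans (φ-hom h _) (cong (φ Y) (swap-hom y))
      ; α-hom = λ y → trans (α-hom h _) (cong (α Y) (swap-hom y)) }
      where
      swap-hom : ∀ y → fun h (Surgery.swap F a b y) ≡ Surgery.swap G a′ b′ (fun h y)
      swap-hom y = trans (swap-natural (Finite._≟_ F) (Finite._≟_ G) (fun h) (injective h) a b y)
        (cong₂ (λ a b → Surgery.swap G a b (fun h y)) ha hb)

hom-∘ : ∀ {A B C : Set} {X : Map A} {Y : Map B} {Z : Map C} → Hom Y Z → Hom X Y → Hom X Z
hom-∘ g h = record
  { fun = fun g ∘ fun h ; injective = injective h ∘ injective g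
  ; φ-hom = λ x → trans (cong (fun g) (φ-hom h x)) (φ-hom g _)
  ; α-hom = λ x → trans (cong (fun g) (α-hom h x)) (α-hom g _) }

module _ {A B : Set} {X : Map A} {Y : Map B} where

  hom-inj₁ : Hom X (X ⊕ Y)
  hom-inj₁ = record { fun = inj₁ ; injective = inj₁-injective ; φ-hom = λ _ → refl ; α-hom = λ _ → refl }

  hom-inj₂ : Hom Y (X ⊕ Y)
  hom-inj₂ = record { fun = inj₂ ; injective = inj₂-injective ; φ-hom = λ _ → refl ; α-hom = λ _ → refl }

  hom-copair : ∀ {C : Set} {Z : Map C} (g : Hom X Z) (h : Hom Y Z) → (∀ x y → fun g x ≢ fun h y) → Hom (X ⊕ Y) Z
  hom-copair g h disjoint = record
    { fun = [ fun g , fun h ]′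
    ; injective = λ
        { {inj₁ x} {inj₁ y} eq → cong inj₁ (injective g eq)
        ; {inj₁ x} {inj₂ y} eq → ⊥-elim (disjoint x y eq)
        ; {inj₂ x} {inj₁ y} eq → ⊥-elim (disjoint y x (sym eq))
        ; {inj₂ x} {inj₂ y} eq → cong inj₂ (injective h eq) }
    ; φ-hom = λ { (inj₁ x) → φ-hom g x ; (inj₂ y) → φ-hom h y }
    ; α-hom = λ { (inj₁ x) → α-hom g x ; (inj₂ y) → α-hom h y } }

hom-point : ∀ {D : Set} {X : Map D} r → φ X r ≡ r → α X r ≡ r → Hom point X
hom-point r φr αr = record { fun = λ _ → r ; injective = λ _ → refl ; φ-hom = λ _ → sym φr ; α-hom = λ _ → sym αr }

-- The deleted edge joins the dart newEdge t to the dart oldRoot t, the former ∗ of (one of) the smaller maps.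

data Composite : Tree → Set where
  isthmus : ∀ {t u} → Composite (isthmus t u)
  chord   : ∀ {t i} → Composite (chord t i)

newEdge oldRoot : ∀ {t} → Composite t → Core t
newEdge (isthmus {t} {u}) = inj₂ ∗
newEdge (chord {t} {i}) = ∗
oldRoot (isthmus {t} {u}) = inj₁ ∗
oldRoot (chord {t} {i}) = inj₂ ∗

entry-newEdge : ∀ {t} (c : Composite t) → entry t ≡ inj₂ (newEdge c)
entry-newEdge isthmus = refl
entry-newEdge chord = refl

newEdge-dead : ∀ {t} (c : Composite t) → α (precore t) (newEdge c) ≡ newEdge c
newEdge-dead isthmus = refl
newEdge-dead chord = refl

oldRoot-dead : ∀ {t} (c : Composite t) → α (precore t) (oldRoot c) ≡ oldRoot c
oldRoot-dead isthmus = refl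
oldRoot-dead chord = refl

newEdge≢oldRoot : ∀ {t} (c : Composite t) → newEdge c ≢ oldRoot c
newEdge≢oldRoot isthmus ()
newEdge≢oldRoot chord ()

precore-comm : ∀ {t} (c : Composite t) x →
  Surgery.swap (core-finite t) (newEdge c) (oldRoot c) (α (precore t) x) ≡
  α (precore t) (Surgery.swap (core-finite t) (newEdge c) (oldRoot c) x)
precore-comm {t} c = Surgery.dead-comm (core-finite t) (precore t) (newEdge-dead c) (oldRoot-dead c)

core-edge : ∀ {t} (c : Composite t) → Euler.Edge.X⁺ (core-finite t) (precore t)
  {newEdge c} {oldRoot c} (newEdge≢oldRoot c) (newEdge-dead c) (oldRoot-dead c) ≋ core t
core-edge isthmus = (λ _ → refl) , (λ _ → refl)
core-edge chord = (λ _ → refl) , (λ _ → refl)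

core-delete : ∀ {t} (c : Composite t) comm →
  Surgery.edge (core-finite t) (core t) (newEdge c) (oldRoot c) comm ≋ precore t
core-delete {t} c@isthmus = Surgery.edge-edge (core-finite t) (precore t) (newEdge c) (oldRoot c) (precore-comm c)
core-delete {t} c@chord = Surgery.edge-edge (core-finite t) (precore t) (newEdge c) (oldRoot c) (precore-comm c)

α-newEdge : ∀ {t} (c : Composite t) → α (core t) (newEdge c) ≡ oldRoot c
α-newEdge {t} isthmus = cong (α (precore t)) (Euler.swap-left (core-finite t) _ _)
α-newEdge {t} chord = cong (α (precore t)) (Euler.swap-left (core-finite t) _ _)

edge-comm-core : ∀ {t} (c : Composite t) x →
  Surgery.swap (core-finite t) (newEdge c) (oldRoot c) (α (core t) x) ≡
  α (core t) (Surgery.swap (core-finite t) (newEdge c) (oldRoot c) x)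
edge-comm-core {t} c = subst
  (λ b → ∀ x → Surgery.swap (core-finite t) (newEdge c) b (α (core t) x) ≡
               α (core t) (Surgery.swap (core-finite t) (newEdge c) b x))
  (α-newEdge c) (Surgery.edge-comm (core-finite t) (core t) (newEdge c))

-- One step of the decomposition, carried out in the ambient map: the dart `r` is taken out of its
-- face, then the root edge is deleted. Since `Y` depends on no tree, different trees can be peeled
-- in it simultaneously.
module Peel {E : Set} (G : Finite E) (X : Map E) (r : E) where
  open Euler G

  a : E
  a = φ X r

  X₁ : Map E
  X₁ = attach X r a

  Y : Map E
  Y = edge X₁ a (α X a) (edge-comm X₁ a)

  module _ (αr : α X r ≡ r) (r≢a : r ≢ a) where

    r-isolated : φ X₁ r ≡ r
    r-isolated = swap-right r a

    peel : ∀ {t} (c : Composite t) (h : Hom (pointed t) X) → fun h ∗ ≡ r →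
           Σ (Hom (precore t) Y) λ k → fun k (newEdge c) ≡ a × fun k (oldRoot c) ≡ α X a
    peel {t} c h refl = hom-source
        (hom-edge h₁ (core-finite t) G h-newEdge h-oldRoot (edge-comm-core c) (edge-comm X₁ a))
        (core-delete c (edge-comm-core c))
      , h-newEdge , h-oldRoot
      where
      h-entry : fun h (entry t) ≡ a
      h-entry = trans (cong (fun h) (sym (pointed-root t))) (φ-hom h ∗)
      h-newEdge : fun h (inj₂ (newEdge c)) ≡ a
      h-newEdge = trans (cong (fun h) (sym (entry-newEdge c))) h-entry
      h-oldRoot : fun h (inj₂ (oldRoot c)) ≡ α X a
      h-oldRoot = trans (cong (fun h ∘ inj₂) (sym (α-newEdge c))) (trans (α-hom h _) (cong (α X) h-newEdge))
      h₁ : Hom (core t) X₁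
      h₁ = hom-∘ (hom-source (hom-attach h (dart-finite t) G refl h-entry)
             (Euler.attach-attach (dart-finite t) (point ⊕ core t) ∗ (entry t)))
             (hom-inj₂ {X = point} {Y = core t})

    -- The point `∗` is sent to `r`, so injectivity requires that `k` miss `r`.
    unpeel : ∀ {t} (c : Composite t) (k : Hom (precore t) Y) → fun k (newEdge c) ≡ a → fun k (oldRoot c) ≡ α X a →
             (∀ x → fun k x ≢ r) → Σ (Hom (pointed t) X) λ h → fun h ∗ ≡ r
    unpeel {t} c k k-newEdge k-oldRoot avoids =
      hom-target (hom-attach h₁ (dart-finite t) G refl
        (trans (cong (fun h₁) (entry-newEdge c)) k-newEdge)) (attach-attach X r a) , refl
      where
      k₁ : Hom (core t) X₁
      k₁ = hom-target
             (hom-source (hom-edge k (core-finite t) G k-newEdge k-oldRoot (precore-comm c) comm) (core-edge c))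
             (edge-edge X₁ a (α X a) (edge-comm X₁ a) comm)
        where
        comm : ∀ x → swap a (α X a) (α Y x) ≡ α Y (swap a (α X a) x)
        comm x = trans (cong (swap a (α X a)) (sym (edge-comm X₁ a x)))
          (trans (swap-invol a (α X a) (α X x)) (cong (α X) (sym (swap-invol a (α X a) x))))
      h₁ : Hom (point ⊕ core t) X₁
      h₁ = hom-copair (hom-point r r-isolated αr) k₁ λ _ x → avoids x ∘ sym

module _ {E : Set} (G : Finite E) {Y : Map E} t i (k : Hom (precore (chord t i)) Y) where
  open Euler G

  private
    K = core-finite (chord t i)
    q : Core (chord t i)
    q = inj₂ (iterate (φ (pointed t)) (suc (toℕ i)) ∗)

  chord-next : fun k q ≡ φ Y (fun k ∗)
  chord-next = trans (cong (fun k) (sym (Euler.swap-left K ∗ q))) (φ-hom k ∗)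

  -- The target mentions neither `t` nor `i`, so that embeddings belonging to different chords at
  -- the same dart become comparable.
  chord-detach : ∀ {a} → fun k ∗ ≡ a → Hom (pointed t) (attach Y a (φ Y a))
  chord-detach ka = hom-∘
    (hom-source (hom-attach k K G ka (trans chord-next (cong (φ Y) ka))) (Euler.attach-attach K (point ⊕ pointed t) ∗ q))
    (hom-inj₂ {X = point} {Y = pointed t})

-- `m` and `m′` agree at `∗` and hence along its orbit. Both send the dart chosen by their index to
-- `φ X a`, and different indices choose different darts of the outer face.
chord-index-unique : ∀ {E : Set} (G : Finite E) {X : Map E} t i i′ {a b}
  (k : Hom (precore (chord t i)) X) (k′ : Hom (precore (chord t i′)) X) →
  fun k ∗ ≡ a → fun k′ ∗ ≡ a → fun k (inj₂ ∗) ≡ b → fun k′ (inj₂ ∗) ≡ b → i ≡ i′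
chord-index-unique {E} G {X} t i i′ {a} {b} k k′ ka k′a kb k′b = Finₚ.toℕ-injective
  (period-distinct (φ-injective (pointed t)) (outer-period t) (Finₚ.toℕ≤pred[n] i) (Finₚ.toℕ≤pred[n] i′)
    (injective m (begin
      fun m (iterate (φ (pointed t)) (suc (toℕ i)) ∗)   ≡⟨ chord-next G t i k ⟩
      φ X (fun k ∗)                                     ≡⟨ cong (φ X) (trans ka (sym k′a)) ⟩
      φ X (fun k′ ∗)                                    ≡⟨ sym (chord-next G t i′ k′) ⟩
      fun m′ (iterate (φ (pointed t)) (suc (toℕ i′)) ∗) ≡⟨ iterate-hom {g = φ Z} (fun m′) (φ-hom m′) (suc (toℕ i′)) ∗ ⟩
      iterate (φ Z) (suc (toℕ i′)) (fun m′ ∗)           ≡⟨ cong (iterate (φ Z) (suc (toℕ i′))) (trans k′b (sym kb)) ⟩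
      iterate (φ Z) (suc (toℕ i′)) (fun m ∗)            ≡⟨ sym (iterate-hom {g = φ Z} (fun m) (φ-hom m) (suc (toℕ i′)) ∗) ⟩
      fun m (iterate (φ (pointed t)) (suc (toℕ i′)) ∗)  ∎)))
  where
  open ≡-Reasoning
  Z : Map E
  Z = Euler.attach G X a (φ X a)
  m m′ : Hom (pointed t) Z
  m = chord-detach G t i k ka
  m′ = chord-detach G t i′ k′ k′a

isthmus-separates : ∀ {E : Set} {Y : Map E} t u (k : Hom (precore (isthmus t u)) Y) n →
                    iterate (φ Y) n (fun k (inj₁ ∗)) ≢ fun k (inj₂ ∗)
isthmus-separates t u k n eq = subst (SumRel _ _ (inj₁ ∗))
  (injective k (trans (iterate-hom (fun k) (φ-hom k) n (inj₁ ∗)) eq))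
  (orb-⊕⇒ {f = φ (pointed t)} {φ (pointed u)} (orb-iterate (φ (pointed t ⊕ pointed u)) n (inj₁ ∗)))

chord-joins : ∀ t i → Orb (φ (precore (chord t i))) (inj₂ ∗) ∗
chord-joins t i = join⇒orb⁺ (inj₂ (inj₂ (EqC.gmap inj₂ (cong inj₂) (orb-iterate (φ (pointed t)) (suc (toℕ i)) ∗) , ε)))
  where
  open Euler.Attach (⊎-finite ⊤-finite (dart-finite t)) (point ⊕ pointed t)
    {∗} {inj₂ (iterate (φ (pointed t)) (suc (toℕ i)) ∗)} (λ ()) refl refl

module _ {E : Set} (G : Finite E) where
  open Euler G

  -- The kind of the root edge is visible after its deletion: the two ends share a cycle of `φ` for
  -- a chord and never for an isthmus.
  isthmus≠chord : ∀ {Y : Map E} t u t′ i (k : Hom (precore (isthmus t u)) Y) (k′ : Hom (precore (chord t′ i)) Y) →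
                  fun k (inj₂ ∗) ≡ fun k′ ∗ → fun k (inj₁ ∗) ≢ fun k′ (inj₂ ∗)
  isthmus≠chord {Y} t u t′ i k k′ ka≡ kb≡
    with n , eq ← orb⇒iterate (φ-injective Y) (hom-orb k′ (chord-joins t′ i)) =
    isthmus-separates t u k n (trans (cong (iterate (φ Y) n) kb≡) (trans eq (sym ka≡)))

  hom-root-dead : ∀ t {X : Map E} (h : Hom (pointed t) X) → α X (fun h ∗) ≡ fun h ∗
  hom-root-dead t h = sym (α-hom h ∗)

  hom-root-next : ∀ t {X : Map E} → Composite t → (h : Hom (pointed t) X) → fun h ∗ ≢ φ X (fun h ∗)
  hom-root-next t c h eq
    with () ← trans (injective h (trans eq (sym (φ-hom h ∗)))) (trans (pointed-root t) (entry-newEdge c))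

  vertex≠composite : ∀ t {X : Map E} → Composite t → (h : Hom (pointed vertex) X) (h′ : Hom (pointed t) X) →
                     fun h ∗ ≢ fun h′ ∗
  vertex≠composite t {X} c h h′ eq = hom-root-next t c h′
    (trans (sym eq) (trans (cong (fun h) (sym (pointed-root vertex))) (trans (φ-hom h ∗) (cong (φ X) eq))))

  private
    -- Lets `t ≡ t′` be matched before the indices are compared, as their types depend on the trees.
    finish : ∀ {X : Map E} {a b} t i t′ i′ (k : Hom (precore (chord t i)) X) (k′ : Hom (precore (chord t′ i′)) X) →
      fun k ∗ ≡ a → fun k (inj₂ ∗) ≡ b → fun k′ ∗ ≡ a → fun k′ (inj₂ ∗) ≡ b → t ≡ t′ → chord t i ≡ chord t′ i′
    finish t i _ i′ k k′ ka kb k′a k′b refl = cong (chord t) (chord-index-unique G t i i′ k k′ ka k′a kb k′b)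

  -- Whether `φ` fixes the root tells `vertex` from the other trees. Those are peeled in the same
  -- `X`, and their parts embed at the same two darts of the same smaller map, where the induction
  -- continues.
  pointed-unique : ∀ t t′ {X : Map E} (h : Hom (pointed t) X) (h′ : Hom (pointed t′) X) → fun h ∗ ≡ fun h′ ∗ → t ≡ t′

  composite-unique : ∀ t t′ {X : Map E} {a b} (k : Hom (precore t) X) (k′ : Hom (precore t′) X) →
    (c : Composite t) (c′ : Composite t′) → fun k (newEdge c) ≡ a → fun k (oldRoot c) ≡ b →
    fun k′ (newEdge c′) ≡ a → fun k′ (oldRoot c′) ≡ b → t ≡ t′
  composite-unique (isthmus t u) (isthmus t′ u′) {X} k k′ isthmus isthmus ka kb k′a k′b = cong₂ isthmus
    (pointed-unique t t′ (hom-∘ k (hom-inj₁ {X = pointed t} {Y = pointed u})) (hom-∘ k′ (hom-inj₁ {X = pointed t′} {Y = pointed u′})) (trans kb (sym k′b)))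
    (pointed-unique u u′ (hom-∘ k (hom-inj₂ {X = pointed t} {Y = pointed u})) (hom-∘ k′ (hom-inj₂ {X = pointed t′} {Y = pointed u′})) (trans ka (sym k′a)))
  composite-unique (isthmus t u) (chord t′ i) k k′ isthmus chord ka kb k′a k′b =
    ⊥-elim (isthmus≠chord t u t′ i k k′ (trans ka (sym k′a)) (trans kb (sym k′b)))
  composite-unique (chord t′ i) (isthmus t u) k k′ chord isthmus ka kb k′a k′b =
    ⊥-elim (isthmus≠chord t u t′ i k′ k (trans k′a (sym ka)) (trans k′b (sym kb)))
  composite-unique (chord t i) (chord t′ i′) {X} k k′ chord chord ka kb k′a k′b = finish t i t′ i′ k k′ ka kb k′a k′b
    (pointed-unique t t′ (chord-detach G t i k ka) (chord-detach G t′ i′ k′ k′a) (trans kb (sym k′b)))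

  composite-unique′ : ∀ t t′ {X : Map E} (c : Composite t) (c′ : Composite t′)
    (h : Hom (pointed t) X) (h′ : Hom (pointed t′) X) → fun h ∗ ≡ fun h′ ∗ → t ≡ t′
  composite-unique′ t t′ {X} c c′ h h′ eq
    with k , ka , kb ← Peel.peel G X (fun h ∗) (hom-root-dead t h) (hom-root-next t c h) c h refl
    with k′ , k′a , k′b ← Peel.peel G X (fun h ∗) (hom-root-dead t h) (hom-root-next t c h) c′ h′ (sym eq) =
    composite-unique t t′ k k′ c c′ ka kb k′a k′b

  pointed-unique vertex vertex h h′ eq = refl
  pointed-unique vertex t′@(isthmus _ _) h h′ eq = ⊥-elim (vertex≠composite t′ isthmus h h′ eq)
  pointed-unique vertex t′@(chord _ _) h h′ eq = ⊥-elim (vertex≠composite t′ chord h h′ eq)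
  pointed-unique t@(isthmus _ _) vertex h h′ eq = ⊥-elim (vertex≠composite t isthmus h′ h (sym eq))
  pointed-unique t@(chord _ _) vertex h h′ eq = ⊥-elim (vertex≠composite t chord h′ h (sym eq))
  pointed-unique t@(isthmus _ _) t′@(isthmus _ _) h h′ eq = composite-unique′ t t′ isthmus isthmus h h′ eq
  pointed-unique t@(isthmus _ _) t′@(chord _ _) h h′ eq = composite-unique′ t t′ isthmus chord h h′ eq
  pointed-unique t@(chord _ _) t′@(isthmus _ _) h h′ eq = composite-unique′ t t′ chord isthmus h h′ eq
  pointed-unique t@(chord _ _) t′@(chord _ _) h h′ eq = composite-unique′ t t′ chord chord h h′ eq

-- Every planar pointed map arises from a tree

module Extraction {E : Set} (G : Finite E) where
  open Euler G

  -- The invariant of the extraction. Other components may contain dead darts: earlier roots,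
  -- detached darts, or the root of the other half of a cut isthmus.
  record Rootable (X : Map E) (r : E) : Set where
    field
      planar : Planar X
      dead   : α X r ≡ r
      sole   : ∀ {x} → Comp X r x → α X x ≡ x → x ≡ r

  Embedded : Map E → E → Set
  Embedded X r = ∃ λ t → Σ (Hom (pointed t) X) λ h → fun h ∗ ≡ r

  module Step (X : Map E) (r : E) (R : Rootable X r) (r≢a : r ≢ φ X r) where
    open Rootable R
    open Peel G X r using (a; X₁; Y; r-isolated; unpeel)

    b : E
    b = α X a

    alive : b ≢ a
    alive αa = r≢a (sym (sole (fwd (inj₁ refl) ◅ ε) αa))

    r≢b : r ≢ b
    r≢b r≡b = r≢a (trans (sym dead) (trans (cong (α X) r≡b) (α-involutive X a)))

    module At = AttachPlanarity X₁ {r} {a} r≢a (r-isolated dead r≢a) dead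

    planar₁ : Planar X₁
    planar₁ = At.planar-detach (planar-resp {X} {At.X⁺} (≋-sym {X = At.X⁺} {X} (attach-attach X r a)) planar)

    module Del = DeletePlanarity X₁ a alive planar₁

    comp-Y⇒X : ∀ {x y} → Comp Y x y → Comp X x y
    comp-Y⇒X = comp-resp {X = At.X⁺} {X} (attach-attach X r a) ∘ At.join⇒comp⁺ ∘ inj₁ ∘
      comp-resp {X = Del.X⁺} {X₁} Del.X⁺≋X ∘ Del.comp⇒comp⁺

    φY-r : φ Y r ≡ r
    φY-r = trans (cong (φ X₁) (swap-other r≢a r≢b)) (r-isolated dead r≢a)

    αY-r : α Y r ≡ r
    αY-r = trans (cong (α X) (swap-other r≢a r≢b)) dead

    r-alone : ∀ {x} → Comp Y x r → x ≡ r
    r-alone xr = comp-invariant Y (_≡ r) (λ { _ refl → φY-r })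
      (λ z eq → φ-injective Y (trans eq (sym φY-r))) (λ { _ refl → αY-r }) (EqC.symmetric _ xr) refl

    #A-step : #A Y ≡ suc (#A X)
    #A-step = Del.#A-delete

    comp-ra : Comp X r a
    comp-ra = fwd (inj₁ refl) ◅ ε

    comp-rb : Comp X r b
    comp-rb = EqC.transitive _ comp-ra (fwd (inj₂ refl) ◅ ε)

    dead-in-Y : ∀ {x} → Comp X r x → x ≢ r → α Y x ≡ x → x ≡ a ⊎ x ≡ b
    dead-in-Y {x} rx x≢r αx with x ≟ a | x ≟ b
    ... | yes x≡a | _ = inj₁ x≡a
    ... | no _ | yes x≡b = inj₂ x≡b
    ... | no x≢a | no x≢b = ⊥-elim (x≢r (sole rx (trans (cong (α X) (sym (swap-other x≢a x≢b))) αx)))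

    module Isthmus (¬ab : ¬ Orb (φ Y) a b) where

      ¬comp-ab : ¬ Comp Y a b
      ¬comp-ab = Del.bridge-disconnects ¬ab

      rootable-a : Rootable Y a
      rootable-a = record
        { planar = Del.planar-bridge-delete ¬ab
        ; dead = Del.Y-a
        ; sole = λ {x} ax αx → [ id , (λ { refl → ⊥-elim (¬comp-ab ax) }) ]′
            (dead-in-Y (EqC.transitive _ comp-ra (comp-Y⇒X ax)) (λ { refl → r≢a (sym (r-alone ax)) }) αx) }

      rootable-b : Rootable Y b
      rootable-b = record
        { planar = Del.planar-bridge-delete ¬ab
        ; dead = Del.Y-b
        ; sole = λ {x} bx αx → [ (λ { refl → ⊥-elim (¬comp-ab (EqC.symmetric _ bx)) }) , id ]′
            (dead-in-Y (EqC.transitive _ comp-rb (comp-Y⇒X bx)) (λ { refl → r≢b (sym (r-alone bx)) }) αx) }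

      module Assemble (t u : Tree) (h : Hom (pointed t) Y) (k : Hom (pointed u) Y) (h∗ : fun h ∗ ≡ b) (k∗ : fun k ∗ ≡ a) where

        comp-b : ∀ x → Comp Y b (fun h x)
        comp-b x = subst (λ z → Comp Y z (fun h x)) h∗ (hom-comp {X = pointed t} {Y} h (pointed-connected t x))

        comp-a : ∀ x → Comp Y a (fun k x)
        comp-a x = subst (λ z → Comp Y z (fun k x)) k∗ (hom-comp {X = pointed u} {Y} k (pointed-connected u x))

        disjoint : ∀ x y → fun h x ≢ fun k y
        disjoint x y eq = ¬comp-ab (EqC.transitive _ (comp-a y)
          (subst (λ z → Comp Y z b) eq (EqC.symmetric _ (comp-b x))))

        hk : Hom (precore (isthmus t u)) Y
        hk = hom-copair {X = pointed t} {pointed u} {Z = Y} h k disjoint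

        avoids : ∀ x → fun hk x ≢ r
        avoids (inj₁ x) eq = r≢b (sym (r-alone (subst (Comp Y b) eq (comp-b x))))
        avoids (inj₂ x) eq = r≢a (sym (r-alone (subst (Comp Y a) eq (comp-a x))))

        assembled : Embedded X r
        assembled = isthmus t u , unpeel dead r≢a {isthmus t u} isthmus hk k∗ h∗ avoids

      assemble : Embedded Y b → Embedded Y a → Embedded X r
      assemble (t , h , h∗) (u , k , k∗) = Assemble.assembled t u h k h∗ k∗

    module Chord (ab : Orb (φ Y) a b) where

      q : E
      q = φ Y a

      a≢q : a ≢ q
      a≢q a≡q = alive (isolated (φ-injective Y) (sym a≡q) ab)

      -- In `Y` the dead darts `a` and `b` lie in one component. Taking `a` out of its face leaves
      -- `b` as the only dead dart there.
      Y₃ : Map E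
      Y₃ = attach Y a q

      φ₃-a : φ Y₃ a ≡ a
      φ₃-a = swap-right a q

      module At₃ = AttachPlanarity Y₃ {a} {q} a≢q φ₃-a Del.Y-a

      Y₃⁺≋Y : At₃.X⁺ ≋ Y
      Y₃⁺≋Y = attach-attach Y a q

      comp-Y₃⇒Y : ∀ {x y} → Comp Y₃ x y → Comp Y x y
      comp-Y₃⇒Y = comp-resp {X = At₃.X⁺} {Y} Y₃⁺≋Y ∘ At₃.join⇒comp⁺ ∘ inj₁

      b≁a : ∀ {x} → Comp Y₃ b x → x ≢ a
      b≁a bx refl = alive (At₃.alone (EqC.symmetric _ bx))

      b≁r : ∀ {x} → Comp Y₃ b x → x ≢ r
      b≁r bx refl = r≢b (sym (r-alone (comp-Y₃⇒Y bx)))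

      rootable-b : Rootable Y₃ b
      rootable-b = record
        { planar = At₃.planar-detach (planar-resp {Y} {At₃.X⁺} (≋-sym {X = At₃.X⁺} {Y} Y₃⁺≋Y) (Del.planar-chord-delete ab))
        ; dead = Del.Y-b
        ; sole = λ {x} bx αx → [ (λ x≡a → ⊥-elim (b≁a bx x≡a)) , id ]′
            (dead-in-Y (EqC.transitive _ comp-rb (comp-Y⇒X (comp-Y₃⇒Y bx))) (b≁r bx) αx) }

      -- `Y` is `Y₃` with `a` inserted before `q`. As `a` is isolated in `Y₃`, its orbit can contain
      -- `b` in `Y` only by way of `q`.
      orb-bq : Orb (φ Y₃) b q
      orb-bq with At₃.orb⁺⇒join (EqC.map (λ {x} eq → trans (swap-invol a q (φ Y x)) eq) ab)
      ... | inj₁ ab₃ = ⊥-elim (alive (isolated (φ-injective Y₃) φ₃-a ab₃))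
      ... | inj₂ (inj₁ (_ , qb)) = EqC.symmetric _ qb
      ... | inj₂ (inj₂ (_ , ab₃)) = ⊥-elim (alive (isolated (φ-injective Y₃) φ₃-a ab₃))

      module Assemble (t : Tree) (h : Hom (pointed t) Y₃) (h∗ : fun h ∗ ≡ b) where

        comp-b : ∀ x → Comp Y₃ b (fun h x)
        comp-b x = subst (λ z → Comp Y₃ z (fun h x)) h∗ (hom-comp {X = pointed t} {Y₃} h (pointed-connected t x))

        -- The origin of the chord index: `q` lies on the face of `b`, whose darts are listed by the
        -- outer face of `pointed t`.
        find : ∃ λ (i : Fin (suc (deg t))) → fun h (iterate (φ (pointed t)) (suc (toℕ i)) ∗) ≡ q
        find with n , eq ← orb⇒iterate (φ-injective Y₃) orb-bq
             with i , eq′ ← period-covers (φ-injective (pointed t)) (outer-period t) n =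
          i , trans (cong (fun h) eq′) (trans (iterate-hom {g = φ Y₃} (fun h) (φ-hom h) n ∗)
                (trans (cong (iterate (φ Y₃) n) h∗) eq))

        h₃ : Hom (point ⊕ pointed t) Y₃
        h₃ = hom-copair {X = point} {pointed t} {Z = Y₃} (hom-point {X = Y₃} a φ₃-a Del.Y-a) h λ _ x eq → b≁a (comp-b x) (sym eq)

        i : Fin (suc (deg t))
        i = proj₁ find

        k : Hom (precore (chord t i)) Y
        k = hom-target {X = precore (chord t i)} {At₃.X⁺} (hom-attach {X = point ⊕ pointed t} {Y₃} h₃ (core-finite (chord t i)) G refl (proj₂ find)) Y₃⁺≋Y

        avoids : ∀ x → fun k x ≢ r
        avoids ∗ eq = r≢a (sym eq)
        avoids (inj₂ x) = b≁r (comp-b x)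

        assembled : Embedded X r
        assembled = chord t i , unpeel dead r≢a {chord t i} chord k refl h∗ avoids

      assemble : Embedded Y₃ b → Embedded X r
      assemble (t , h , h∗) = Assemble.assembled t h h∗

  vertex-hom : ∀ X r → α X r ≡ r → φ X r ≡ r → Embedded X r
  vertex-hom X r αr φr = vertex , hom-source
    (hom-copair {X = point} {empty} {Z = X} (hom-point {X = X} r φr αr)
      (record { fun = λ () ; injective = λ { {()} } ; φ-hom = λ () ; α-hom = λ () }) λ _ ())
    (≋-sym {X = pointed vertex} {point ⊕ empty} pointed-vertex) , refl

  private
    extract-fuel : ∀ k X r → size ≤ k + #A X → Rootable X r → Embedded X r
    extract-step : ∀ k X r → size ≤ k + #A X → Rootable X r → r ≢ φ X r → Embedded X r

    extract-fuel k X r bound R with r ≟ φ X r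
    ... | yes r≡φr = vertex-hom X r (Rootable.dead R) (sym r≡φr)
    ... | no r≢φr = extract-step k X r bound R r≢φr

    extract-step zero X r bound R r≢φr = ⊥-elim (ℕₚ.<-irrefl refl (ℕₚ.≤-trans
      (ℕₚ.≤-reflexive (sym #A-step)) (ℕₚ.≤-trans (#A≤size (Peel.Y G X r)) bound)))
      where open Step X r R r≢φr
    extract-step (suc k) X r bound R r≢φr with orb? (φ (Peel.Y G X r)) (φ X r) (α X (φ X r))
    ... | no ¬ab = assemble (extract-fuel k (Peel.Y G X r) _ bound′ rootable-b)
                            (extract-fuel k (Peel.Y G X r) _ bound′ rootable-a)
      where
      open Step X r R r≢φr
      open Isthmus ¬ab
      bound′ : size ≤ k + #A (Peel.Y G X r)
      bound′ = ℕₚ.≤-trans bound (ℕₚ.≤-reflexive (trans (sym (ℕₚ.+-suc k (#A X))) (cong (k +_) (sym #A-step))))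
    ... | yes ab = assemble (extract-fuel k Y₃ _
        (ℕₚ.≤-trans bound (ℕₚ.≤-reflexive (trans (sym (ℕₚ.+-suc k (#A X))) (cong (k +_) (sym #A-step))))) rootable-b)
      where
      open Step X r R r≢φr
      open Chord ab

  extract : ∀ X r → Rootable X r → Embedded X r
  extract X r = extract-fuel size X r (ℕₚ.m≤m+n size _)

-- Normal planar terms

data Neutral : ℕ → Set
data Normal : ℕ → Set

-- With k + j rather than j + k free variables in an application, adding a last variable to
-- the argument, or to the function when the argument is closed, is definitionally well-typed.
data Neutral where
  var : Neutral 1
  app : ∀ {j k} → Neutral j → Normal k → Neutral (k + j)

data Normal where
  ne  : ∀ {i} → Neutral i → Normal i
  lam : ∀ {i} → Normal (suc i) → Normal i

sizeᵇ : ∀ {i} → Neutral i → ℕ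
sizeʳ : ∀ {i} → Normal i → ℕ
sizeᵇ var = 0
sizeᵇ (app p q) = sizeᵇ p + sizeʳ q
sizeʳ (ne p) = suc (sizeᵇ p)
sizeʳ (lam q) = sizeʳ q

-- The summands follow the order of the list of outer neutral handles, so that the enumeration below
-- numbers handles as the list does.
Handleᵇ : ∀ {i} → Neutral i → Set
Handleʳ : ∀ {i} → Normal i → Set
Handleᵇ var = ⊤
Handleᵇ (app {k = zero} p q) = ⊤ ⊎ (Handleʳ q ⊎ Handleᵇ p)
Handleᵇ (app {k = suc k} p q) = ⊤ ⊎ Handleʳ q
Handleʳ (ne p) = Handleᵇ p
Handleʳ (lam q) = Handleʳ q

handleᵇ-finite : ∀ {i} (p : Neutral i) → Finite (Handleᵇ p)
handleʳ-finite : ∀ {i} (q : Normal i) → Finite (Handleʳ q)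
handleᵇ-finite var = ⊤-finite
handleᵇ-finite (app {k = zero} p q) = ⊎-finite ⊤-finite (⊎-finite (handleʳ-finite q) (handleᵇ-finite p))
handleᵇ-finite (app {k = suc k} p q) = ⊎-finite ⊤-finite (handleʳ-finite q)
handleʳ-finite (ne p) = handleᵇ-finite p
handleʳ-finite (lam q) = handleʳ-finite q

#handlesᵇ : ∀ {i} → Neutral i → ℕ
#handlesᵇ = Finite.size ∘ handleᵇ-finite

#handlesʳ : ∀ {i} → Normal i → ℕ
#handlesʳ = Finite.size ∘ handleʳ-finite

whole : ∀ {i} (p : Neutral i) → Handleᵇ p
whole var = tt
whole (app {k = zero} p q) = inj₁ tt
whole (app {k = suc k} p q) = inj₁ tt

-- Replaces the handle h by its application h(y) to a new last variable y.
insᵇ : ∀ {i} (p : Neutral i) → Handleᵇ p → Neutral (suc i)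
insʳ : ∀ {i} (q : Normal i) → Handleʳ q → Normal (suc i)
insᵇ var tt = app var (ne var)
insᵇ (app {k = zero} p q) (inj₁ tt) = app (app p q) (ne var)
insᵇ (app {k = zero} p q) (inj₂ (inj₁ h)) = app p (insʳ q h)
insᵇ (app {k = zero} p q) (inj₂ (inj₂ h)) = app (insᵇ p h) q
insᵇ (app {k = suc k} p q) (inj₁ tt) = app (app p q) (ne var)
insᵇ (app {k = suc k} p q) (inj₂ h) = app p (insʳ q h)
insʳ (ne p) h = ne (insᵇ p h)
insʳ (lam q) h = lam (insʳ q h)

-- Applies the maximal application y(u₁)...(uₖ) of the last variable y to one more argument.
addᵇ : ∀ {i} → Neutral i → Normal 0 → Neutral i
addʳ : ∀ {i} → Normal i → Normal 0 → Normal i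
addᵇ var u = app var u
addᵇ (app {k = suc k} p q) u = app p (addʳ q u)
addᵇ (app {zero} {zero} p q) u = app (app p q) u
addᵇ (app {suc zero} {zero} p q) u = app (app p q) u
addᵇ (app {suc (suc j)} {zero} p q) u = app (addᵇ p u) q
addʳ (ne p) u = ne (addᵇ p u)
addʳ (lam q) u = lam (addʳ q u)

neutral-open : ¬ Neutral 0
neutral-open p = go p refl
  where
  go : ∀ {i} → Neutral i → i ≢ 0
  go (app {k = zero} p _) eq = go p eq

size-insᵇ : ∀ {i} (p : Neutral i) h → sizeᵇ (insᵇ p h) ≡ suc (sizeᵇ p)
size-insʳ : ∀ {i} (q : Normal i) h → sizeʳ (insʳ q h) ≡ suc (sizeʳ q)
size-insᵇ var tt = refl
size-insᵇ (app {k = zero} p q) (inj₁ tt) = ℕₚ.+-comm (sizeᵇ (app p q)) 1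
size-insᵇ (app {k = zero} p q) (inj₂ (inj₁ h)) = trans (cong (sizeᵇ p +_) (size-insʳ q h)) (ℕₚ.+-suc (sizeᵇ p) (sizeʳ q))
size-insᵇ (app {k = zero} p q) (inj₂ (inj₂ h)) = cong (_+ sizeʳ q) (size-insᵇ p h)
size-insᵇ (app {k = suc k} p q) (inj₁ tt) = ℕₚ.+-comm (sizeᵇ (app p q)) 1
size-insᵇ (app {k = suc k} p q) (inj₂ h) = trans (cong (sizeᵇ p +_) (size-insʳ q h)) (ℕₚ.+-suc (sizeᵇ p) (sizeʳ q))
size-insʳ (ne p) h = cong suc (size-insᵇ p h)
size-insʳ (lam q) h = size-insʳ q h

size-addᵇ : ∀ {i} (p : Neutral i) u → sizeᵇ (addᵇ p u) ≡ sizeᵇ p + sizeʳ u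
size-addʳ : ∀ {i} (q : Normal i) u → sizeʳ (addʳ q u) ≡ sizeʳ q + sizeʳ u
size-addᵇ var u = refl
size-addᵇ (app {zero} {zero} p q) u = refl
size-addᵇ (app {suc zero} {zero} p q) u = refl
size-addᵇ (app {suc (suc j)} {zero} p q) u = begin
  sizeᵇ (addᵇ p u) + sizeʳ q     ≡⟨ cong (_+ sizeʳ q) (size-addᵇ p u) ⟩
  sizeᵇ p + sizeʳ u + sizeʳ q    ≡⟨ ℕₚ.+-assoc (sizeᵇ p) (sizeʳ u) (sizeʳ q) ⟩
  sizeᵇ p + (sizeʳ u + sizeʳ q)  ≡⟨ cong (sizeᵇ p +_) (ℕₚ.+-comm (sizeʳ u) (sizeʳ q)) ⟩
  sizeᵇ p + (sizeʳ q + sizeʳ u)  ≡⟨ sym (ℕₚ.+-assoc (sizeᵇ p) (sizeʳ q) (sizeʳ u)) ⟩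
  sizeᵇ p + sizeʳ q + sizeʳ u    ∎
  where open ≡-Reasoning
size-addᵇ (app {k = suc k} p q) u =
  trans (cong (sizeᵇ p +_) (size-addʳ q u)) (sym (ℕₚ.+-assoc (sizeᵇ p) (sizeʳ q) (sizeʳ u)))
size-addʳ (ne p) u = cong suc (size-addᵇ p u)
size-addʳ (lam q) u = size-addʳ q u

-- The handles listed before `h` survive, followed by `h(y)` and `y`. Those listed after `h` now lie
-- in the function part of an application whose argument contains `y`, and are no longer outer.
#handles-insᵇ : ∀ {i} (p : Neutral i) h → #handlesᵇ (insᵇ p h) ≡ 2 + toℕ (Finite.to (handleᵇ-finite p) h)
#handles-insʳ : ∀ {i} (q : Normal i) h → #handlesʳ (insʳ q h) ≡ 2 + toℕ (Finite.to (handleʳ-finite q) h)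
#handles-insᵇ var tt = refl
#handles-insᵇ (app {k = zero} p q) (inj₁ tt) = refl
#handles-insᵇ (app {k = zero} p q) (inj₂ (inj₁ h)) =
  cong suc (trans (#handles-insʳ q h) (cong (2 +_) (sym (Finₚ.toℕ-↑ˡ (Finite.to (handleʳ-finite q) h) (#handlesᵇ p)))))
#handles-insᵇ (app {k = zero} p q) (inj₂ (inj₂ h)) = cong suc (begin
  #handlesʳ q + #handlesᵇ (insᵇ p h)                        ≡⟨ cong (#handlesʳ q +_) (#handles-insᵇ p h) ⟩
  #handlesʳ q + (2 + toℕ (Finite.to (handleᵇ-finite p) h))  ≡⟨ trans (ℕₚ.+-suc _ _) (cong suc (ℕₚ.+-suc _ _)) ⟩
  2 + (#handlesʳ q + toℕ (Finite.to (handleᵇ-finite p) h))  ≡⟨ cong (2 +_) (sym (Finₚ.toℕ-↑ʳ (#handlesʳ q) (Finite.to (handleᵇ-finite p) h))) ⟩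
  2 + toℕ (#handlesʳ q Fin.↑ʳ Finite.to (handleᵇ-finite p) h) ∎)
  where open ≡-Reasoning
#handles-insᵇ (app {k = suc k} p q) (inj₁ tt) = refl
#handles-insᵇ (app {k = suc k} p q) (inj₂ h) = cong suc (#handles-insʳ q h)
#handles-insʳ (ne p) h = #handles-insᵇ p h
#handles-insʳ (lam q) h = #handles-insʳ q h

#handles-addᵇ : ∀ {i} (p : Neutral i) u → #handlesᵇ (addᵇ p u) ≡ suc (#handlesʳ u + #handlesᵇ p)
#handles-addʳ : ∀ {i} (q : Normal (suc i)) u → #handlesʳ (addʳ q u) ≡ suc (#handlesʳ u + #handlesʳ q)
#handles-addᵇ var u = refl
#handles-addᵇ (app {zero} {zero} p q) u = refl
#handles-addᵇ (app {suc zero} {zero} p q) u = refl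
#handles-addᵇ (app {suc (suc j)} {zero} p q) u = cong suc (begin
  Q + #handlesᵇ (addᵇ p u)  ≡⟨ cong (Q +_) (#handles-addᵇ p u) ⟩
  Q + suc (U + P)           ≡⟨ ℕₚ.+-suc Q (U + P) ⟩
  suc (Q + (U + P))         ≡⟨ cong suc (sym (ℕₚ.+-assoc Q U P)) ⟩
  suc (Q + U + P)           ≡⟨ cong (λ i → suc (i + P)) (ℕₚ.+-comm Q U) ⟩
  suc (U + Q + P)           ≡⟨ cong suc (ℕₚ.+-assoc U Q P) ⟩
  suc (U + (Q + P))         ≡⟨ sym (ℕₚ.+-suc U (Q + P)) ⟩
  U + suc (Q + P)           ∎)
  where
  open ≡-Reasoning
  Q U P : ℕ
  Q = #handlesʳ q
  U = #handlesʳ u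
  P = #handlesᵇ p
#handles-addᵇ (app {k = suc k} p q) u = cong suc (trans (#handles-addʳ q u) (sym (ℕₚ.+-suc _ _)))
#handles-addʳ (ne p) u = #handles-addᵇ p u
#handles-addʳ (lam q) u = #handles-addʳ q u

data Lastᵇ : ∀ {i} → Neutral i → Set where
  var   : Lastᵇ var
  spine : ∀ {i} (p : Neutral i) u → Lastᵇ (addᵇ p u)
  arg   : ∀ {i} (p : Neutral i) h → Lastᵇ (insᵇ p h)

data Lastʳ : ∀ {i} → Normal i → Set where
  var   : Lastʳ (ne var)
  spine : ∀ {i} (q : Normal (suc i)) u → Lastʳ (addʳ q u)
  arg   : ∀ {i} (q : Normal i) h → Lastʳ (insʳ q h)

ins-whole : ∀ {i} (p : Neutral i) → insᵇ p (whole p) ≡ app p (ne var)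
ins-whole var = refl
ins-whole (app {k = zero} p q) = refl
ins-whole (app {k = suc k} p q) = refl

-- A neutral term with a single free variable has it as head and only closed arguments, hence is
-- itself the maximal application of that variable. The index equation is a hypothesis because
-- `k + j` does not unify with `1`.
add-single : ∀ {i} → i ≡ 1 → (p : Neutral i) (u : Normal 0) → addᵇ p u ≡ app p u
add-single _ var u = refl
add-single _ (app {zero} {zero} p q) u = refl
add-single _ (app {suc zero} {zero} p q) u = refl
add-single _ (app {zero} {suc k} p q) u = ⊥-elim (neutral-open p)
add-single eq (app {suc j} {suc k} p q) u
  with () ← trans (sym (ℕₚ.+-suc k j)) (ℕₚ.suc-injective eq)

-- The last variable of an application lies in the argument unless that is closed. If the argument
-- is the bare variable, the handle is the whole function.
lastᵇ : ∀ {i} (p : Neutral i) → Lastᵇ p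
lastʳ : ∀ {i} (q : Normal (suc i)) → Lastʳ q
lastᵇ var = var
lastᵇ (app {zero} {zero} p q) = ⊥-elim (neutral-open p)
lastᵇ (app {suc zero} {zero} p q) = subst Lastᵇ (add-single refl p q) (spine p q)
lastᵇ (app {suc (suc j)} {zero} p q) = go (lastᵇ p)
  where
  go : ∀ {j} {p : Neutral (suc (suc j))} → Lastᵇ p → Lastᵇ (app p q)
  go (spine p u) = spine (app p q) u
  go (arg p h) = arg (app p q) (inj₂ (inj₂ h))
lastᵇ (app {j} {suc k} p q) = go (lastʳ q)
  where
  go : ∀ {k} {q : Normal (suc k)} → Lastʳ q → Lastᵇ (app p q)
  go var = subst Lastᵇ (ins-whole p) (arg p (whole p))
  go (spine q u) = spine (app p q) u
  go {zero} (arg q h) = arg (app p q) (inj₂ (inj₁ h))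
  go {suc k} (arg q h) = arg (app p q) (inj₂ h)
lastʳ (ne p) = go (lastᵇ p)
  where
  go : ∀ {i} {p : Neutral (suc i)} → Lastᵇ p → Lastʳ (ne p)
  go var = var
  go (spine p u) = spine (ne p) u
  go (arg p h) = arg (ne p) h
lastʳ (lam q) = go (lastʳ q)
  where
  go : ∀ {i} {q : Normal (suc (suc i))} → Lastʳ q → Lastʳ (lam q)
  go (spine q u) = spine (lam q) u
  go (arg q h) = arg (lam q) h

-- The indices of `Lastᵇ` are values of `addᵇ` and `insᵇ`, which unification cannot invert.
-- Uniqueness of the decomposition comes instead from functions that compute the parts and undo
-- `addᵇ` and `insᵇ`.
data Partsᵇ : ℕ → Set where
  var   : ∀ {i} → Partsᵇ i
  spine : ∀ {i} → Neutral i → Normal 0 → Partsᵇ i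
  arg   : ∀ {i} (p : Neutral i) → Handleᵇ p → Partsᵇ (suc i)

data Partsʳ : ℕ → Set where
  var   : ∀ {i} → Partsʳ i
  spine : ∀ {i} → Normal i → Normal 0 → Partsʳ i
  arg   : ∀ {i} (q : Normal i) → Handleʳ q → Partsʳ (suc i)

parts-fun : ∀ {j} → Normal 0 → Partsᵇ j → Partsᵇ j
parts-fun q var = var
parts-fun q (spine p u) = spine (app p q) u
parts-fun q (arg p h) = arg (app p q) (inj₂ (inj₂ h))

parts-arg : ∀ {j k} → Neutral j → Partsʳ (suc k) → Partsᵇ (suc k + j)
parts-arg p (spine q u) = spine (app p q) u
parts-arg {k = zero} p var = arg p (whole p)
parts-arg {k = suc k} p var = var
parts-arg {k = zero} p (arg q h) = arg (app p q) (inj₂ (inj₁ h))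
parts-arg {k = suc k} p (arg q h) = arg (app p q) (inj₂ h)

parts-ne : ∀ {i} → Partsᵇ i → Partsʳ i
parts-ne var = var
parts-ne (spine p u) = spine (ne p) u
parts-ne (arg p h) = arg (ne p) h

parts-lam : ∀ {i} → Partsʳ (suc (suc i)) → Partsʳ (suc i)
parts-lam var = var
parts-lam (spine q u) = spine (lam q) u
parts-lam (arg q h) = arg (lam q) h

-- The values on terms without a last variable are irrelevant.
partsᵇ : ∀ {i} → Neutral i → Partsᵇ i
partsʳ : ∀ {i} → Normal (suc i) → Partsʳ (suc i)
partsᵇ (app {k = suc k} p q) = parts-arg p (partsʳ q)
partsᵇ var = var
partsᵇ (app {zero} {zero} p q) = var
partsᵇ (app {suc zero} {zero} p q) = spine p q
partsᵇ (app {suc (suc j)} {zero} p q) = parts-fun q (partsᵇ p)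
partsʳ (ne p) = parts-ne (partsᵇ p)
partsʳ (lam q) = parts-lam (partsʳ q)

parts-addᵇ : ∀ {i} (p : Neutral i) u → partsᵇ (addᵇ p u) ≡ spine p u
parts-addʳ : ∀ {i} (q : Normal (suc i)) u → partsʳ (addʳ q u) ≡ spine q u
parts-addᵇ var u = refl
parts-addᵇ (app {k = suc k} p q) u = cong (parts-arg p) (parts-addʳ q u)
parts-addᵇ (app {zero} {zero} p q) u = ⊥-elim (neutral-open p)
parts-addᵇ (app {suc zero} {zero} p q) u = refl
parts-addᵇ (app {suc (suc j)} {zero} p q) u = cong (parts-fun q) (parts-addᵇ p u)
parts-addʳ (ne p) u = cong parts-ne (parts-addᵇ p u)
parts-addʳ (lam q) u = cong parts-lam (parts-addʳ q u)

parts-insᵇ : ∀ {i} (p : Neutral i) h → partsᵇ (insᵇ p h) ≡ arg p h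
parts-insʳ : ∀ {i} (q : Normal i) h → partsʳ (insʳ q h) ≡ arg q h
parts-insᵇ var tt = refl
parts-insᵇ (app {zero} {zero} p q) h = ⊥-elim (neutral-open p)
parts-insᵇ (app {k = zero} p q) (inj₁ tt) = refl
parts-insᵇ (app {k = zero} p q) (inj₂ (inj₁ h)) = cong (parts-arg p) (parts-insʳ q h)
parts-insᵇ (app {suc j} {zero} p q) (inj₂ (inj₂ h)) = cong (parts-fun q) (parts-insᵇ p h)
parts-insᵇ (app {k = suc k} p q) (inj₁ tt) = refl
parts-insᵇ (app {k = suc k} p q) (inj₂ h) = cong (parts-arg p) (parts-insʳ q h)
parts-insʳ (ne p) h = cong parts-ne (parts-insᵇ p h)
parts-insʳ (lam q) h = cong parts-lam (parts-insʳ q h)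

-- Trees and normal terms with one free variable

term : Tree → Normal 1
#handles-term : ∀ t → #handlesʳ (term t) ≡ suc (deg t)

position : ∀ t → Fin (suc (deg t)) → Handleʳ (term t)
position t i = Finite.from (handleʳ-finite (term t)) (Fin.cast (sym (#handles-term t)) i)

term vertex = ne var
term (isthmus t u) = addʳ (term t) (lam (term u))
-- `lam` binds the first variable, that of `term t`; the inserted last variable becomes the free
-- one.
term (chord t i) = lam (insʳ (term t) (position t i))

#handles-term vertex = refl
#handles-term (isthmus t u) = trans (#handles-addʳ (term t) (lam (term u)))
  (cong suc (trans (cong₂ _+_ (#handles-term u) (#handles-term t)) (ℕₚ.+-comm (suc (deg u)) (suc (deg t)))))
#handles-term (chord t i) = trans (#handles-insʳ (term t) (position t i))
  (cong (2 +_) (trans (cong toℕ (Finite.to-from (handleʳ-finite (term t)) _)) (Finₚ.toℕ-cast (sym (#handles-term t)) i)))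

size-term : ∀ t → sizeʳ (term t) ≡ suc (edges t)
size-term vertex = refl
size-term (isthmus t u) = trans (size-addʳ (term t) (lam (term u)))
  (trans (cong₂ _+_ (size-term t) (size-term u)) (cong suc (ℕₚ.+-suc (edges t) (edges u))))
size-term (chord t i) = trans (size-insʳ (term t) (position t i)) (cong suc (size-term t))

position-injective : ∀ t {i j} → position t i ≡ position t j → i ≡ j
position-injective t {i} {j} eq = Finₚ.toℕ-injective (begin
  toℕ i                                                  ≡⟨ sym (Finₚ.toℕ-cast e i) ⟩
  toℕ (Fin.cast e i)                                     ≡⟨ cong toℕ (sym (to-from (Fin.cast e i))) ⟩
  toℕ (to (position t i))                                ≡⟨ cong (toℕ ∘ to) eq ⟩
  toℕ (to (position t j))                                ≡⟨ cong toℕ (to-from (Fin.cast e j)) ⟩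
  toℕ (Fin.cast e j)                                     ≡⟨ Finₚ.toℕ-cast e j ⟩
  toℕ j                                                  ∎)
  where
  open ≡-Reasoning
  open Finite (handleʳ-finite (term t))
  e : suc (deg t) ≡ #handlesʳ (term t)
  e = sym (#handles-term t)

position-surjective : ∀ t h → ∃ λ i → position t i ≡ h
position-surjective t h = Fin.cast (#handles-term t) (to h) , trans
  (cong from (Finₚ.toℕ-injective (trans (Finₚ.toℕ-cast (sym (#handles-term t)) _) (Finₚ.toℕ-cast (#handles-term t) (to h)))))
  (from-to h)
  where open Finite (handleʳ-finite (term t))

parts-term : Tree → Partsʳ 1
parts-term vertex = var
parts-term (isthmus t u) = spine (term t) (lam (term u))
parts-term (chord t i) = arg (lam (term t)) (position t i)

parts-of-term : ∀ t → partsʳ (term t) ≡ parts-term t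
parts-of-term vertex = refl
parts-of-term (isthmus t u) = parts-addʳ (term t) (lam (term u))
parts-of-term (chord t i) = cong parts-lam (parts-insʳ (term t) (position t i))

spine-injective : ∀ {q q′ : Normal 1} {u u′} → Partsʳ.spine q (lam u) ≡ spine q′ (lam u′) → q ≡ q′ × u ≡ u′
spine-injective refl = refl , refl

arg-injectiveˡ : ∀ {q q′ : Normal 1} {h h′} → Partsʳ.arg (lam q) h ≡ arg (lam q′) h′ → q ≡ q′
arg-injectiveˡ refl = refl

arg-injectiveʳ : ∀ {q : Normal 1} {h h′} → Partsʳ.arg (lam q) h ≡ arg (lam q) h′ → h ≡ h′
arg-injectiveʳ refl = refl

term-injective : ∀ t t′ → term t ≡ term t′ → t ≡ t′
term-injective t t′ eq = go t t′ (trans (sym (parts-of-term t)) (trans (cong partsʳ eq) (parts-of-term t′)))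
  where
  go : ∀ t t′ → parts-term t ≡ parts-term t′ → t ≡ t′
  go vertex vertex _ = refl
  go (isthmus t u) (isthmus t′ u′) eq with p , q ← spine-injective eq =
    cong₂ isthmus (term-injective t t′ p) (term-injective u u′ q)
  go (chord t i) (chord t′ i′) eq with term-injective t t′ (arg-injectiveˡ eq)
  ... | refl = cong (chord t) (position-injective t (arg-injectiveʳ eq))

term-surjective : ∀ q → ∃ λ t → term t ≡ q
term-surjective q = go (sizeʳ q) q ℕₚ.≤-refl
  where
  size>0 : ∀ {i} (q : Normal i) → 1 ≤ sizeʳ q
  size>0 (ne p) = s≤s z≤n
  size>0 (lam q) = size>0 q
  go : ∀ n (q : Normal 1) → sizeʳ q ≤ n → ∃ λ t → term t ≡ q
  by-last : ∀ n {q : Normal 1} → Lastʳ q → sizeʳ q ≤ suc n → ∃ λ t → term t ≡ q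
  go zero q bound with () ← ℕₚ.≤-trans (size>0 q) bound
  go (suc n) q bound = by-last n (lastʳ q) bound
  by-last n var bound = vertex , refl
  -- A closed normal term is an abstraction, since a neutral term contains its head variable free.
  -- The same excludes `arg (ne p) h`.
  by-last n (spine q (ne p)) bound = ⊥-elim (neutral-open p)
  by-last n (spine q (lam u)) bound
    with t , t≡ ← go n q (ℕₚ.≤-pred (ℕₚ.≤-trans (ℕₚ.≤-trans (ℕₚ.≤-reflexive (ℕₚ.+-comm 1 (sizeʳ q)))
           (ℕₚ.+-monoʳ-≤ (sizeʳ q) (size>0 u))) (ℕₚ.≤-trans (ℕₚ.≤-reflexive (sym (size-addʳ q (lam u)))) bound)))
    with v , v≡ ← go n u (ℕₚ.≤-pred (ℕₚ.≤-trans (ℕₚ.+-monoˡ-≤ (sizeʳ u) (size>0 q))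
           (ℕₚ.≤-trans (ℕₚ.≤-reflexive (sym (size-addʳ q (lam u)))) bound))) =
    isthmus t v , cong₂ (λ q u → addʳ q (lam u)) t≡ v≡
  by-last n (arg (ne p) h) bound = ⊥-elim (neutral-open p)
  by-last n (arg (lam q) h) bound
    with t , refl ← go n q (ℕₚ.≤-pred (ℕₚ.≤-trans (ℕₚ.≤-reflexive (sym (size-insʳ q h))) bound))
    with i , refl ← position-surjective t h = chord t i , refl

-- Opened only here: the constructors a, s, v and ℓ would clash with the bound variables above.
open import Defs

-- Colored skeletons as normal terms

toᵇ : ∀ {i} {p : Sk i} → Neu p → Neutral i
toʳ : ∀ {i} {p : Sk i} → Nor p → Normal i
toᵇ v = var
toᵇ (a {j} {k} π ρ) = subst Neutral (ℕₚ.+-comm k j) (app (toᵇ π) (toʳ ρ))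
toʳ (s π) = ne (toᵇ π)
toʳ (ℓ π) = lam (toʳ π)

app-neu : ∀ {j k} → Σ (Sk j) Neu → Σ (Sk k) Nor → Σ (Sk (j + k)) Neu
app-neu (p , π) (q , ρ) = app p q , a π ρ

s-nor : ∀ {i} → Σ (Sk i) Neu → Σ (Sk i) Nor
s-nor (p , π) = p , s π

ℓ-nor : ∀ {i} → Σ (Sk (suc i)) Nor → Σ (Sk i) Nor
ℓ-nor (p , π) = lam p , ℓ π

fromᵇ : ∀ {i} → Neutral i → Σ (Sk i) Neu
fromʳ : ∀ {i} → Normal i → Σ (Sk i) Nor
fromᵇ var = var , v
fromᵇ (app {j} {k} p q) = subst (λ i → Σ (Sk i) Neu) (ℕₚ.+-comm j k) (app-neu (fromᵇ p) (fromʳ q))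
fromʳ (ne p) = s-nor (fromᵇ p)
fromʳ (lam q) = ℓ-nor (fromʳ q)

subst-natural : ∀ {P Q : ℕ → Set} (f : ∀ {i} → P i → Q i) {i j} (e : i ≡ j) x → f (subst P e x) ≡ subst Q e (f x)
subst-natural f refl x = refl

subst-loop : ∀ {P : ℕ → Set} {i j} (e : i ≡ j) (e′ : j ≡ i) (x : P i) → subst P e′ (subst P e x) ≡ x
subst-loop refl refl x = refl

subst-constant : ∀ {A : Set} {P : ℕ → Set} (f : ∀ {i} → P i → A) {i j} (e : i ≡ j) x → f (subst P e x) ≡ f x
subst-constant f refl x = refl

from-toᵇ : ∀ {i} {p : Sk i} (π : Neu p) → fromᵇ (toᵇ π) ≡ (p , π)
from-toʳ : ∀ {i} {p : Sk i} (π : Nor p) → fromʳ (toʳ π) ≡ (p , π)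
from-toᵇ v = refl
from-toᵇ (a {j} {k} π ρ) = trans (subst-natural fromᵇ (ℕₚ.+-comm k j) (app (toᵇ π) (toʳ ρ)))
  (trans (subst-loop (ℕₚ.+-comm j k) (ℕₚ.+-comm k j) (app-neu (fromᵇ (toᵇ π)) (fromʳ (toʳ ρ))))
         (cong₂ app-neu (from-toᵇ π) (from-toʳ ρ)))
from-toʳ (s π) = cong s-nor (from-toᵇ π)
from-toʳ (ℓ π) = cong ℓ-nor (from-toʳ π)

toᵇ′ : ∀ {i} → Σ (Sk i) Neu → Neutral i
toᵇ′ (_ , π) = toᵇ π

toʳ′ : ∀ {i} → Σ (Sk i) Nor → Normal i
toʳ′ (_ , π) = toʳ π

to-fromᵇ : ∀ {i} (p : Neutral i) → toᵇ′ (fromᵇ p) ≡ p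
to-fromʳ : ∀ {i} (q : Normal i) → toʳ′ (fromʳ q) ≡ q
to-fromᵇ var = refl
to-fromᵇ (app {j} {k} p q) = trans (subst-natural toᵇ′ (ℕₚ.+-comm j k) (app-neu (fromᵇ p) (fromʳ q)))
  (trans (subst-loop (ℕₚ.+-comm k j) (ℕₚ.+-comm j k) (app (toᵇ′ (fromᵇ p)) (toʳ′ (fromʳ q))))
         (cong₂ app (to-fromᵇ p) (to-fromʳ q)))
to-fromʳ (ne p) = cong ne (to-fromᵇ p)
to-fromʳ (lam q) = cong lam (to-fromʳ q)

size-toᵇ : ∀ {i} {p : Sk i} (π : Neu p) → sizeᵇ (toᵇ π) ≡ sizeB π
size-toʳ : ∀ {i} {p : Sk i} (π : Nor p) → sizeʳ (toʳ π) ≡ sizeR π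
size-toᵇ v = refl
size-toᵇ (a {j} {k} π ρ) = trans (subst-constant sizeᵇ (ℕₚ.+-comm k j) (app (toᵇ π) (toʳ ρ)))
  (cong₂ _+_ (size-toᵇ π) (size-toʳ ρ))
size-toʳ (s π) = cong suc (size-toᵇ π)
size-toʳ (ℓ π) = size-toʳ π

#handles-toᵇ : ∀ {i} {p : Sk i} (π : Neu p) → #handlesᵇ (toᵇ π) ≡ length (onhB π)
#handles-toʳ : ∀ {i} {p : Sk i} (π : Nor p) → #handlesʳ (toʳ π) ≡ length (onhR π)
#handles-toᵇ v = refl
#handles-toᵇ (a {j} {zero} π ρ) = trans (subst-constant #handlesᵇ (ℕₚ.+-comm 0 j) (app (toᵇ π) (toʳ ρ)))
  (cong suc (trans (cong₂ _+_ (#handles-toʳ ρ) (#handles-toᵇ π)) (sym (length-++ (onhR ρ)))))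
#handles-toᵇ (a {j} {suc k} π ρ) = trans (subst-constant #handlesᵇ (ℕₚ.+-comm (suc k) j) (app (toᵇ π) (toʳ ρ)))
  (cong suc (#handles-toʳ ρ))
#handles-toʳ (s π) = #handles-toᵇ π
#handles-toʳ (ℓ π) = #handles-toʳ π

-- The bijection between terms and trees

TreeOf : ℕ → ℕ → Set
TreeOf n d = Σ Tree λ t → edges t ≡ n × deg t ≡ d

tree : ∀ {n d} → NormalTerm n d → TreeOf n d
tree {n} {d} (_ , π , size≡ , onh≡) with t , eq ← term-surjective (toʳ π) = t ,
  ℕₚ.suc-injective (trans (sym (size-term t)) (trans (cong sizeʳ eq) (trans (size-toʳ π) size≡))) ,
  ℕₚ.suc-injective (trans (sym (#handles-term t)) (trans (cong #handlesʳ eq) (trans (#handles-toʳ π) onh≡)))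

term-tree : ∀ {n d} (T : NormalTerm n d) → term (proj₁ (tree T)) ≡ toʳ (proj₁ (proj₂ T))
term-tree (_ , π , _) = proj₂ (term-surjective (toʳ π))

tree-injective : ∀ {n d} (T T′ : NormalTerm n d) → proj₁ (tree T) ≡ proj₁ (tree T′) → T ≡ T′
tree-injective T@(_ , π , _) T′@(_ , π′ , _) eq = same (trans (sym (from-toʳ π))
  (trans (cong fromʳ (trans (sym (term-tree T)) (trans (cong term eq) (term-tree T′)))) (from-toʳ π′)))
  where
  same : ∀ {n d p p′} {π : Nor p} {π′ : Nor p′}
           {e : sizeR π ≡ suc n × length (onhR π) ≡ suc d} {e′ : sizeR π′ ≡ suc n × length (onhR π′) ≡ suc d} →
         (p , π) ≡ (p′ , π′) → (p , π , e) ≡ (p′ , π′ , e′)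
  same {e = e₁ , e₂} {e₁′ , e₂′} refl =
    cong₂ (λ e₁ e₂ → _ , _ , e₁ , e₂) (ℕₚ.≡-irrelevant e₁ e₁′) (ℕₚ.≡-irrelevant e₂ e₂′)

tree-surjective : ∀ {n d} t → edges t ≡ n → deg t ≡ d → Σ (NormalTerm n d) λ T → proj₁ (tree T) ≡ t
tree-surjective {n} {d} t refl refl = T ,
  term-injective _ t (trans (term-tree T) (to-fromʳ (term t)))
  where
  π : Nor (proj₁ (fromʳ (term t)))
  π = proj₂ (fromʳ (term t))
  T : NormalTerm n d
  T = _ , π ,
    trans (sym (size-toʳ π)) (trans (cong sizeʳ (to-fromʳ (term t))) (size-term t)) ,
    trans (sym (#handles-toʳ π)) (trans (cong #handlesʳ (to-fromʳ (term t))) (#handles-term t))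

-- The counting functions on Fin

module _ {m : ℕ} {f : Fin m → Fin m} where

  iter≡iterate : ∀ n x → iter f n x ≡ iterate f n x
  iter≡iterate zero x = refl
  iter≡iterate (suc n) x = cong f (iter≡iterate n x)

count-index : ∀ m (P : Fin m → Bool) x → P x ≡ true → Fin (countFin m P)
count-index (suc m) P Fin.zero p with true ← P Fin.zero = Fin.zero
count-index (suc m) P (Fin.suc x) p = (if P Fin.zero then 1 else 0) Fin.↑ʳ count-index m (P ∘ Fin.suc) x p

count-index-injective : ∀ m (P : Fin m → Bool) x y p q → count-index m P x p ≡ count-index m P y q → x ≡ y
count-index-injective (suc m) P Fin.zero Fin.zero p q eq = refl
count-index-injective (suc m) P Fin.zero (Fin.suc y) p q eq with true ← P Fin.zero with () ← eq
count-index-injective (suc m) P (Fin.suc x) Fin.zero p q eq with true ← P Fin.zero with () ← eq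
count-index-injective (suc m) P (Fin.suc x) (Fin.suc y) p q eq = cong Fin.suc
  (count-index-injective m (P ∘ Fin.suc) x y p q (Finₚ.↑ʳ-injective (if P Fin.zero then 1 else 0) _ _ eq))

count-elem : ∀ m (P : Fin m → Bool) → Fin (countFin m P) → Fin m
count-elem (suc m) P i with P Fin.zero
count-elem (suc m) P Fin.zero | true = Fin.zero
count-elem (suc m) P (Fin.suc i) | true = Fin.suc (count-elem m (P ∘ Fin.suc) i)
count-elem (suc m) P i | false = Fin.suc (count-elem m (P ∘ Fin.suc) i)

count-elem-holds : ∀ m (P : Fin m → Bool) i → P (count-elem m P i) ≡ true
count-elem-holds (suc m) P i with P Fin.zero in eq
count-elem-holds (suc m) P Fin.zero | true = eq
count-elem-holds (suc m) P (Fin.suc i) | true = count-elem-holds m (P ∘ Fin.suc) i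
count-elem-holds (suc m) P i | false = count-elem-holds m (P ∘ Fin.suc) i

count-elem-injective : ∀ m (P : Fin m → Bool) i j → count-elem m P i ≡ count-elem m P j → i ≡ j
count-elem-injective (suc m) P i j eq with P Fin.zero
count-elem-injective (suc m) P Fin.zero Fin.zero eq | true = refl
count-elem-injective (suc m) P (Fin.suc i) (Fin.suc j) eq | true =
  cong Fin.suc (count-elem-injective m (P ∘ Fin.suc) i j (Finₚ.suc-injective eq))
count-elem-injective (suc m) P i j eq | false = count-elem-injective m (P ∘ Fin.suc) i j (Finₚ.suc-injective eq)

count-unique : ∀ {m k} (P : Fin m → Bool) (enum : Fin k → Fin m) → Injective _≡_ _≡_ enum →
               (∀ l → P (enum l) ≡ true) → (∀ x → P x ≡ true → ∃ λ l → enum l ≡ x) → countFin m P ≡ k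
count-unique {m} {k} P enum inj holds onto = ℕₚ.≤-antisym
  (Finₚ.injective⇒≤ {f = pre} λ {i} {j} eq → count-elem-injective m P i j
    (trans (sym (proj₂ (onto _ (count-elem-holds m P i)))) (trans (cong enum eq) (proj₂ (onto _ (count-elem-holds m P j))))))
  (Finₚ.injective⇒≤ {f = λ l → count-index m P (enum l) (holds l)} λ {i} {j} eq →
    inj (count-index-injective m P (enum i) (enum j) (holds i) (holds j) eq))
  where
  pre : Fin (countFin m P) → Fin k
  pre i = proj₁ (onto _ (count-elem-holds m P i))

allBelow⇒ : ∀ n (P : ℕ → Bool) → allBelow n P ≡ true → ∀ {k} → k < n → P k ≡ true
allBelow⇒ (suc n) P all {k} (s≤s k≤n) with P n in eq | k ℕ.≟ n
... | true | yes refl = eq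
... | true | no k≢n = allBelow⇒ n P all (ℕₚ.≤∧≢⇒< k≤n k≢n)

⇒allBelow : ∀ n (P : ℕ → Bool) → (∀ {k} → k < n → P k ≡ true) → allBelow n P ≡ true
⇒allBelow zero P all = refl
⇒allBelow (suc n) P all rewrite all (ℕₚ.n<1+n n) = ⇒allBelow n P (all ∘ ℕₚ.m<n⇒m<1+n)

anyBelow⇒ : ∀ n (P : ℕ → Bool) → anyBelow n P ≡ true → ∃ λ k → P k ≡ true
anyBelow⇒ (suc n) P any with P n in eq
... | true = n , eq
... | false = anyBelow⇒ n P any

⇒anyBelow : ∀ n (P : ℕ → Bool) {k} → k < n → P k ≡ true → anyBelow n P ≡ true
⇒anyBelow (suc n) P {k} (s≤s k≤n) p with P n in eq | k ℕ.≟ n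
... | true | _ = refl
... | false | yes refl with () ← trans (sym p) eq
... | false | no k≢n = ⇒anyBelow n P (ℕₚ.≤∧≢⇒< k≤n k≢n) p

module _ {D : Set} (F : Finite D) {f : D → D} (inj : Injective _≡_ _≡_ f) where
  open Orbits F

  period-exists : ∀ x → ∃ (Period f x)
  period-exists x with n , eq ← finite-order F inj x
    with m , eq′ , below ← least (λ n → iterate f (suc n) x ≟ x) n eq =
    m , subst (Walk f (_≢ x) (f x) m) (trans (iterate-comm f m x) eq′)
      (walk-build m (f x) λ j j<m → below j j<m ∘ trans (sym (iterate-comm f j x)))

  period≤size : ∀ {x n} → Period f x n → suc n ≤ size
  period≤size {x} {n} period = Finₚ.injective⇒≤ {f = λ i → to (iterate f (suc (toℕ i)) x)} λ {i} {j} eq →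
    Finₚ.toℕ-injective (period-distinct inj period (Finₚ.toℕ≤pred[n] i) (Finₚ.toℕ≤pred[n] j) (to-injective eq))

  orb-period : ∀ {x y n} → Period f x n → Orb f x y → ∃ λ (i : Fin (suc n)) → iterate f (suc (toℕ i)) x ≡ y
  orb-period period xy with m , eq ← orb⇒iterate inj xy
    with i , eq′ ← period-covers inj period m = i , trans eq′ eq

  -- `cycles` and `orbitSize` inspect only as many iterates as there are darts. The full period
  -- would overshoot this bound, so the return to `x` is given exponent `0`.
  orb-bounded : ∀ {x y} → Orb f x y → ∃ λ k → k < size × iterate f k x ≡ y
  orb-bounded {x} xy with n , period ← period-exists x
    with i , eq ← orb-period period xy with toℕ i ℕ.≟ n
  ... | yes i≡n = 0 , ℕₚ.≤-trans (s≤s z≤n) (period≤size period) ,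
    trans (sym (period-end inj period)) (trans (cong (λ j → iterate f (suc j) x) (sym i≡n)) eq)
  ... | no i≢n = suc (toℕ i) , ℕₚ.≤-trans (s≤s (ℕₚ.≤∧≢⇒< (Finₚ.toℕ≤pred[n] i) i≢n)) (period≤size period) , eq

≤ᵇ⇒ : ∀ {m n} → (m ℕ.≤ᵇ n) ≡ true → m ≤ n
≤ᵇ⇒ {m} {n} eq = ℕₚ.≤ᵇ⇒≤ m n (subst Bool.T (sym eq) tt)

⇒≤ᵇ : ∀ {m n} → m ≤ n → (m ℕ.≤ᵇ n) ≡ true
⇒≤ᵇ {m} {n} m≤n with m ℕ.≤ᵇ n | ℕₚ.≤⇒≤ᵇ m≤n
... | true | _ = refl

module _ {m : ℕ} {f : Fin m → Fin m} (inj : Injective _≡_ _≡_ f) where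
  open Orbits (Fin-finite m)

  private
    isLeast : Fin m → Bool
    isLeast i = allBelow m λ k → toℕ i ℕ.≤ᵇ toℕ (iter f k i)

    isLeast⇒ : ∀ {i j} → isLeast i ≡ true → Orb f i j → toℕ i ≤ toℕ j
    isLeast⇒ {i} eq ij with k , k<m , refl ← orb-bounded (Fin-finite m) inj ij =
      subst (λ x → toℕ i ≤ toℕ x) (iter≡iterate k i) (≤ᵇ⇒ (allBelow⇒ m _ eq k<m))

    ⇒isLeast : ∀ {i} → (∀ {j} → Orb f i j → toℕ i ≤ toℕ j) → isLeast i ≡ true
    ⇒isLeast {i} least = ⇒allBelow m _ λ {k} _ →
      ⇒≤ᵇ (least (subst (Orb f i) (sym (iter≡iterate k i)) (orb-iterate f k i)))

    leastInOrbit : ∀ i → ∃ λ j → Orb f i j × isLeast j ≡ true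
    leastInOrbit i with least (λ n → Finₚ.any? λ j → (toℕ j ℕ.≟ n) ×-dec orb? f i j) (toℕ i) (i , refl , ε)
    ... | _ , (j , refl , ij) , below = j , ij , ⇒isLeast λ {k} jk →
      ℕₚ.≮⇒≥ λ k<j → below (toℕ k) k<j (k , refl , EqC.transitive _ ij jk)

  cycles≡orbits : cycles f ≡ orbits f
  cycles≡orbits = count-unique isLeast (λ l → proj₁ (leastInOrbit (P.rep l)))
    (λ {l} {l′} eq → trans (sym (P.class-rep l)) (trans (P.complete (EqC.transitive _ (proj₁ (proj₂ (leastInOrbit (P.rep l))))
      (subst (λ x → Orb f x (P.rep l′)) (sym eq) (EqC.symmetric _ (proj₁ (proj₂ (leastInOrbit (P.rep l′)))))))) (P.class-rep l′)))
    (λ l → proj₂ (proj₂ (leastInOrbit (P.rep l))))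
    (λ x px → P.class x , onto x px (leastInOrbit (P.rep (P.class x))) (P.sound (P.class-rep (P.class x))))
    where
    module P = Classes (proj₂ (orb-classes f))
    onto : ∀ x → isLeast x ≡ true → ∀ {y} (l : ∃ λ j → Orb f y j × isLeast j ≡ true) → Orb f y x → proj₁ l ≡ x
    onto x px (j , yj , pj) yx = Finₚ.toℕ-injective (ℕₚ.≤-antisym
      (isLeast⇒ pj (EqC.transitive _ (EqC.symmetric _ yj) yx))
      (isLeast⇒ px (EqC.transitive _ (EqC.symmetric _ yx) yj)))

  orbitSize≡period : ∀ {r n} → Period f r n → orbitSize f r ≡ suc n
  orbitSize≡period {r} {n} period = count-unique _ (λ i → iterate f (suc (toℕ i)) r)
    (λ {i} {j} eq → Finₚ.toℕ-injective (period-distinct inj period (Finₚ.toℕ≤pred[n] i) (Finₚ.toℕ≤pred[n] j) eq))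
    (λ l → hit (orb-iterate f (suc (toℕ l)) r))
    (λ x px → orb-period (Fin-finite m) inj period (reached x px))
    where
    hit : ∀ {x} → Orb f r x → anyBelow m (λ k → ⌊ iter f k r Fin.≟ x ⌋) ≡ true
    hit {x} rx with k , k<m , eq ← orb-bounded (Fin-finite m) inj rx =
      ⇒anyBelow m _ k<m (yes-true (iter f k r Fin.≟ x) (trans (iter≡iterate k r) eq))
      where
      yes-true : ∀ {A : Set} (d : Dec A) → A → ⌊ d ⌋ ≡ true
      yes-true (yes _) _ = refl
      yes-true (no ¬x) x = ⊥-elim (¬x x)
    reached : ∀ x → anyBelow m (λ k → ⌊ iter f k r Fin.≟ x ⌋) ≡ true → Orb f r x
    reached x px with k , eq ← anyBelow⇒ m _ px =
      subst (Orb f r) (trans (sym (iter≡iterate k r)) (toWitness (subst Bool.T (sym eq) tt))) (orb-iterate f k r)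

-- Rooted planar maps on Fin

-- Every cycle of `α` consists of two darts: one half of `Fin (k + k)` lists the representatives,
-- the other half their partners.
alive-size : ∀ {D : Set} (F : Finite D) (X : Map D) → (∀ x → α X x ≢ x) →
             Finite.size F ≡ Euler.#A F X + Euler.#A F X
alive-size {D} F X alive = ℕₚ.≤-antisym
  (Finₚ.injective⇒≤ {f = side ∘ from} λ {i} {j} eq →
    trans (sym (to-from i)) (trans (cong to (side-injective (from i) (from j) eq)) (to-from j)))
  (Finₚ.injective⇒≤ {f = to ∘ pick ∘ Fin.splitAt k} λ {i} {j} eq →
    trans (sym (Finₚ.join-splitAt k k i)) (trans (cong (Fin.join k k) (pick-injective (Fin.splitAt k i) (Fin.splitAt k j) (to-injective eq))) (Finₚ.join-splitAt k k j)))
  where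
  open Euler F
  module P = Classes (proj₂ (orb-classes (α X)))
  k : ℕ
  k = #A X
  α-orb : ∀ {x y} → Orb (α X) x y → y ≡ x ⊎ y ≡ α X x
  α-orb {x} r = orb-invariant (α X) (λ y → y ≡ x ⊎ y ≡ α X x)
    (λ { _ (inj₁ refl) → inj₂ refl ; _ (inj₂ refl) → inj₁ (α-involutive X x) })
    (λ { y (inj₁ eq) → inj₂ (trans (sym (α-involutive X y)) (cong (α X) eq)) ; y (inj₂ eq) → inj₁ (α-injective X eq) })
    r (inj₁ refl)
  α-class : ∀ x → P.class (α X x) ≡ P.class x
  α-class x = sym (P.complete (fwd refl ◅ ε))
  side : D → Fin (k + k)
  side x with x ≟ P.rep (P.class x)
  ... | yes _ = Fin.join k k (inj₁ (P.class x))
  ... | no _ = Fin.join k k (inj₂ (P.class x))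
  join-injective : ∀ {i j : Fin k ⊎ Fin k} → Fin.join k k i ≡ Fin.join k k j → i ≡ j
  join-injective {i} {j} eq = trans (sym (Finₚ.splitAt-join k k i)) (trans (cong (Fin.splitAt k) eq) (Finₚ.splitAt-join k k j))
  other-side : ∀ x → x ≢ P.rep (P.class x) → x ≡ α X (P.rep (P.class x))
  other-side x ≢rep with α-orb (P.sound (P.class-rep (P.class x)))
  ... | inj₁ eq = ⊥-elim (≢rep eq)
  ... | inj₂ eq = eq
  side-injective : ∀ x y → side x ≡ side y → x ≡ y
  side-injective x y eq with x ≟ P.rep (P.class x) | y ≟ P.rep (P.class y)
  ... | yes x≡ | yes y≡ = trans x≡ (trans (cong P.rep (inj₁-injective (join-injective eq))) (sym y≡))
  ... | no x≢ | no y≢ = trans (other-side x x≢)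
    (trans (cong (α X ∘ P.rep) (inj₂-injective (join-injective eq))) (sym (other-side y y≢)))
  ... | yes _ | no _ with () ← join-injective {inj₁ _} {inj₂ _} eq
  ... | no _ | yes _ with () ← join-injective {inj₂ _} {inj₁ _} eq
  pick : Fin k ⊎ Fin k → D
  pick (inj₁ l) = P.rep l
  pick (inj₂ l) = α X (P.rep l)
  pick-class : ∀ i → P.class (pick i) ≡ Sum.[ id , id ] i
  pick-class (inj₁ l) = P.class-rep l
  pick-class (inj₂ l) = trans (α-class (P.rep l)) (P.class-rep l)
  pick-injective : ∀ i j → pick i ≡ pick j → i ≡ j
  pick-injective i j eq with trans (sym (pick-class i)) (trans (cong P.class eq) (pick-class j))
  pick-injective (inj₁ _) (inj₁ _) eq | refl = refl
  pick-injective (inj₂ _) (inj₂ _) eq | refl = refl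
  pick-injective (inj₁ l) (inj₂ _) eq | refl = ⊥-elim (alive _ (sym eq))
  pick-injective (inj₂ l) (inj₁ _) eq | refl = ⊥-elim (alive _ eq)

connected-#C : ∀ {D : Set} (F : Finite D) (X : Map D) → D → (∀ x y → Comp X x y) → Euler.#C F X ≡ 1
connected-#C F X x₀ connected = classes-unique {R = Comp X} {Comp X} (proj₂ (Euler.comp-classes F X)) one id id id id
  where
  one : Classes (Comp X) 1
  one = record { class = λ _ → Fin.zero ; rep = λ _ → x₀ ; class-rep = λ { Fin.zero → refl }
               ; sound = λ _ → connected _ _ ; complete = λ _ → refl }

injective⇒perm : ∀ {m} (f : Fin m → Fin m) → Injective _≡_ _≡_ f → Permutation′ m
injective⇒perm {m} f inj = mk↔ₛ′ f (proj₁ ∘ pre) (proj₂ ∘ pre) (λ x → inj (proj₂ (pre (f x))))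
  where
  pre : ∀ y → ∃ λ x → f x ≡ y
  pre = injective⇒surjective (Fin-finite m) inj

perm-injective : ∀ {m} (π : Permutation′ m) → Injective _≡_ _≡_ (π ⟨$⟩ʳ_)
perm-injective π {x} {y} eq = trans (sym (Inverse.strictlyInverseʳ π x))
  (trans (cong (Inverse.from π) eq) (Inverse.strictlyInverseʳ π y))

module _ {e : ℕ} (X : Map (Fin (2 * suc e))) (alive : ∀ x → α X x ≢ x) (connected : ∀ x y → Comp X x y) where
  open Euler (Fin-finite (2 * suc e))

  private
    #A≡ : #A X ≡ suc e
    #A≡ = ℕₚ.*-cancelˡ-≡ (#A X) (suc e) 2
      (trans (cong (#A X +_) (ℕₚ.+-identityʳ (#A X))) (sym (alive-size (Fin-finite (2 * suc e)) X alive)))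

    #C≡ : #C X ≡ 1
    #C≡ = connected-#C (Fin-finite (2 * suc e)) X Fin.zero connected

    -- With `size = 2E`, `#A = E` and one component, the planarity equation loses `E` on both sides
    -- and becomes `V + F = E + 2`.
    sizes : 2 * suc e + #C X + #C X ≡ (suc e + 2) + #A X
    sizes = trans (cong (λ c → 2 * suc e + c + c) #C≡) (trans
      (solve 1 (λ n → (n :+ (n :+ con 0)) :+ con 1 :+ con 1 := (n :+ con 2) :+ n) refl (suc e))
      (cong (suc e + 2 +_) (sym #A≡)))
      where open +-*-Solver

  planar⇒formula : Planar X → #V X + #F X ≡ suc e + 2
  planar⇒formula pl = ℕₚ.+-cancelʳ-≡ (#A X) _ _ (trans pl sizes)

  formula⇒planar : #V X + #F X ≡ suc e + 2 → Planar X
  formula⇒planar eq = trans (cong (_+ #A X) eq) (sym sizes)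

module _ {m : ℕ} (X : Map (Fin m)) where

  -- `Reach` has only forward steps; the finite order of `σ` and the involution `α` supply the
  -- backward ones.
  comp⇒reach : ∀ {x y} → Comp X x y → Reach (σ X) (α X) x y
  comp⇒reach = EqC.fold (record { refl = here ; sym = reach-sym ; trans = reach-trans }) λ
      { {x} (inj₁ refl) → stepα (stepσ (subst (λ z → Reach (σ X) (α X) (φ X z) _) (sym (α-involutive X x)) here))
      ; (inj₂ refl) → stepα here }
    where
    reach-trans : ∀ {x y z} → Reach (σ X) (α X) x y → Reach (σ X) (α X) y z → Reach (σ X) (α X) x z
    reach-trans here r = r
    reach-trans (stepσ q) r = stepσ (reach-trans q r)
    reach-trans (stepα q) r = stepα (reach-trans q r)
    reach-iterate : ∀ n x → Reach (σ X) (α X) x (iterate (σ X) n x)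
    reach-iterate zero x = here
    reach-iterate (suc n) x = reach-trans (reach-iterate n x) (stepσ here)
    reach-sym : ∀ {x y} → Reach (σ X) (α X) x y → Reach (σ X) (α X) y x
    reach-sym here = here
    reach-sym (stepα {i} q) = reach-trans (reach-sym q) (stepα (subst (λ z → Reach (σ X) (α X) z i) (sym (α-involutive X i)) here))
    reach-sym (stepσ {i} q) with n , eq ← finite-order (Fin-finite m) (σ-injective X) i =
      reach-trans (reach-sym q) (subst (Reach (σ X) (α X) (σ X i)) (trans (iterate-comm (σ X) n i) eq) (reach-iterate n (σ X i)))

map : ∀ {e} → PlanarMap e → Map (Fin (2 * e))
map M = record
  { φ = PlanarMap.φ M
  ; α = PlanarMap.α M ⟨$⟩ʳ_
  ; φ-injective = perm-injective (PlanarMap.α M) ∘ perm-injective (PlanarMap.σ M)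
  ; α-involutive = PlanarMap.α-invol M }

module _ {e : ℕ} (M : PlanarMap e) where

  map-σ : ∀ x → σ (map M) x ≡ PlanarMap.σ M ⟨$⟩ʳ x
  map-σ x = cong (PlanarMap.σ M ⟨$⟩ʳ_) (PlanarMap.α-invol M x)

  map-connected : ∀ x y → Comp (map M) x y
  map-connected x y = go (PlanarMap.connected M x y)
    where
    go : ∀ {x y} → Reach (PlanarMap.σ M ⟨$⟩ʳ_) (PlanarMap.α M ⟨$⟩ʳ_) x y → Comp (map M) x y
    go here = ε
    go (stepσ {i} r) = fwd (inj₂ refl) ◅ fwd (inj₁ (map-σ i)) ◅ go r
    go (stepα r) = fwd (inj₂ refl) ◅ go r

map-planar : ∀ {e} (M : PlanarMap (suc e)) → Euler.Planar (Fin-finite (2 * suc e)) (map M)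
map-planar {e} M = formula⇒planar (map M) (PlanarMap.α-fpf M) (map-connected M) (trans (cong₂ _+_
  (trans (orbits-cong (map-σ M)) (sym (cycles≡orbits (perm-injective (PlanarMap.σ M)))))
  (sym (cycles≡orbits (φ-injective (map M)))))
  (PlanarMap.planar M))
  where open Euler (Fin-finite (2 * suc e))

planarMap : ∀ {e} (X : Map (Fin (2 * suc e))) → (∀ x → α X x ≢ x) → (∀ x y → Comp X x y) →
            Euler.Planar (Fin-finite (2 * suc e)) X → PlanarMap (suc e)
planarMap {e} X alive connected pl = record
  { σ = injective⇒perm (σ X) (σ-injective X)
  ; α = injective⇒perm (α X) (α-injective X)
  ; α-invol = α-involutive X
  ; α-fpf = alive
  ; connected = λ x y → comp⇒reach X (connected x y)
  ; planar = trans (cong₂ _+_ (cycles≡orbits (σ-injective X))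
      (trans (cycles≡orbits (α-injective X ∘ σ-injective X)) (orbits-cong (cong (φ X) ∘ α-involutive X))))
      (planar⇒formula X alive connected pl) }
  where open Euler (Fin-finite (2 * suc e))

map-planarMap : ∀ {e} (X : Map (Fin (2 * suc e))) alive connected pl → X ≋ map (planarMap X alive connected pl)
map-planarMap X _ _ _ = (λ x → cong (φ X) (sym (α-involutive X x))) , λ _ → refl

-- Passage between trees and rooted planar maps

core-size : ∀ t → Finite.size (core-finite t) ≡ 2 * edges t
core-size vertex = refl
core-size (isthmus t u) = trans (cong₂ (λ m n → suc m + suc n) (core-size t) (core-size u))
  (solve 2 (λ m n → con 1 :+ con 2 :* m :+ (con 1 :+ con 2 :* n) := con 2 :* (con 1 :+ (m :+ n))) refl (edges t) (edges u))
  where open +-*-Solver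
core-size (chord t i) = trans (cong (2 +_) (core-size t))
  (solve 1 (λ m → con 2 :+ con 2 :* m := con 2 :* (con 1 :+ m)) refl (edges t))
  where open +-*-Solver

composite : ∀ t {e} → edges t ≡ suc e → Composite t
composite (isthmus t u) _ = isthmus
composite (chord t i) _ = chord

comp-core : ∀ {t} → Composite t → ∀ x y → Comp (core t) x y
comp-core {t} c x y = comp-⊕⇒ point (core t) {inj₂ x} {inj₂ y}
  (EqC.transitive _ (EqC.symmetric _ (core-connected t x)) (core-connected t y))

module Pointing {m} (X : Map (Fin m)) (r : Fin m) where

  F : Finite (⊤ ⊎ Fin m)
  F = ⊎-finite ⊤-finite (Fin-finite m)

  open Euler F

  X∗ : Map (⊤ ⊎ Fin m)
  X∗ = attach (point ⊕ X) ∗ (inj₂ r)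

  hom-pointed : ∀ t (c : Composite t) (k : Hom (core t) X) → fun k (newEdge c) ≡ r → Hom (pointed t) X∗
  hom-pointed t c k k-root = hom-attach k⁺ (dart-finite t) F refl
    (trans (cong (fun k⁺) (entry-newEdge c)) (cong inj₂ k-root))
    where
    k⁺ : Hom (point ⊕ core t) (point ⊕ X)
    k⁺ = hom-copair {X = point} {core t} {Z = point ⊕ X} (hom-inj₁ {X = point} {X})
      (hom-∘ (hom-inj₂ {X = point} {X}) k) λ _ _ ()

  φ-∗ : φ X∗ ∗ ≡ inj₂ r
  φ-∗ = swap-left ∗ (inj₂ r)

  module _ (t : Tree) (h : Hom (pointed t) X∗) (h∗ : fun h ∗ ≡ ∗) where

    -- Both numbers measure the first return to `∗` in `X∗`: `orbitSize` because `∗` is inserted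
    -- into the face of `r`, `deg t` because the embedding carries over the outer face of
    -- `pointed t`.
    outer-degree : orbitSize (φ X) r ≡ deg t
    outer-degree with n , period ← period-exists (Fin-finite m) (φ-injective X) r =
      trans (orbitSize≡period (φ-injective X) period) (walk-unique (lift period) image)
      where
      g : Fin m → ⊤ ⊎ Fin m
      g y = swap ∗ (inj₂ r) (inj₂ y)
      g-other : ∀ y → y ≢ r → g y ≡ inj₂ y
      g-other y y≢r = swap-other (λ ()) (y≢r ∘ inj₂-injective)
      lift : ∀ {n} → Period (φ X) r n → Period (φ X∗) ∗ (suc n)
      lift {n} period = subst (λ x → Walk (φ X∗) (_≢ ∗) x (suc n) ∗) (sym φ-∗) ((λ ()) ∷
        subst (Walk (φ X∗) (_≢ ∗) (g (φ X r)) n) (swap-right ∗ (inj₂ r))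
          (walk-map g (λ y y≢r → cong (φ X∗) (sym (g-other y y≢r)))
            (λ y y≢r eq → case-inj (trans (sym (g-other y y≢r)) eq)) period))
        where
        case-inj : ∀ {y} → inj₂ y ≢ ∗
        case-inj ()
      image : Period (φ X∗) ∗ (deg t)
      image = subst (λ z → Walk (φ X∗) (_≢ z) (φ X∗ z) (deg t) z) h∗
        (subst (λ z → Walk (φ X∗) (_≢ fun h ∗) z (deg t) (fun h ∗)) (φ-hom h ∗)
          (walk-map (fun h) (λ x _ → φ-hom h x) (λ x x≢∗ → x≢∗ ∘ injective h) (outer-period t)))

    not-vertex : t ≢ vertex
    not-vertex refl with () ← trans (sym φ-∗) (trans (cong (φ X∗) (sym h∗))
      (trans (sym (φ-hom h ∗)) (trans (cong (fun h) (pointed-root vertex)) h∗)))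

    private
      strip : (y : ⊤ ⊎ Fin m) → y ≢ ∗ → ∃ λ z → inj₂ z ≡ y
      strip ∗ y≢∗ = ⊥-elim (y≢∗ refl)
      strip (inj₂ z) _ = z , refl

      lower : ∀ x → ∃ λ z → inj₂ z ≡ fun h (inj₂ x)
      lower x = strip (fun h (inj₂ x)) λ eq → not-∗ (injective h (trans eq (sym h∗)))
        where
        not-∗ : inj₂ x ≢ ∗
        not-∗ ()

      h₁ : Hom (point ⊕ core t) (point ⊕ X)
      h₁ = hom-target (hom-source
        (hom-attach h (dart-finite t) F h∗ (trans (cong (fun h) (sym (pointed-root t)))
          (trans (φ-hom h ∗) (trans (cong (φ X∗) h∗) φ-∗))))
        (Euler.attach-attach (dart-finite t) (point ⊕ core t) ∗ (entry t)))
        (attach-attach (point ⊕ X) ∗ (inj₂ r))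

    hom-core : Hom (core t) X
    hom-core = record
      { fun = proj₁ ∘ lower
      ; injective = λ {x} {y} eq → inj₂-injective (injective h
          (trans (sym (proj₂ (lower x))) (trans (cong inj₂ eq) (proj₂ (lower y)))))
      ; φ-hom = λ x → inj₂-injective (trans (proj₂ (lower (φ (core t) x)))
          (trans (φ-hom h₁ (inj₂ x)) (cong (φ (point ⊕ X)) (sym (proj₂ (lower x))))))
      ; α-hom = λ x → inj₂-injective (trans (proj₂ (lower (α (core t) x)))
          (trans (α-hom h₁ (inj₂ x)) (cong (α (point ⊕ X)) (sym (proj₂ (lower x)))))) }

    hom-core-root : (c : Composite t) → fun hom-core (newEdge c) ≡ r
    hom-core-root c = inj₂-injective (trans (proj₂ (lower (newEdge c))) (trans (cong (fun h) (sym (entry-newEdge c)))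
      (trans (cong (fun h) (sym (pointed-root t))) (trans (φ-hom h ∗) (trans (cong (φ X∗) h∗) φ-∗)))))

  module _ (connected : ∀ x y → Comp X x y) where

    -- The image is closed under `φ` and `α`, and under the inverse of `φ` because the core is
    -- finite. By connectedness it is everything.
    hom-surjective : ∀ {t} → Composite t → (k : Hom (core t) X) → ∀ y → ∃ λ x → fun k x ≡ y
    hom-surjective {t} c k y = comp-invariant X (λ y → ∃ λ x → fun k x ≡ y)
      (λ { _ (x , refl) → φ (core t) x , φ-hom k x })
      (λ z (x , eq) → let (x′ , eq′) = injective⇒surjective (core-finite t) (φ-injective (core t)) x in
        x′ , φ-injective X (trans (sym (φ-hom k x′)) (trans (cong (fun k) eq′) eq)))
      (λ { _ (x , refl) → α (core t) x , α-hom k x })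
      (connected (fun k (newEdge c)) y) (newEdge c , refl)

    hom-size : ∀ {t} → Composite t → Hom (core t) X → 2 * edges t ≡ m
    hom-size {t} c k = trans (sym (core-size t)) (ℕₚ.≤-antisym
      (Finₚ.injective⇒≤ {f = fun k ∘ K.from} λ {i} {j} eq →
        trans (sym (K.to-from i)) (trans (cong K.to (injective k eq)) (K.to-from j)))
      (Finₚ.injective⇒≤ {f = K.to ∘ proj₁ ∘ hom-surjective c k} λ {i} {j} eq →
        trans (sym (proj₂ (hom-surjective c k i))) (trans (cong (fun k) (K.to-injective eq)) (proj₂ (hom-surjective c k j)))))
      where module K = Finite (core-finite t)

    extract-core : (∀ x → α X x ≢ x) → Euler.Planar (Fin-finite m) X →
                   ∃ λ t → Σ (Hom (pointed t) X∗) λ h → fun h ∗ ≡ ∗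
    extract-core alive pl = Extraction.extract F X∗ ∗ record
      { planar = AttachPlanarity.planar-attach (point ⊕ X) {∗} {inj₂ r} (λ ()) refl refl
          (planar-⊕ ⊤-finite (Fin-finite m) point X point-planar pl)
      ; dead = refl
      ; sole = λ { {∗} _ _ → refl ; {inj₂ x} _ eq → ⊥-elim (alive x (inj₂-injective eq)) } }

planar-transport : ∀ {D E : Set} (F : Finite D) (G : Finite E) {X : Map D} {Y : Map E} (h : Hom X Y) (g : Hom Y X) →
                   (∀ x → fun g (fun h x) ≡ x) → (∀ y → fun h (fun g y) ≡ y) → Finite.size F ≡ Finite.size G →
                   Euler.Planar F X → Euler.Planar G Y
planar-transport F G {X} {Y} h g gh hg size≡ pl = trans (sym χ≡) (trans pl
  (trans (cong (λ n → n + F.#C X + F.#C X) size≡) (cong (λ c → Finite.size G + c + c) #C≡)))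
  where
  module F = Euler F
  module G = Euler G
  orbits≡ : ∀ f f′ → (∀ x → fun h (f x) ≡ f′ (fun h x)) → (∀ y → fun g (f′ y) ≡ f (fun g y)) → F.orbits f ≡ G.orbits f′
  orbits≡ f f′ hf gf = classes-unique (proj₂ (F.orb-classes f)) (proj₂ (G.orb-classes f′))
    (fun h) (λ {x} {y} r → subst₂ (Orb f) (gh x) (gh y) (EqC.gmap (fun g) (λ {z} eq → trans (sym (gf z)) (cong (fun g) eq)) r))
    (fun g) (λ {x} {y} r → subst₂ (Orb f′) (hg x) (hg y) (EqC.gmap (fun h) (λ {z} eq → trans (sym (hf z)) (cong (fun h) eq)) r))
  χ≡ : F.χ X ≡ G.χ Y
  χ≡ = cong₂ _+_ (cong₂ _+_
      (orbits≡ (σ X) (σ Y) (λ x → trans (φ-hom h _) (cong (φ Y) (α-hom h x))) (λ y → trans (φ-hom g _) (cong (φ X) (α-hom g y))))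
      (orbits≡ (φ X) (φ Y) (φ-hom h) (φ-hom g)))
    (orbits≡ (α X) (α Y) (α-hom h) (α-hom g))
  #C≡ : F.#C X ≡ G.#C Y
  #C≡ = classes-unique (proj₂ (F.comp-classes X)) (proj₂ (G.comp-classes Y))
    (fun h) (λ {x} {y} r → subst₂ (Comp X) (gh x) (gh y) (hom-comp g r))
    (fun g) (λ {x} {y} r → subst₂ (Comp Y) (hg x) (hg y) (hom-comp h r))

-- Here `m` is still a variable, so the size equation can be matched by `refl`.
resize : ∀ {D : Set} (F : Finite D) {m} → Finite.size F ≡ m → D ↔ Fin m
resize F refl = Finite.enum F

module Realise {t : Tree} {e : ℕ} (edges≡ : edges t ≡ suc e) where

  c : Composite t
  c = composite t edges≡

  size≡ : Finite.size (core-finite t) ≡ 2 * suc e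
  size≡ = trans (core-size t) (cong (2 *_) edges≡)

  open Inverse (resize (core-finite t) size≡) public using (to; from)
    renaming (strictlyInverseʳ to from-to; strictlyInverseˡ to to-from)

  to-injective : Injective _≡_ _≡_ to
  to-injective {x} {y} eq = trans (sym (from-to x)) (trans (cong from eq) (from-to y))

  from-injective : Injective _≡_ _≡_ from
  from-injective {x} {y} eq = trans (sym (to-from x)) (trans (cong to eq) (to-from y))

  X : Map (Fin (2 * suc e))
  X = record
    { φ = to ∘ φ (core t) ∘ from
    ; α = to ∘ α (core t) ∘ from
    ; φ-injective = from-injective ∘ φ-injective (core t) ∘ to-injective
    ; α-involutive = λ x → trans (cong (to ∘ α (core t)) (from-to _)) (trans (cong to (α-involutive (core t) _)) (to-from x)) }

  to-hom : Hom (core t) X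
  to-hom = record
    { fun = to ; injective = to-injective
    ; φ-hom = λ x → cong (to ∘ φ (core t)) (sym (from-to x))
    ; α-hom = λ x → cong (to ∘ α (core t)) (sym (from-to x)) }

  from-hom : Hom X (core t)
  from-hom = record
    { fun = from ; injective = from-injective
    ; φ-hom = λ x → from-to _
    ; α-hom = λ x → from-to _ }

  alive : ∀ x → α X x ≢ x
  alive x eq = core-alive t (from x) (trans (sym (from-to _)) (cong from eq))

  connected : ∀ x y → Comp X x y
  connected x y = subst₂ (Comp X) (to-from x) (to-from y) (hom-comp to-hom (comp-core c (from x) (from y)))

  pl : Euler.Planar (Fin-finite (2 * suc e)) X
  pl = planar-transport (core-finite t) (Fin-finite (2 * suc e)) to-hom from-hom from-to to-from size≡ (core-planar t)

  planar-map : PlanarMap (suc e)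
  planar-map = planarMap X alive connected pl

  root : Fin (2 * suc e)
  root = to (newEdge c)

  hom : Hom (core t) (map planar-map)
  hom = hom-target {Y = X} to-hom {map planar-map} (map-planarMap X alive connected pl)

realise : ∀ n t → edges t ≡ n → RootedPlanarMap n
realise zero t _ = tt
realise (suc e) t eq = Realise.planar-map eq , Realise.root eq

outerDegree-realise : ∀ n t eq → outerDegree n (realise n t eq) ≡ deg t
outerDegree-realise zero vertex eq = refl
outerDegree-realise (suc e) t eq = Pt.outer-degree t (Pt.hom-pointed t c hom refl) refl
  where
  open Realise {t} eq
  module Pt = Pointing (map planar-map) root

module _ {e : ℕ} {t : Tree} (c : Composite t) (size≡ : Finite.size (core-finite t) ≡ 2 * suc e)
         (M M′ : PlanarMap (suc e)) (k : Hom (core t) (map M)) (k′ : Hom (core t) (map M′)) where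

  private
    open Inverse (resize (core-finite t) size≡) using (to; from)
      renaming (strictlyInverseʳ to from-to; strictlyInverseˡ to to-from)

    perm : (f : Core t → Fin (2 * suc e)) → Injective _≡_ _≡_ f → Permutation′ (2 * suc e)
    perm f inj = injective⇒perm (f ∘ from) λ {x} {y} eq →
      trans (sym (to-from x)) (trans (cong to (inj eq)) (to-from y))

    π π′ : Permutation′ (2 * suc e)
    π = perm (fun k) (injective k)
    π′ = perm (fun k′) (injective k′)

    -- Both embeddings are bijections by the count of darts, so `k′` can follow the inverse of `k`.
    τ : Permutation′ (2 * suc e)
    τ = π′ ↔-∘ ↔-sym π

    τ-fun : ∀ x → τ ⟨$⟩ʳ fun k x ≡ fun k′ x
    τ-fun x = trans (cong (π′ ⟨$⟩ʳ_) (trans (cong (Inverse.from π ∘ fun k) (sym (from-to x)))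
      (Inverse.strictlyInverseʳ π (to x)))) (cong (fun k′) (from-to x))

    onto : ∀ y → ∃ λ x → fun k x ≡ y
    onto = Pointing.hom-surjective (map M) (fun k (newEdge c)) (map-connected M) c k

    τ-commutes : (f : Core t → Core t) (g g′ : Fin (2 * suc e) → Fin (2 * suc e)) →
      (∀ x → fun k (f x) ≡ g (fun k x)) → (∀ x → fun k′ (f x) ≡ g′ (fun k′ x)) →
      ∀ y → τ ⟨$⟩ʳ g y ≡ g′ (τ ⟨$⟩ʳ y)
    τ-commutes f g g′ kf k′f y with x , refl ← onto y =
      trans (cong (τ ⟨$⟩ʳ_) (sym (kf x))) (trans (τ-fun (f x)) (trans (k′f x) (cong g′ (sym (τ-fun x)))))

    σ-hom : ∀ (M : PlanarMap (suc e)) (k : Hom (core t) (map M)) x → fun k (σ (core t) x) ≡ PlanarMap.σ M ⟨$⟩ʳ fun k x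
    σ-hom M k x = trans (φ-hom k _) (trans (cong (φ (map M)) (α-hom k x)) (map-σ M (fun k x)))

  common-core⇒iso : RootedIso (suc e) (M , fun k (newEdge c)) (M′ , fun k′ (newEdge c))
  common-core⇒iso = τ
    , τ-commutes (σ (core t)) (PlanarMap.σ M ⟨$⟩ʳ_) (PlanarMap.σ M′ ⟨$⟩ʳ_) (σ-hom M k) (σ-hom M′ k′)
    , τ-commutes (α (core t)) (PlanarMap.α M ⟨$⟩ʳ_) (PlanarMap.α M′ ⟨$⟩ʳ_) (α-hom k) (α-hom k′)
    , τ-fun (newEdge c)

iso⇒hom : ∀ {e} {M M′ : PlanarMap (suc e)} {r r′} → RootedIso (suc e) (M , r) (M′ , r′) →
          Σ (Hom (map M) (map M′)) λ h → fun h r ≡ r′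
iso⇒hom {M = M} {M′} (τ , τσ , τα , τr) = record
  { fun = τ ⟨$⟩ʳ_ ; injective = perm-injective τ
  ; φ-hom = λ x → trans (τσ _) (cong (PlanarMap.σ M′ ⟨$⟩ʳ_) (τα x)) ; α-hom = τα } , τr

-- Both trees embed at the root of the second map, the first one through the isomorphism, and
-- `pointed-unique` applies.
realise-injective : ∀ n t t′ eq eq′ → RootedIso n (realise n t eq) (realise n t′ eq′) → t ≡ t′
realise-injective zero vertex vertex _ _ _ = refl
realise-injective (suc e) t t′ eq eq′ iso =
  pointed-unique Pt.F t t′ (Pt.hom-pointed t R.c (hom-∘ (proj₁ h) R.hom) (proj₂ h)) (Pt.hom-pointed t′ R′.c R′.hom refl) refl
  where
  module R = Realise {t} eq
  module R′ = Realise {t′} eq′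
  module Pt = Pointing (map R′.planar-map) R′.root
  h : Σ (Hom (map R.planar-map) (map R′.planar-map)) λ h → fun h R.root ≡ R′.root
  h = iso⇒hom {M = R.planar-map} {R′.planar-map} iso

not-vertex⇒composite : ∀ t → t ≢ vertex → Composite t
not-vertex⇒composite vertex ≢vertex = ⊥-elim (≢vertex refl)
not-vertex⇒composite (isthmus _ _) _ = isthmus
not-vertex⇒composite (chord _ _) _ = chord

core⇒realise : ∀ {e} t (eq : edges t ≡ suc e) (M : PlanarMap (suc e)) {r} (k : Hom (core t) (map M)) →
               fun k (newEdge (composite t eq)) ≡ r → RootedIso (suc e) (realise (suc e) t eq) (M , r)
core⇒realise t eq M k refl = common-core⇒iso R.c R.size≡ R.planar-map M R.hom k
  where module R = Realise {t} eq

realise-surjective : ∀ n (M : RootedPlanarMap n) → ∃ λ t → Σ (edges t ≡ n) λ eq → RootedIso n (realise n t eq) M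
realise-surjective zero _ = vertex , refl , tt
realise-surjective (suc e) (M , r) = covered (extract-core (map-connected M) (PlanarMap.α-fpf M) (map-planar M))
  where
  open Pointing (map M) r
  covered : (∃ λ t → Σ (Hom (pointed t) X∗) λ h → fun h ∗ ≡ ∗) →
            ∃ λ t → Σ (edges t ≡ suc e) λ eq → RootedIso (suc e) (realise (suc e) t eq) (M , r)
  covered (t , h , h∗) = t , eq , core⇒realise t eq M (hom-core t h h∗) (hom-core-root t h h∗ (composite t eq))
    where
    eq : edges t ≡ suc e
    eq = ℕₚ.*-cancelˡ-≡ (edges t) (suc e) 2
      (hom-size (map-connected M) (not-vertex⇒composite t (not-vertex t h h∗)) (hom-core t h h∗))

outerDegree-iso : ∀ n t eq (M : RootedPlanarMap n) → RootedIso n (realise n t eq) M → outerDegree n M ≡ deg t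
outerDegree-iso zero vertex _ _ _ = refl
outerDegree-iso (suc e) t eq (M , r) iso =
  Pt.outer-degree t (Pt.hom-pointed t R.c (hom-∘ (proj₁ h) R.hom) (proj₂ h)) refl
  where
  module R = Realise {t} eq
  module Pt = Pointing (map M) r
  h : Σ (Hom (map R.planar-map) (map M)) λ h → fun h R.root ≡ r
  h = iso⇒hom {M = R.planar-map} {M} iso

theorem4p10 : (n d : ℕ) →
    Σ (NormalTerm n d → RootedMap n d) λ f →
    (∀ (M : RootedMap n d) → Σ (NormalTerm n d) λ t → RootedIso n (proj₁ (f t)) (proj₁ M)) ×
    (∀ (t t' : NormalTerm n d) → RootedIso n (proj₁ (f t)) (proj₁ (f t')) → t ≡ t')
theorem4p10 n d = f , f-surjective , f-injective
  where
  f : NormalTerm n d → RootedMap n d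
  f T with t , edges≡ , deg≡ ← tree T = realise n t edges≡ , trans (outerDegree-realise n t edges≡) deg≡

  f-surjective : ∀ (M : RootedMap n d) → Σ (NormalTerm n d) λ T → RootedIso n (proj₁ (f T)) (proj₁ M)
  f-surjective (M , M-degree)
    with t , edges≡ , iso ← realise-surjective n M
    with T , refl ← tree-surjective t edges≡ (trans (sym (outerDegree-iso n t edges≡ M iso)) M-degree) =
    -- `tree T` brings its own proof of the edge count, on which `realise` formally depends;
    -- irrelevance identifies it with the given one.
    T , subst (λ eq → RootedIso n (realise n (proj₁ (tree T)) eq) M) (ℕₚ.≡-irrelevant _ _) iso

  f-injective : ∀ (T T′ : NormalTerm n d) → RootedIso n (proj₁ (f T)) (proj₁ (f T′)) → T ≡ T′
  f-injective T T′ iso = tree-injective T T′ (realise-injective n _ _ _ _ iso)
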